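{- There is an absolute constant $C>0$ such that for all sufficiently large $n$ and every convex set $S\subseteq\{0,\pm1\}^n$, $\mathbb{I}(S)\le C\,n^{3/4}\log^{1/4}n$; that is, $\mathbb{I}(S)=O(n^{3/4}\log^{1/4}n)$.
   Context: A set $S\subseteq\{0,\pm1\}^n$ is called convex (discrete convex) if $S=\mathrm{Conv}(S)\cap\{0,\pm1\}^n$, where $\mathrm{Conv}(S)\subseteq\mathbb{R}^n$ is the convex hull. The edge set of the ternary hypercube is the set $E$ of pairs $(x,y)$ of points of $\{0,\pm1\}^n$ with $\sum_{i=1}^n|x_i-y_i|=1$, each edge being counted once, so that $|E|=2n\cdot 3^{n-1}$. Identify $S$ with its indicator function ($S(x)=1$ if $x\in S$, else $0$). The influence of $S$ is $$\mathbb{I}(S)=\frac{1}{3^n}\,\bigl|\{(u,v)\in E: S(u)\ne S(v)\}\bigr|.$$ -}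

module Defs where

open import Data.Bool using (Bool; T)
open import Data.Bool.Properties using () renaming (_≟_ to _≟ᵇ_)
open import Data.Fin using (Fin)
open import Data.Integer as ℤ using (ℤ; +_)
import Data.Integer.Properties as ℤP
open import Data.List as List using (List; []; _∷_; _++_; cartesianProductWith; filter; length)
open import Data.Nat as ℕ using (ℕ; zero; suc)
import Data.Nat.Properties as ℕP
open import Data.Nat.Induction using (<-rec)
open import Data.Nat.Logarithm
open import Data.Integer.Tactic.RingSolver using (solve-∀)
open import Data.Product using (_×_; _,_; ∃-syntax; proj₁; proj₂)
open import Data.Rational as ℚ using (ℚ; 0ℚ; 1ℚ; ½; mkℚ)
import Data.Rational.Properties as ℚP
open import Data.Rational.Solver using (module +-*-Solver)
import Data.Rational.Unnormalised as ℚᵘ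
import Data.Rational.Unnormalised.Properties as ℚᵘP
open import Data.Sum using (inj₁; inj₂)
open import Data.Vec as Vec using (Vec; []; _∷_; lookup)
open import Data.Vec.Functional using (Vector; foldr)
open import Function using (_⇔_)
open import Relation.Binary.PropositionalEquality
open import Relation.Nullary using (¬_; ¬?; Dec; yes; no; contradiction)

-- Real numbers: Cauchy sequences of rationals, compared by _≃_ below.

record ℝ : Set where
  constructor mkℝ
  field
    seq    : ℕ → ℚ
    cauchy : ∀ ε → 0ℚ ℚ.< ε → ∃[ N ] ∀ m n → N ℕ.≤ m → N ℕ.≤ n →
             ℚ.∣ seq m ℚ.- seq n ∣ ℚ.≤ ε

open ℝ public

infix  4 _≤_ _≃_
infixl 6 _+_
infixr 7 _·_

_≤_ : ℝ → ℝ → Set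
x ≤ y = ∀ ε → 0ℚ ℚ.< ε → ∃[ N ] ∀ n → N ℕ.≤ n → seq x n ℚ.≤ seq y n ℚ.+ ε

_≃_ : ℝ → ℝ → Set
x ≃ y = x ≤ y × y ≤ x

fromℚ : ℚ → ℝ
fromℚ q = mkℝ (λ _ → q) cau
  where
  abstract
    cau : ∀ ε → 0ℚ ℚ.< ε → ∃[ N ] ∀ m n → N ℕ.≤ m → N ℕ.≤ n → ℚ.∣ q ℚ.- q ∣ ℚ.≤ ε
    cau ε 0<ε = 0 , λ _ _ _ _ → subst (ℚ._≤ ε) (sym (cong ℚ.∣_∣ (ℚP.+-inverseʳ q))) (ℚP.<⇒≤ 0<ε)

_+_ : ℝ → ℝ → ℝ
x + y = mkℝ (λ n → seq x n ℚ.+ seq y n) cau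
  where
  rearrange : ∀ a b c d → (a ℚ.+ b) ℚ.- (c ℚ.+ d) ≡ (a ℚ.- c) ℚ.+ (b ℚ.- d)
  rearrange = solve 4 (λ a b c d → (a :+ b) :- (c :+ d) := (a :- c) :+ (b :- d)) refl
    where open +-*-Solver

  halves : ∀ ε → ε ℚ.* ½ ℚ.+ ε ℚ.* ½ ≡ ε
  halves ε = trans (sym (ℚP.*-distribˡ-+ ε ½ ½)) (ℚP.*-identityʳ ε)

  abstract
    cau : ∀ ε → 0ℚ ℚ.< ε → ∃[ N ] ∀ m n → N ℕ.≤ m → N ℕ.≤ n →
          ℚ.∣ (seq x m ℚ.+ seq y m) ℚ.- (seq x n ℚ.+ seq y n) ∣ ℚ.≤ ε
    cau ε 0<ε with cauchy x (ε ℚ.* ½) (ℚP.*-monoˡ-<-pos ½ 0<ε) | cauchy y (ε ℚ.* ½) (ℚP.*-monoˡ-<-pos ½ 0<ε)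
    ... | M , f | N , g = M ℕ.⊔ N , λ m n p q → begin
      ℚ.∣ (seq x m ℚ.+ seq y m) ℚ.- (seq x n ℚ.+ seq y n) ∣
        ≡⟨ cong ℚ.∣_∣ (rearrange (seq x m) (seq y m) (seq x n) (seq y n)) ⟩
      ℚ.∣ (seq x m ℚ.- seq x n) ℚ.+ (seq y m ℚ.- seq y n) ∣
        ≤⟨ ℚP.∣p+q∣≤∣p∣+∣q∣ (seq x m ℚ.- seq x n) (seq y m ℚ.- seq y n) ⟩
      ℚ.∣ seq x m ℚ.- seq x n ∣ ℚ.+ ℚ.∣ seq y m ℚ.- seq y n ∣
        ≤⟨ ℚP.+-mono-≤
             (f m n (ℕP.m⊔n≤o⇒m≤o M N p) (ℕP.m⊔n≤o⇒m≤o M N q))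
             (g m n (ℕP.m⊔n≤o⇒n≤o M N p) (ℕP.m⊔n≤o⇒n≤o M N q)) ⟩
      ε ℚ.* ½ ℚ.+ ε ℚ.* ½ ≡⟨ halves ε ⟩
      ε ∎
      where open ℚP.≤-Reasoning

_·_ : ℚ → ℝ → ℝ
q · x = mkℝ (λ n → q ℚ.* seq x n) cau
  where
  M : ℚ
  M = 1ℚ ℚ.+ ℚ.∣ q ∣

  instance
    M-pos : ℚ.Positive M
    M-pos = ℚ.positive (ℚP.<-≤-trans (ℚP.positive⁻¹ 1ℚ)
      (subst (ℚ._≤ M) (ℚP.+-identityʳ 1ℚ) (ℚP.+-monoʳ-≤ 1ℚ (ℚP.0≤∣p∣ q))))

    M-nonZero : ℚ.NonZero M
    M-nonZero = ℚP.pos⇒nonZero M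

    1/M-pos : ℚ.Positive (ℚ.1/ M)
    1/M-pos = ℚP.1/pos⇒pos M

  ∣q∣≤M : ℚ.∣ q ∣ ℚ.≤ M
  ∣q∣≤M = subst (ℚ._≤ M) (ℚP.+-identityˡ ℚ.∣ q ∣)
            (ℚP.+-monoˡ-≤ ℚ.∣ q ∣ (ℚP.<⇒≤ (ℚP.positive⁻¹ 1ℚ)))

  factor : ∀ a b c → a ℚ.* b ℚ.- a ℚ.* c ≡ a ℚ.* (b ℚ.- c)
  factor = solve 3 (λ a b c → a :* b :- a :* c := a :* (b :- c)) refl
    where open +-*-Solver

  abstract
    cau : ∀ ε → 0ℚ ℚ.< ε → ∃[ N ] ∀ m n → N ℕ.≤ m → N ℕ.≤ n →
          ℚ.∣ q ℚ.* seq x m ℚ.- q ℚ.* seq x n ∣ ℚ.≤ ε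
    cau ε 0<ε with cauchy x (ℚ.1/ M ℚ.* ε)
                     (subst (ℚ._< ℚ.1/ M ℚ.* ε) (ℚP.*-zeroʳ (ℚ.1/ M)) (ℚP.*-monoʳ-<-pos (ℚ.1/ M) 0<ε))
    ... | N , f = N , λ m n p r → begin
      ℚ.∣ q ℚ.* seq x m ℚ.- q ℚ.* seq x n ∣ ≡⟨ cong ℚ.∣_∣ (factor q (seq x m) (seq x n)) ⟩
      ℚ.∣ q ℚ.* (seq x m ℚ.- seq x n) ∣ ≡⟨ ℚP.∣p*q∣≡∣p∣*∣q∣ q (seq x m ℚ.- seq x n) ⟩
      ℚ.∣ q ∣ ℚ.* d m n
        ≤⟨ ℚP.*-monoʳ-≤-nonNeg (d m n) {{ℚP.∣-∣-nonNeg (seq x m ℚ.- seq x n)}} ∣q∣≤M ⟩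
      M ℚ.* d m n ≤⟨ ℚP.*-monoˡ-≤-nonNeg M {{ℚP.pos⇒nonNeg M}} (f m n p r) ⟩
      M ℚ.* (ℚ.1/ M ℚ.* ε) ≡⟨ ℚP.*-assoc M (ℚ.1/ M) ε ⟨
      (M ℚ.* ℚ.1/ M) ℚ.* ε ≡⟨ cong (ℚ._* ε) (ℚP.*-inverseʳ M) ⟩
      1ℚ ℚ.* ε ≡⟨ ℚP.*-identityˡ ε ⟩
      ε ∎
      where
      open ℚP.≤-Reasoning
      d : ℕ → ℕ → ℚ
      d m n = ℚ.∣ seq x m ℚ.- seq x n ∣

∑ : ∀ {k} → Vector ℝ k → ℝ
∑ = foldr _+_ (fromℚ 0ℚ)

-- The binary logarithm, as the limit of ⌊log₂ nᵏ⌋ / k, which lies within 1/k of it;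
-- the base only affects the constant in a bound of the form O(logᶜ n).
-- (At n = 0 this gives the junk value 0.)

module _ where
  open ℕP.≤-Reasoning

  2^⌊log₂n⌋≤n : ∀ n → 0 ℕ.< n → 2 ℕ.^ ⌊log₂ n ⌋ ℕ.≤ n
  2^⌊log₂n⌋≤n = <-rec _ step
    where
    double : ∀ n → 2 ℕ.* ℕ.⌊ n /2⌋ ℕ.≤ n
    double n = begin
      2 ℕ.* ℕ.⌊ n /2⌋ ≡⟨ cong (ℕ.⌊ n /2⌋ ℕ.+_) (ℕP.+-identityʳ _) ⟩
      ℕ.⌊ n /2⌋ ℕ.+ ℕ.⌊ n /2⌋ ≤⟨ ℕP.+-monoʳ-≤ ℕ.⌊ n /2⌋ (ℕP.⌊n/2⌋≤⌈n/2⌉ n) ⟩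
      ℕ.⌊ n /2⌋ ℕ.+ ℕ.⌈ n /2⌉ ≡⟨ ℕP.⌊n/2⌋+⌈n/2⌉≡n n ⟩
      n ∎

    pred-pow : ∀ a → 2 ℕ.^ a ℕ.≤ 2 ℕ.* 2 ℕ.^ (a ℕ.∸ 1)
    pred-pow zero    = ℕ.s≤s ℕ.z≤n
    pred-pow (suc a) = ℕP.≤-refl

    step : ∀ n → (∀ {m} → m ℕ.< n → 0 ℕ.< m → 2 ℕ.^ ⌊log₂ m ⌋ ℕ.≤ m) →
           0 ℕ.< n → 2 ℕ.^ ⌊log₂ n ⌋ ℕ.≤ n
    step (suc zero)      _   _ = ℕ.s≤s ℕ.z≤n
    step n@(suc (suc k)) rec _ = begin
      2 ℕ.^ ⌊log₂ n ⌋ ≤⟨ pred-pow ⌊log₂ n ⌋ ⟩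
      2 ℕ.* 2 ℕ.^ (⌊log₂ n ⌋ ℕ.∸ 1) ≡⟨ cong (λ a → 2 ℕ.* 2 ℕ.^ a) (⌊log₂⌊n/2⌋⌋≡⌊log₂n⌋∸1 n) ⟨
      2 ℕ.* 2 ℕ.^ ⌊log₂ ℕ.⌊ n /2⌋ ⌋
        ≤⟨ ℕP.*-monoʳ-≤ 2 (rec (ℕP.⌊n/2⌋<n (suc k)) (ℕ.s≤s ℕ.z≤n)) ⟩
      2 ℕ.* ℕ.⌊ n /2⌋ ≤⟨ double n ⟩
      n ∎

  n<2^1+⌊log₂n⌋ : ∀ n → n ℕ.< 2 ℕ.^ suc ⌊log₂ n ⌋
  n<2^1+⌊log₂n⌋ n = ℕP.≰⇒> λ le → ℕP.<-irrefl refl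
    (ℕP.≤-trans (ℕP.≤-reflexive (sym (⌊log₂[2^n]⌋≡n (suc ⌊log₂ n ⌋)))) (⌊log₂⌋-mono-≤ le))

  log-compare : ∀ n k l → ⌊log₂ (n ℕ.^ suc k) ⌋ ℕ.* suc l ℕ.≤ suc ⌊log₂ (n ℕ.^ suc l) ⌋ ℕ.* suc k
  log-compare zero        k l = ℕ.z≤n
  log-compare n@(suc n-1) k l = ℕP.<⇒≤ (ℕP.≰⇒> λ le →
    ℕP.<-irrefl refl (ℕP.<-≤-trans lt (ℕP.^-monoʳ-≤ 2 le)))
    where
    a b : ℕ
    a = ⌊log₂ (n ℕ.^ suc k) ⌋
    b = suc ⌊log₂ (n ℕ.^ suc l) ⌋

    lt : 2 ℕ.^ (a ℕ.* suc l) ℕ.< 2 ℕ.^ (b ℕ.* suc k)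
    lt = begin-strict
      2 ℕ.^ (a ℕ.* suc l) ≡⟨ ℕP.^-*-assoc 2 a (suc l) ⟨
      (2 ℕ.^ a) ℕ.^ suc l
        ≤⟨ ℕP.^-monoˡ-≤ (suc l) (2^⌊log₂n⌋≤n (n ℕ.^ suc k) (ℕP.m^n>0 n (suc k))) ⟩
      (n ℕ.^ suc k) ℕ.^ suc l ≡⟨ ℕP.^-*-assoc n (suc k) (suc l) ⟩
      n ℕ.^ (suc k ℕ.* suc l) ≡⟨ cong (n ℕ.^_) (ℕP.*-comm (suc k) (suc l)) ⟩
      n ℕ.^ (suc l ℕ.* suc k) ≡⟨ ℕP.^-*-assoc n (suc l) (suc k) ⟨
      (n ℕ.^ suc l) ℕ.^ suc k <⟨ ℕP.^-monoˡ-< (suc k) (n<2^1+⌊log₂n⌋ (n ℕ.^ suc l)) ⟩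
      (2 ℕ.^ b) ℕ.^ suc k ≡⟨ ℕP.^-*-assoc 2 b (suc k) ⟩
      2 ℕ.^ (b ℕ.* suc k) ∎

module _ where
  open ℚP.≤-Reasoning

  /-split : ∀ b l → + suc b ℚ./ suc l ≡ (+ b ℚ./ suc l) ℚ.+ (+ 1 ℚ./ suc l)
  /-split b l = ℚP.toℚᵘ-injective (ℚᵘP.≃-trans
    (ℚP.toℚᵘ-fromℚᵘ (ℚᵘ.mkℚᵘ (+ suc b) l)) (ℚᵘP.≃-trans
    (ℚᵘ.*≡* (arith (+ b) (+ suc l))) (ℚᵘP.≃-trans
    (ℚᵘP.+-cong {ℚᵘ.mkℚᵘ (+ b) l} {_} {ℚᵘ.mkℚᵘ (+ 1) l}
                (ℚᵘP.≃-sym (ℚP.toℚᵘ-fromℚᵘ (ℚᵘ.mkℚᵘ (+ b) l)))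
                (ℚᵘP.≃-sym (ℚP.toℚᵘ-fromℚᵘ (ℚᵘ.mkℚᵘ (+ 1) l))))
    (ℚᵘP.≃-sym (ℚP.toℚᵘ-homo-+ (+ b ℚ./ suc l) (+ 1 ℚ./ suc l))))))
    where
    arith : ∀ b l → (ℤ.1ℤ ℤ.+ b) ℤ.* (l ℤ.* l) ≡ (b ℤ.* l ℤ.+ ℤ.1ℤ ℤ.* l) ℤ.* l
    arith = solve-∀

  /-mono : ∀ a b k l → a ℕ.* suc l ℕ.≤ b ℕ.* suc k → + a ℚ./ suc k ℚ.≤ + b ℚ./ suc l
  /-mono a b k l le = ℚP.toℚᵘ-cancel-≤ (ℚᵘP.≤-trans
    (ℚᵘP.≤-reflexive (ℚP.toℚᵘ-fromℚᵘ (ℚᵘ.mkℚᵘ (+ a) k))) (ℚᵘP.≤-trans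
    (ℚᵘ.*≤* (subst₂ ℤ._≤_ (ℤP.pos-* a (suc l)) (ℤP.pos-* b (suc k)) (ℤ.+≤+ le)))
    (ℚᵘP.≤-reflexive (ℚᵘP.≃-sym (ℚP.toℚᵘ-fromℚᵘ (ℚᵘ.mkℚᵘ (+ b) l))))))

  archimedean : ∀ ε → 0ℚ ℚ.< ε → ∃[ N ] ∀ l → N ℕ.≤ l → + 1 ℚ./ suc l ℚ.≤ ε
  archimedean (mkℚ (+ zero) d c) (ℚ.*<* (ℤ.+<+ ()))
  archimedean ε@(mkℚ (+ suc p) d c) _ = d , λ l d≤l →
    ℚP.≤-trans
      (/-mono 1 (suc p) l d (ℕP.*-mono-≤ {1} {suc p} (ℕ.s≤s ℕ.z≤n) (ℕ.s≤s d≤l)))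
      (ℚP.≤-reflexive (ℚP.fromℚᵘ-toℚᵘ ε))
  archimedean (mkℚ (ℤ.-[1+ _ ]) d c) (ℚ.*<* ())

  ∣-∣-bound : ∀ {x y ε} → x ℚ.≤ y ℚ.+ ε → y ℚ.≤ x ℚ.+ ε → ℚ.∣ x ℚ.- y ∣ ℚ.≤ ε
  ∣-∣-bound {x} {y} {ε} p q with ℚP.∣p∣≡p∨∣p∣≡-p (x ℚ.- y)
  ... | inj₁ eq = begin
    ℚ.∣ x ℚ.- y ∣ ≡⟨ eq ⟩
    x ℚ.- y ≤⟨ ℚP.+-monoˡ-≤ (ℚ.- y) p ⟩
    y ℚ.+ ε ℚ.- y ≡⟨ solve 2 (λ y ε → y :+ ε :- y := ε) refl y ε ⟩
    ε ∎
    where open +-*-Solver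
  ... | inj₂ eq = begin
    ℚ.∣ x ℚ.- y ∣ ≡⟨ eq ⟩
    ℚ.- (x ℚ.- y) ≡⟨ solve 2 (λ x y → :- (x :- y) := y :- x) refl x y ⟩
    y ℚ.- x ≤⟨ ℚP.+-monoˡ-≤ (ℚ.- x) q ⟩
    x ℚ.+ ε ℚ.- x ≡⟨ solve 2 (λ x ε → x :+ ε :- x := ε) refl x ε ⟩
    ε ∎
    where open +-*-Solver

log₂ : ℕ → ℝ
log₂ n = mkℝ s cau
  where
  s : ℕ → ℚ
  s k = + ⌊log₂ (n ℕ.^ suc k) ⌋ ℚ./ suc k

  close : ∀ ε (0<ε : 0ℚ ℚ.< ε) k l → proj₁ (archimedean ε 0<ε) ℕ.≤ l → s k ℚ.≤ s l ℚ.+ ε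
  close ε 0<ε k l q = begin
    s k ≤⟨ /-mono ⌊log₂ (n ℕ.^ suc k) ⌋ (suc ⌊log₂ (n ℕ.^ suc l) ⌋) k l (log-compare n k l) ⟩
    + suc ⌊log₂ (n ℕ.^ suc l) ⌋ ℚ./ suc l ≡⟨ /-split ⌊log₂ (n ℕ.^ suc l) ⌋ l ⟩
    s l ℚ.+ (+ 1 ℚ./ suc l) ≤⟨ ℚP.+-monoʳ-≤ (s l) (proj₂ (archimedean ε 0<ε) l q) ⟩
    s l ℚ.+ ε ∎
    where open ℚP.≤-Reasoning

  abstract
    cau : ∀ ε → 0ℚ ℚ.< ε → ∃[ N ] ∀ k l → N ℕ.≤ k → N ℕ.≤ l → ℚ.∣ s k ℚ.- s l ∣ ℚ.≤ ε
    cau ε 0<ε = proj₁ (archimedean ε 0<ε) , λ k l p q →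
      ∣-∣-bound {s k} {s l} {ε} (close ε 0<ε k l q) (close ε 0<ε l k p)

-- The fourth root of a real x ≥ 0, from the largest multiple of 1/(k+1) whose
-- fourth power is at most the k-th term of x.  (At x < 0 this gives the junk value 0.)

infixr 8 _^_

_^_ : ℚ → ℕ → ℚ
q ^ zero  = 1ℚ
q ^ suc k = q ℚ.* q ^ k

-- The largest a ≤ bound satisfying P, or 0 if there is none.
largest : ∀ {P : ℕ → Set} → (∀ a → Dec (P a)) → (bound : ℕ) → ℕ
largest P? zero    = 0
largest P? (suc b) with P? (suc b)
... | yes _ = suc b
... | no  _ = largest P? b

largest-satisfies : ∀ {P : ℕ → Set} (P? : ∀ a → Dec (P a)) b → P 0 → P (largest P? b)
largest-satisfies P? zero    p₀ = p₀
largest-satisfies P? (suc b) p₀ with P? (suc b)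
... | yes p = p
... | no  _ = largest-satisfies P? b p₀

largest-none : ∀ {P : ℕ → Set} (P? : ∀ a → Dec (P a)) b → (∀ a → ¬ P a) → largest P? b ≡ 0
largest-none P? zero    _  = refl
largest-none P? (suc b) ¬P with P? (suc b)
... | yes p = contradiction p (¬P (suc b))
... | no  _ = largest-none P? b ¬P

largest-maximal : ∀ {P : ℕ → Set} (P? : ∀ a → Dec (P a)) b → ¬ P (suc b) → ¬ P (suc (largest P? b))
largest-maximal P? zero    ¬p = ¬p
largest-maximal P? (suc b) ¬p with P? (suc b)
... | yes _ = ¬p
... | no ¬q = largest-maximal P? b ¬q

rootNumerator : ℚ → ℕ → ℕ
rootNumerator q k =
  largest (λ a → (+ a ℚ./ suc k) ^ 4 ℚ.≤? q) (suc ℤ.∣ ℚ.↥ q ∣ ℕ.* suc k)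

rootBelow rootAbove : ℚ → ℕ → ℚ
rootBelow q k = + rootNumerator q k ℚ./ suc k
rootAbove q k = + suc (rootNumerator q k) ℚ./ suc k

module _ where
  open ℚP.≤-Reasoning

  0≤a/k : ∀ a k → 0ℚ ℚ.≤ + a ℚ./ suc k
  0≤a/k a k = ℚP.nonNegative⁻¹ (+ a ℚ./ suc k) {{ℚP.normalize-nonNeg a (suc k)}}

  *-mono : ∀ {a b c d} → 0ℚ ℚ.≤ b → 0ℚ ℚ.≤ c → a ℚ.≤ b → c ℚ.≤ d → a ℚ.* c ℚ.≤ b ℚ.* d
  *-mono {a} {b} {c} {d} 0≤b 0≤c a≤b c≤d = ℚP.≤-trans
    (ℚP.*-monoʳ-≤-nonNeg c {{ℚ.nonNegative 0≤c}} a≤b)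
    (ℚP.*-monoˡ-≤-nonNeg b {{ℚ.nonNegative 0≤b}} c≤d)

  ^-nonNeg : ∀ {a} k → 0ℚ ℚ.≤ a → 0ℚ ℚ.≤ a ^ k
  ^-nonNeg     zero    _   = ℚP.<⇒≤ (ℚP.positive⁻¹ 1ℚ)
  ^-nonNeg {a} (suc k) 0≤a = subst (ℚ._≤ a ℚ.* a ^ k) (ℚP.*-zeroˡ 0ℚ)
    (*-mono {0ℚ} {a} {0ℚ} {a ^ k} 0≤a ℚP.≤-refl 0≤a (^-nonNeg k 0≤a))

  ^-mono-≤ : ∀ {a b} k → 0ℚ ℚ.≤ a → a ℚ.≤ b → a ^ k ℚ.≤ b ^ k
  ^-mono-≤         zero    _   _   = ℚP.≤-refl
  ^-mono-≤ {a} {b} (suc k) 0≤a a≤b =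
    *-mono {a} {b} {a ^ k} {b ^ k} (ℚP.≤-trans 0≤a a≤b) (^-nonNeg k 0≤a) a≤b (^-mono-≤ k 0≤a a≤b)

  ^-mono-< : ∀ {a b} k → 0ℚ ℚ.≤ a → a ℚ.< b → a ^ suc k ℚ.< b ^ suc k
  ^-mono-< {a} {b} zero    0≤a a<b =
    subst₂ ℚ._<_ (sym (ℚP.*-identityʳ a)) (sym (ℚP.*-identityʳ b)) a<b
  ^-mono-< {a} {b} (suc k) 0≤a a<b = ℚP.≤-<-trans
    (ℚP.*-monoˡ-≤-nonNeg a {{ℚ.nonNegative 0≤a}} (ℚP.<⇒≤ (^-mono-< k 0≤a a<b)))
    (ℚP.*-monoˡ-<-pos (b ^ suc k) {{ℚ.positive 0<b^}} a<b)
    where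
    0<b^ : 0ℚ ℚ.< b ^ suc k
    0<b^ = ℚP.≤-<-trans (^-nonNeg (suc k) 0≤a) (^-mono-< k 0≤a a<b)

  ^-superadditive : ∀ a b k → 0ℚ ℚ.≤ a → 0ℚ ℚ.≤ b → a ^ suc k ℚ.+ b ^ suc k ℚ.≤ (a ℚ.+ b) ^ suc k
  ^-superadditive a b k 0≤a 0≤b = begin
    a ℚ.* a ^ k ℚ.+ b ℚ.* b ^ k ≤⟨ ℚP.+-mono-≤
      (ℚP.*-monoˡ-≤-nonNeg a {{ℚ.nonNegative 0≤a}} (^-mono-≤ k 0≤a a≤a+b))
      (ℚP.*-monoˡ-≤-nonNeg b {{ℚ.nonNegative 0≤b}} (^-mono-≤ k 0≤b b≤a+b)) ⟩
    a ℚ.* (a ℚ.+ b) ^ k ℚ.+ b ℚ.* (a ℚ.+ b) ^ k ≡⟨ ℚP.*-distribʳ-+ ((a ℚ.+ b) ^ k) a b ⟨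
    (a ℚ.+ b) ℚ.* (a ℚ.+ b) ^ k ∎
    where
    a≤a+b : a ℚ.≤ a ℚ.+ b
    a≤a+b = subst (ℚ._≤ a ℚ.+ b) (ℚP.+-identityʳ a) (ℚP.+-monoʳ-≤ a 0≤b)
    b≤a+b : b ℚ.≤ a ℚ.+ b
    b≤a+b = subst (ℚ._≤ a ℚ.+ b) (ℚP.+-identityˡ b) (ℚP.+-monoˡ-≤ b 0≤a)

  p≤∣p∣ : ∀ p → p ℚ.≤ ℚ.∣ p ∣
  p≤∣p∣ p with ℚP.≤-total 0ℚ p
  ... | inj₁ 0≤p = ℚP.≤-reflexive (sym (ℚP.0≤p⇒∣p∣≡p 0≤p))
  ... | inj₂ p≤0 = ℚP.≤-trans p≤0 (ℚP.0≤∣p∣ p)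

  <-numerator : ∀ q → q ℚ.< + suc ℤ.∣ ℚ.↥ q ∣ ℚ./ 1
  <-numerator q@(mkℚ n d c) = begin-strict
    q ≤⟨ p≤∣p∣ q ⟩
    ℚ.∣ q ∣ ≡⟨ ℚP.fromℚᵘ-toℚᵘ ℚ.∣ q ∣ ⟨
    + ℤ.∣ n ∣ ℚ./ suc d ≤⟨ /-mono ℤ.∣ n ∣ ℤ.∣ n ∣ d 0 (ℕP.*-monoʳ-≤ ℤ.∣ n ∣ (ℕ.s≤s ℕ.z≤n)) ⟩
    + ℤ.∣ n ∣ ℚ./ 1 ≡⟨ ℚP.+-identityʳ (+ ℤ.∣ n ∣ ℚ./ 1) ⟨
    (+ ℤ.∣ n ∣ ℚ./ 1) ℚ.+ 0ℚ <⟨ ℚP.+-monoʳ-< (+ ℤ.∣ n ∣ ℚ./ 1) (ℚP.positive⁻¹ 1ℚ) ⟩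
    (+ ℤ.∣ n ∣ ℚ./ 1) ℚ.+ 1ℚ ≡⟨ /-split ℤ.∣ n ∣ 0 ⟨
    + suc ℤ.∣ n ∣ ℚ./ 1 ∎

  x≤x⁴ : ∀ x → 1ℚ ℚ.≤ x → x ℚ.≤ x ^ 4
  x≤x⁴ x 1≤x = subst (ℚ._≤ x ^ 4) (ℚP.*-identityʳ x)
    (ℚP.*-monoˡ-≤-nonNeg x {{ℚ.nonNegative (ℚP.≤-trans 0≤1 1≤x)}} (^-mono-≤ {1ℚ} 3 0≤1 1≤x))
    where
    0≤1 : 0ℚ ℚ.≤ 1ℚ
    0≤1 = ℚP.<⇒≤ (ℚP.positive⁻¹ 1ℚ)

  a⁴≤p⇒a≤t+δ : ∀ a t p q δ → 0ℚ ℚ.≤ t → 0ℚ ℚ.≤ δ →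
    a ^ 4 ℚ.≤ p → p ℚ.≤ q ℚ.+ δ ^ 4 → q ℚ.< t ^ 4 → a ℚ.≤ t ℚ.+ δ
  a⁴≤p⇒a≤t+δ a t p q δ 0≤t 0≤δ a⁴≤p p≤q+δ⁴ q<t⁴ =
    ℚP.≮⇒≥ λ lt → ℚP.<-irrefl refl (ℚP.<-trans bound⁴ (^-mono-< 3 (ℚP.+-mono-≤ 0≤t 0≤δ) lt))
    where
    bound⁴ : a ^ 4 ℚ.< (t ℚ.+ δ) ^ 4
    bound⁴ = begin-strict
      a ^ 4 ≤⟨ a⁴≤p ⟩
      p ≤⟨ p≤q+δ⁴ ⟩
      q ℚ.+ δ ^ 4 <⟨ ℚP.+-monoˡ-< (δ ^ 4) q<t⁴ ⟩
      t ^ 4 ℚ.+ δ ^ 4 ≤⟨ ^-superadditive t δ 3 0≤t 0≤δ ⟩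
      (t ℚ.+ δ) ^ 4 ∎

  m/1<x⇒q<x⁴ : ∀ q m x → q ℚ.< m → 1ℚ ℚ.≤ m → m ℚ.≤ x → q ℚ.< x ^ 4
  m/1<x⇒q<x⁴ q m x q<m 1≤m m≤x =
    ℚP.<-≤-trans q<m (ℚP.≤-trans m≤x (x≤x⁴ x (ℚP.≤-trans 1≤m m≤x)))

  0⁴≤q : ∀ q z → z ≡ 0ℚ → 0ℚ ℚ.≤ q → z ^ 4 ℚ.≤ q
  0⁴≤q q z refl 0≤q = 0≤q

  module _ (q : ℚ) (k : ℕ) where
    private
      m : ℕ
      m = suc ℤ.∣ ℚ.↥ q ∣

      P : ℕ → Set
      P a = (+ a ℚ./ suc k) ^ 4 ℚ.≤ q

      P? : ∀ a → Dec (P a)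
      P? a = (+ a ℚ./ suc k) ^ 4 ℚ.≤? q

    rootBelow-lower : 0ℚ ℚ.≤ q → rootBelow q k ^ 4 ℚ.≤ q
    rootBelow-lower 0≤q = largest-satisfies {P} P? (m ℕ.* suc k)
      (0⁴≤q q (+ 0 ℚ./ suc k) (ℚP.0/n≡0 (suc k)) 0≤q)

    rootBelow-negative : q ℚ.< 0ℚ → rootBelow q k ≡ 0ℚ
    rootBelow-negative q<0 = trans (cong (λ a → + a ℚ./ suc k) none) (ℚP.0/n≡0 (suc k))
      where
      none : rootNumerator q k ≡ 0
      none = largest-none {P} P? (m ℕ.* suc k) λ a p →
        ℚP.<-irrefl refl (ℚP.≤-<-trans (ℚP.≤-trans (^-nonNeg 4 (0≤a/k a k)) p) q<0)

    rootAbove-upper : q ℚ.< rootAbove q k ^ 4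
    rootAbove-upper = ℚP.≰⇒> (largest-maximal {P} P? (m ℕ.* suc k)
        λ le → ℚP.<-irrefl refl (ℚP.<-≤-trans beyond le))
      where
      beyond : q ℚ.< (+ suc (m ℕ.* suc k) ℚ./ suc k) ^ 4
      beyond = m/1<x⇒q<x⁴ q (+ m ℚ./ 1) (+ suc (m ℕ.* suc k) ℚ./ suc k) (<-numerator q)
        (/-mono 1 m 0 0 (ℕ.s≤s ℕ.z≤n))
        (/-mono m (suc (m ℕ.* suc k)) 0 k
          (subst (m ℕ.* suc k ℕ.≤_) (sym (ℕP.*-identityʳ _)) (ℕP.n≤1+n _)))

    0≤rootBelow : 0ℚ ℚ.≤ rootBelow q k
    0≤rootBelow = 0≤a/k (rootNumerator q k) k

    0≤rootAbove : 0ℚ ℚ.≤ rootAbove q k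
    0≤rootAbove = 0≤a/k (suc (rootNumerator q k)) k

    rootAbove-split : rootAbove q k ≡ rootBelow q k ℚ.+ (+ 1 ℚ./ suc k)
    rootAbove-split = /-split (rootNumerator q k) k

  chain⁻ : ∀ u r δ → u ≡ 0ℚ → 0ℚ ℚ.≤ r → 0ℚ ℚ.≤ δ → u ℚ.≤ r ℚ.+ (δ ℚ.+ δ)
  chain⁻ u r δ refl 0≤r 0≤δ = ℚP.+-mono-≤ 0≤r (ℚP.+-mono-≤ 0≤δ 0≤δ)

  chain⁺ : ∀ u r t h δ → u ℚ.≤ t ℚ.+ δ → t ≡ r ℚ.+ h → h ℚ.≤ δ → u ℚ.≤ r ℚ.+ (δ ℚ.+ δ)
  chain⁺ u r t h δ u≤t+δ refl h≤δ = begin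
    u ≤⟨ u≤t+δ ⟩
    (r ℚ.+ h) ℚ.+ δ ≤⟨ ℚP.+-monoˡ-≤ δ (ℚP.+-monoʳ-≤ r h≤δ) ⟩
    (r ℚ.+ δ) ℚ.+ δ ≡⟨ ℚP.+-assoc r δ δ ⟩
    r ℚ.+ (δ ℚ.+ δ) ∎

  ∣-∣-upper : ∀ p q e → ℚ.∣ p ℚ.- q ∣ ℚ.≤ e → p ℚ.≤ q ℚ.+ e
  ∣-∣-upper p q e le = begin
    p ≡⟨ solve 2 (λ p q → p := q :+ (p :- q)) refl p q ⟩
    q ℚ.+ (p ℚ.- q) ≤⟨ ℚP.+-monoʳ-≤ q (ℚP.≤-trans (p≤∣p∣ (p ℚ.- q)) le) ⟩
    q ℚ.+ e ∎
    where open +-*-Solver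

  root-close : ∀ p q k l δ → 0ℚ ℚ.≤ δ → + 1 ℚ./ suc l ℚ.≤ δ → p ℚ.≤ q ℚ.+ δ ^ 4 →
    rootBelow p k ℚ.≤ rootBelow q l ℚ.+ (δ ℚ.+ δ)
  root-close p q k l δ 0≤δ 1/l≤δ p≤q+δ⁴ = by-sign (0ℚ ℚ.≤? p)
    where
    by-sign : Dec (0ℚ ℚ.≤ p) → rootBelow p k ℚ.≤ rootBelow q l ℚ.+ (δ ℚ.+ δ)
    by-sign (no 0≰p) = chain⁻ (rootBelow p k) (rootBelow q l) δ
      (rootBelow-negative p k (ℚP.≰⇒> 0≰p)) (0≤rootBelow q l) 0≤δ
    by-sign (yes 0≤p) = chain⁺ (rootBelow p k) (rootBelow q l) (rootAbove q l) (+ 1 ℚ./ suc l) δ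
      (a⁴≤p⇒a≤t+δ (rootBelow p k) (rootAbove q l) p q δ (0≤rootAbove q l) 0≤δ
        (rootBelow-lower p k 0≤p) p≤q+δ⁴ (rootAbove-upper q l))
      (rootAbove-split q l) 1/l≤δ

  ^-pos : ∀ δ → 0ℚ ℚ.< δ → 0ℚ ℚ.< δ ^ 4
  ^-pos δ 0<δ = ^-mono-< {0ℚ} {δ} 3 ℚP.≤-refl 0<δ

  root-cauchy : ∀ (x : ℝ) δ ε → 0ℚ ℚ.< δ → δ ℚ.+ δ ≡ ε → ∃[ N ] ∀ k l → N ℕ.≤ k → N ℕ.≤ l →
    ℚ.∣ rootBelow (seq x k) k ℚ.- rootBelow (seq x l) l ∣ ℚ.≤ ε
  root-cauchy x δ _ 0<δ refl = M ℕ.⊔ N , λ k l p q →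
    ∣-∣-bound {rootBelow (seq x k) k} {rootBelow (seq x l) l} {δ ℚ.+ δ} (close k l p q) (close l k q p)
    where
    M N : ℕ
    M = proj₁ (archimedean δ 0<δ)
    N = proj₁ (cauchy x (δ ^ 4) (^-pos δ 0<δ))

    close : ∀ k l → M ℕ.⊔ N ℕ.≤ k → M ℕ.⊔ N ℕ.≤ l →
      rootBelow (seq x k) k ℚ.≤ rootBelow (seq x l) l ℚ.+ (δ ℚ.+ δ)
    close k l p q = root-close (seq x k) (seq x l) k l δ (ℚP.<⇒≤ 0<δ)
      (proj₂ (archimedean δ 0<δ) l (ℕP.m⊔n≤o⇒m≤o M N q))
      (∣-∣-upper (seq x k) (seq x l) (δ ^ 4)
        (proj₂ (cauchy x (δ ^ 4) (^-pos δ 0<δ)) k l (ℕP.m⊔n≤o⇒n≤o M N p) (ℕP.m⊔n≤o⇒n≤o M N q)))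

infix 8 ∜_

∜_ : ℝ → ℝ
∜ x = mkℝ (λ k → rootBelow (seq x k) k) cau
  where
  abstract
    cau : ∀ ε → 0ℚ ℚ.< ε → ∃[ N ] ∀ k l → N ℕ.≤ k → N ℕ.≤ l →
      ℚ.∣ rootBelow (seq x k) k ℚ.- rootBelow (seq x l) l ∣ ℚ.≤ ε
    cau ε 0<ε = root-cauchy x (ε ℚ.* ½) ε (ℚP.*-monoˡ-<-pos ½ 0<ε)
      (trans (sym (ℚP.*-distribˡ-+ ε ½ ½)) (ℚP.*-identityʳ ε))

data Trit : Set where
  −1 O +1 : Trit

toℤ : Trit → ℤ
toℤ −1 = ℤ.-1ℤ
toℤ O  = ℤ.0ℤ
toℤ +1 = ℤ.1ℤ

toℚ : Trit → ℚ
toℚ t = toℤ t ℚ./ 1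

Point : ℕ → Set
Point = Vec Trit

allPoints : ∀ n → List (Point n)
allPoints zero    = [] ∷ []
allPoints (suc n) = cartesianProductWith _∷_ (−1 ∷ O ∷ +1 ∷ []) (allPoints n)

-- All pairs of entries at distinct positions, earlier entry first: each
-- unordered pair of distinct points then occurs once.
pairs : ∀ {A : Set} → List A → List (A × A)
pairs []       = []
pairs (x ∷ xs) = List.map (x ,_) xs ++ pairs xs

distance : ∀ {n} → Point n → Point n → ℕ
distance x y = Vec.sum (Vec.zipWith (λ a b → ℤ.∣ toℤ a ℤ.- toℤ b ∣) x y)

edges : ∀ n → List (Point n × Point n)
edges n = filter (λ (x , y) → distance x y ℕ.≟ 1) (pairs (allPoints n))

infix 4 _∈_ _∈Conv_

-- Subsets of the cube are identified with their indicator functions.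
Subset : ℕ → Set
Subset n = Point n → Bool

_∈_ : ∀ {n} → Point n → Subset n → Set
x ∈ S = T (S x)

embed : ∀ {n} → Point n → Vector ℝ n
embed x i = fromℚ (toℚ (lookup x i))

record _∈Conv_ {n} (x : Vector ℝ n) (S : Subset n) : Set where
  field
    size        : ℕ
    point       : Fin size → Point n
    weight      : Fin size → ℝ
    point∈S     : ∀ j → point j ∈ S
    weight≥0    : ∀ j → fromℚ 0ℚ ≤ weight j
    ∑weight≃1   : ∑ weight ≃ fromℚ 1ℚ
    combination : ∀ i → x i ≃ ∑ λ j → toℚ (lookup (point j) i) · weight j

Convex : ∀ {n} → Subset n → Set
Convex S = ∀ x → (x ∈ S) ⇔ (embed x ∈Conv S)

𝕀 : ∀ {n} → Subset n → ℚ
𝕀 {n} S = + length (filter (λ (u , v) → ¬? (S u ≟ᵇ S v)) (edges n)) ℚ./ (3 ℕ.^ n)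
  where instance _ = ℕP.m^n≢0 3 n

{-# OPTIONS --safe #-}

-- Consider the random walk on {0,±1}ⁿ that turns a random zero coordinate into a random
-- sign at every step.  When it steps out of S to a point y, take a linear functional that
-- is smaller on S than at y.  Along the rest of the walk this functional is a sum of
-- exchangeable symmetric steps, so by Sparre Andersen's theorem it stays above its value
-- at y for t steps with probability (2t choose t) / 4^t, of order 1/√t, whatever the
-- functional.  Hence every exit from S has at least this probability of being the last
-- one, and a walk of t steps crosses the boundary of S only O(√t) times on average.  The
-- edges between consecutive levels (the sets of points with a given number of nonzero
-- coordinates) that the walk uses are uniformly distributed, and the level sizes are
-- nearly constant over t ≈ √n consecutive levels, so a fraction O(1/√t) of all edges
-- crosses the boundary.  This gives the bound O(n / √t) = O(n^{3/4}), without a logarithm.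

module Submission where

-- Sparre Andersen's count does not depend on the step sizes only as long as no two partial sums
-- agree, and a functional that separates a point from `S` may well produce ties. It is therefore
-- multiplied by 3ⁿ and perturbed by distinct powers of 3. Integrality makes room for this: a
-- negative value is at most -1. Working over the integers also lets Gordan's alternative stand in
-- for separation in ℝⁿ: without a separating functional, the point is an average of points of `S`
-- with equal rational weights.
--
-- Level sizes are far from constant away from their peak, where neighbouring levels may differ by
-- large factors. Each level is therefore compared only with levels on the side of the peak. Within
-- distance t of order √n these are at least half as large, and this holds for every level of the
-- cube. The choice of t is a compromise: longer walks lower the rate 1/√t, but √n is as far as this
-- comparison reaches.
--
-- Probabilities appear as counts of walks with denominators cleared: `ν` counts all walks, and
-- powers of 4 are the denominators of Sparre Andersen's theorem.

-- Upward walks and their crossings of the boundary of a set.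

module Walk where

  open import Data.Bool using (Bool; true; false; if_then_else_)
  open import Data.Nat
  open import Data.Nat.Properties
  open import Data.Nat.Tactic.RingSolver using (solve-∀)
  open import Data.Vec using ([]; _∷_)
  open import Relation.Binary.PropositionalEquality
  open import Defs using (−1; O; +1; Point)

  zeros : ∀ {n} → Point n → ℕ
  zeros []       = 0
  zeros (O ∷ x)  = suc (zeros x)
  zeros (−1 ∷ x) = zeros x
  zeros (+1 ∷ x) = zeros x

  -- The sum of f over the points obtained from x by replacing one zero coordinate by ±1.
  U : ∀ {n} → (Point n → ℕ) → Point n → ℕ
  U f []       = 0
  U f (O ∷ x)  = f (+1 ∷ x) + f (−1 ∷ x) + U (λ y → f (O ∷ y)) x
  U f (−1 ∷ x) = U (λ y → f (−1 ∷ y)) x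
  U f (+1 ∷ x) = U (λ y → f (+1 ∷ y)) x

  U-mono : ∀ {n} {f g : Point n → ℕ} → (∀ x → f x ≤ g x) → ∀ x → U f x ≤ U g x
  U-mono f≤g []       = z≤n
  U-mono f≤g (O ∷ x)  =
    +-mono-≤ (+-mono-≤ (f≤g (+1 ∷ x)) (f≤g (−1 ∷ x))) (U-mono (λ y → f≤g (O ∷ y)) x)
  U-mono f≤g (−1 ∷ x) = U-mono (λ y → f≤g (−1 ∷ y)) x
  U-mono f≤g (+1 ∷ x) = U-mono (λ y → f≤g (+1 ∷ y)) x

  U-cong : ∀ {n} {f g : Point n → ℕ} → (∀ x → f x ≡ g x) → ∀ x → U f x ≡ U g x
  U-cong f≡g x = ≤-antisym (U-mono (λ y → ≤-reflexive (f≡g y)) x)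
                           (U-mono (λ y → ≤-reflexive (sym (f≡g y))) x)

  U-+ : ∀ {n} (f g : Point n → ℕ) x → U (λ y → f y + g y) x ≡ U f x + U g x
  U-+ f g []       = refl
  U-+ f g (O ∷ x)  = trans
    (cong (f (+1 ∷ x) + g (+1 ∷ x) + (f (−1 ∷ x) + g (−1 ∷ x)) +_)
      (U-+ (λ y → f (O ∷ y)) (λ y → g (O ∷ y)) x))
    (arith (f (+1 ∷ x)) (g (+1 ∷ x)) (f (−1 ∷ x)) (g (−1 ∷ x)) _ _)
    where
    arith : ∀ a b c d e f → a + b + (c + d) + (e + f) ≡ a + c + e + (b + d + f)
    arith = solve-∀
  U-+ f g (−1 ∷ x) = U-+ (λ y → f (−1 ∷ y)) (λ y → g (−1 ∷ y)) x
  U-+ f g (+1 ∷ x) = U-+ (λ y → f (+1 ∷ y)) (λ y → g (+1 ∷ y)) x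

  U-* : ∀ {n} c (f : Point n → ℕ) x → U (λ y → c * f y) x ≡ c * U f x
  U-* c f []       = sym (*-zeroʳ c)
  U-* c f (O ∷ x)  = trans
    (cong (c * f (+1 ∷ x) + c * f (−1 ∷ x) +_) (U-* c (λ y → f (O ∷ y)) x))
    (arith c (f (+1 ∷ x)) (f (−1 ∷ x)) _)
    where
    arith : ∀ c a b d → c * a + c * b + c * d ≡ c * (a + b + d)
    arith = solve-∀
  U-* c f (−1 ∷ x) = U-* c (λ y → f (−1 ∷ y)) x
  U-* c f (+1 ∷ x) = U-* c (λ y → f (+1 ∷ y)) x

  U-full : ∀ {n} (f : Point n → ℕ) x → zeros x ≡ 0 → U f x ≡ 0
  U-full f []       _ = refl
  U-full f (−1 ∷ x) p = U-full (λ y → f (−1 ∷ y)) x p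
  U-full f (+1 ∷ x) p = U-full (λ y → f (+1 ∷ y)) x p

  -- One step removes exactly one zero, so a weight that depends on `zeros` is constant over the
  -- successors of `x`. If `x` has no zeros, the value of `pred` is junk, but then `U` is an empty
  -- sum.
  U-zeros : ∀ {n} (g : ℕ → ℕ) (f : Point n → ℕ) x →
    U (λ y → g (zeros y) * f y) x ≡ g (pred (zeros x)) * U f x
  U-zeros g f []       = sym (*-zeroʳ (g 0))
  U-zeros g f (−1 ∷ x) = U-zeros g (λ y → f (−1 ∷ y)) x
  U-zeros g f (+1 ∷ x) = U-zeros g (λ y → f (+1 ∷ y)) x
  U-zeros g f (O ∷ x)  = trans
    (cong (g (zeros x) * f (+1 ∷ x) + g (zeros x) * f (−1 ∷ x) +_) rest)
    (arith (g (zeros x)) (f (+1 ∷ x)) (f (−1 ∷ x)) _)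
    where
    arith : ∀ c a b d → c * a + c * b + c * d ≡ c * (a + b + d)
    arith = solve-∀
    f′ : Point _ → ℕ
    f′ y = f (O ∷ y)
    rest : U (λ y → g (suc (zeros y)) * f′ y) x ≡ g (zeros x) * U f′ x
    rest with zeros x in eq | U-zeros (λ z → g (suc z)) f′ x
    ... | zero  | _  = trans (U-full _ x eq)
                         (sym (trans (cong (g 0 *_) (U-full f′ x eq)) (*-zeroʳ (g 0))))
    ... | suc z | ih = ih

  U-1 : ∀ {n} (x : Point n) → U (λ _ → 1) x ≡ 2 * zeros x
  U-1 []       = refl
  U-1 (O ∷ x)  = trans (cong (2 +_) (U-1 x)) (sym (*-suc 2 (zeros x)))
  U-1 (−1 ∷ x) = U-1 x
  U-1 (+1 ∷ x) = U-1 x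

  -- The number of t-step walks from a point with z zeros.
  ν : ℕ → ℕ → ℕ
  ν zero    z       = 1
  ν (suc t) zero    = 0
  ν (suc t) (suc z) = 2 * suc z * ν t z

  U-ν : ∀ {n} t (x : Point n) → U (λ y → ν t (zeros y)) x ≡ ν (suc t) (zeros x)
  U-ν t x = begin
    U (λ y → ν t (zeros y)) x     ≡⟨ U-cong (λ y → sym (*-identityʳ (ν t (zeros y)))) x ⟩
    U (λ y → ν t (zeros y) * 1) x ≡⟨ U-zeros (ν t) (λ _ → 1) x ⟩
    ν t (pred (zeros x)) * U (λ _ → 1) x ≡⟨ cong (ν t (pred (zeros x)) *_) (U-1 x) ⟩
    ν t (pred (zeros x)) * (2 * zeros x) ≡⟨ step (zeros x) ⟩
    ν (suc t) (zeros x) ∎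
    where
    open ≡-Reasoning
    step : ∀ z → ν t (pred z) * (2 * z) ≡ ν (suc t) z
    step zero    = *-zeroʳ (ν t 0)
    step (suc z) = *-comm (ν t z) (2 * suc z)

  module _ {n} (S : Point n → Bool) where

    inside outside : Point n → ℕ
    inside  x = if S x then 1 else 0
    outside x = if S x then 0 else 1

    -- Over all t-step walks from x: the number of those that stay outside S, the number
    -- of those that leave S and then stay outside, and the total number of exits from S.
    stay last exits : ℕ → Point n → ℕ
    stay zero    x = outside x
    stay (suc t) x = if S x then 0 else U (stay t) x
    last zero    x = 0
    last (suc t) x = (if S x then U (stay t) x else 0) + U (last t) x
    exits zero    x = 0
    exits (suc t) x = (if S x then U (λ y → ν t (zeros y) * outside y) x else 0) + U (exits t) x

    crossing : Point n → ℕ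
    crossing x = if S x then U outside x else U inside x

    crossings : ℕ → Point n → ℕ
    crossings zero    x = 0
    crossings (suc t) x = ν t (pred (zeros x)) * crossing x + U (crossings t) x

    -- A walk that ends outside `S` either never meets `S` or has exactly one last exit, so `last`
    -- and `stay` count disjoint sets of walks.
    last+stay≤ν : ∀ t x → last t x + stay t x ≤ ν t (zeros x)
    last+stay≤ν zero x with S x
    ... | true  = z≤n
    ... | false = s≤s z≤n
    last+stay≤ν (suc t) x = ≤-trans (≤-reflexive split) (≤-trans
        (≤-trans (≤-reflexive (sym (U-+ (last t) (stay t) x))) (U-mono (last+stay≤ν t) x))
        (≤-reflexive (U-ν t x)))
      where
      split : last (suc t) x + stay (suc t) x ≡ U (last t) x + U (stay t) x
      split with S x
      ... | true  = trans (+-identityʳ _) (+-comm (U (stay t) x) (U (last t) x))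
      ... | false = refl

    -- Along a walk exits and entries alternate, so entries exceed exits by at most one, and only
    -- when the walk starts outside. The summand with `inside` keeps track of the starting side for
    -- the induction.
    crossings≤2exits : ∀ t x → crossings t x + inside x * ν t (zeros x) ≤ 2 * exits t x + ν t (zeros x)
    crossings≤2exits zero x with S x
    ... | true  = ≤-refl
    ... | false = z≤n
    crossings≤2exits (suc t) x with S x
    ... | true = begin
        ν t (pred (zeros x)) * U outside x + U (crossings t) x + (ν (suc t) (zeros x) + 0)
          ≡⟨ cong₂ _+_ (cong (_+ U (crossings t) x) (sym (U-zeros (ν t) outside x))) (+-identityʳ _) ⟩
        A + U (crossings t) x + ν (suc t) (zeros x)
          ≤⟨ +-monoˡ-≤ _ (+-monoʳ-≤ A (U-mono bound x)) ⟩
        A + U (λ y → ν t (zeros y) * outside y + 2 * exits t y) x + ν (suc t) (zeros x)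
          ≡⟨ cong (λ z → A + z + ν (suc t) (zeros x)) (trans (U-+ (λ y → ν t (zeros y) * outside y) (λ y → 2 * exits t y) x)
               (cong (A +_) (U-* 2 (exits t) x))) ⟩
        A + (A + 2 * U (exits t) x) + ν (suc t) (zeros x)
          ≡⟨ cong (_+ ν (suc t) (zeros x)) (arith A (U (exits t) x)) ⟩
        2 * (A + U (exits t) x) + ν (suc t) (zeros x) ∎
      where
      open ≤-Reasoning
      A : ℕ
      A = U (λ y → ν t (zeros y) * outside y) x
      arith : ∀ a b → a + (a + 2 * b) ≡ 2 * (a + b)
      arith = solve-∀
      -- A step to a `y` outside is itself an exit; it pays for the one crossing by which a walk
      -- from outside may exceed twice its exits.
      bound : ∀ y → crossings t y ≤ ν t (zeros y) * outside y + 2 * exits t y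
      bound y with S y | crossings≤2exits t y
      ... | true  | ih = ≤-trans
        (+-cancelʳ-≤ (ν t (zeros y)) (crossings t y) (2 * exits t y)
          (subst (λ z → crossings t y + z ≤ 2 * exits t y + ν t (zeros y)) (+-identityʳ _) ih))
        (m≤n+m (2 * exits t y) (ν t (zeros y) * 0))
      ... | false | ih = subst₂ _≤_ (+-identityʳ (crossings t y))
        (trans (+-comm (2 * exits t y) (ν t (zeros y)))
               (cong (_+ 2 * exits t y) (sym (*-identityʳ (ν t (zeros y)))))) ih
    ... | false = begin
        ν t (pred (zeros x)) * U inside x + U (crossings t) x + 0
          ≡⟨ trans (+-identityʳ _) (cong (_+ U (crossings t) x) (sym (U-zeros (ν t) inside x))) ⟩
        U (λ y → ν t (zeros y) * inside y) x + U (crossings t) x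
          ≡⟨ U-+ (λ y → ν t (zeros y) * inside y) (crossings t) x ⟨
        U (λ y → ν t (zeros y) * inside y + crossings t y) x
          ≤⟨ U-mono (λ y → ≤-trans (≤-reflexive (trans (+-comm _ (crossings t y))
               (cong (crossings t y +_) (*-comm (ν t (zeros y)) (inside y))))) (crossings≤2exits t y)) x ⟩
        U (λ y → 2 * exits t y + ν t (zeros y)) x
          ≡⟨ U-+ (λ y → 2 * exits t y) (λ y → ν t (zeros y)) x ⟩
        U (λ y → 2 * exits t y) x + U (λ y → ν t (zeros y)) x
          ≡⟨ cong₂ _+_ (U-* 2 (exits t) x) (U-ν t x) ⟩
        2 * U (exits t) x + ν (suc t) (zeros x) ∎
      where open ≤-Reasoning

    module _ (a : ℕ → ℕ) (a₀≤1 : a 0 ≤ 1) (a-step : ∀ t → a (suc t) ≤ 4 * a t)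
             (stay-bound : ∀ t x → S x ≡ false → a t * ν t (zeros x) ≤ 4 ^ t * stay t x) where

      -- An exit with s steps left is the last one with probability at least `a s / 4 ^ s`. By
      -- `a-step` this ratio never increases with s, so `a t / 4 ^ t` serves for every exit of a
      -- walk of t steps.
      exits≤last : ∀ t x → a t * exits t x ≤ 4 ^ t * last t x
      exits≤last zero x = ≤-reflexive (*-zeroʳ (a 0))
      exits≤last (suc t) x = begin
        a (suc t) * exits (suc t) x ≤⟨ *-monoˡ-≤ (exits (suc t) x) (a-step t) ⟩
        4 * a t * exits (suc t) x ≡⟨ *-assoc 4 (a t) _ ⟩
        4 * (a t * exits (suc t) x) ≤⟨ *-monoʳ-≤ 4 main ⟩
        4 * (4 ^ t * last (suc t) x) ≡⟨ *-assoc 4 (4 ^ t) _ ⟨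
        4 ^ suc t * last (suc t) x ∎
        where
        open ≤-Reasoning
        leave : ∀ y → a t * (ν t (zeros y) * outside y) ≤ 4 ^ t * stay t y
        leave y with S y in eq
        ... | true  = ≤-trans (≤-reflexive (trans (cong (a t *_) (*-zeroʳ (ν t (zeros y)))) (*-zeroʳ (a t)))) z≤n
        ... | false = ≤-trans (≤-reflexive (cong (a t *_) (*-identityʳ _))) (stay-bound t y eq)
        rest : a t * U (exits t) x ≤ 4 ^ t * U (last t) x
        rest = subst₂ _≤_ (U-* (a t) (exits t) x) (U-* (4 ^ t) (last t) x) (U-mono (exits≤last t) x)
        main : a t * exits (suc t) x ≤ 4 ^ t * last (suc t) x
        main with S x
        ... | false = rest
        ... | true  = subst₂ _≤_ (sym (*-distribˡ-+ (a t) _ _)) (sym (*-distribˡ-+ (4 ^ t) _ _))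
          (+-mono-≤ (subst₂ _≤_ (U-* (a t) _ x) (U-* (4 ^ t) (stay t) x) (U-mono leave x)) rest)

      a≤4^ : ∀ t → a t ≤ 4 ^ t
      a≤4^ zero    = a₀≤1
      a≤4^ (suc t) = ≤-trans (a-step t) (*-monoʳ-≤ 4 (a≤4^ t))

      -- At most one exit per walk is the last, so there are at most `4 ^ t / a t` exits on average.
      -- The factor 3 is 2 for these exits and 1 for an entry that precedes them all.
      crossings-bound : ∀ t x → a t * crossings t x ≤ 3 * 4 ^ t * ν t (zeros x)
      crossings-bound t x = begin
        a t * crossings t x ≤⟨ *-monoʳ-≤ (a t) (≤-trans (m≤m+n _ _) (crossings≤2exits t x)) ⟩
        a t * (2 * exits t x + ν t (zeros x)) ≡⟨ arith₁ (a t) (exits t x) (ν t (zeros x)) ⟩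
        2 * (a t * exits t x) + a t * ν t (zeros x)
          ≤⟨ +-mono-≤ (*-monoʳ-≤ 2 (≤-trans (exits≤last t x)
               (*-monoʳ-≤ (4 ^ t) (≤-trans (m≤m+n _ _) (last+stay≤ν t x)))))
               (*-monoˡ-≤ (ν t (zeros x)) (a≤4^ t)) ⟩
        2 * (4 ^ t * ν t (zeros x)) + 4 ^ t * ν t (zeros x) ≡⟨ arith₂ (4 ^ t) (ν t (zeros x)) ⟩
        3 * 4 ^ t * ν t (zeros x) ∎
        where
        open ≤-Reasoning
        arith₁ : ∀ a e v → a * (2 * e + v) ≡ 2 * (a * e) + a * v
        arith₁ = solve-∀
        arith₂ : ∀ p v → 2 * (p * v) + p * v ≡ 3 * p * v
        arith₂ = solve-∀

-- Finite sums and central binomial coefficients.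

module Sums where

  open import Data.Nat
  open import Data.Nat.Combinatorics using (_C_; nCk≡n!/k![n-k]!; k![n∸k]!∣n!)
  open import Data.Nat.DivMod using (m/n*n≡m)
  open import Data.Nat.Properties
  open import Data.Nat.Tactic.RingSolver using (solve-∀)
  open import Function using (_∘_)
  open import Relation.Binary.PropositionalEquality

  Σ< : ℕ → (ℕ → ℕ) → ℕ
  Σ< zero    f = 0
  Σ< (suc n) f = f 0 + Σ< n (f ∘ suc)

  Σ<-cong : ∀ n {f g : ℕ → ℕ} → (∀ i → i < n → f i ≡ g i) → Σ< n f ≡ Σ< n g
  Σ<-cong zero    f≡g = refl
  Σ<-cong (suc n) f≡g = cong₂ _+_ (f≡g 0 (s≤s z≤n)) (Σ<-cong n (λ i i<n → f≡g (suc i) (s≤s i<n)))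

  Σ<-mono : ∀ n {f g : ℕ → ℕ} → (∀ i → i < n → f i ≤ g i) → Σ< n f ≤ Σ< n g
  Σ<-mono zero    f≤g = z≤n
  Σ<-mono (suc n) f≤g = +-mono-≤ (f≤g 0 (s≤s z≤n)) (Σ<-mono n (λ i i<n → f≤g (suc i) (s≤s i<n)))

  Σ<-+ : ∀ n (f g : ℕ → ℕ) → Σ< n (λ i → f i + g i) ≡ Σ< n f + Σ< n g
  Σ<-+ zero    f g = refl
  Σ<-+ (suc n) f g = trans (cong (f 0 + g 0 +_) (Σ<-+ n (f ∘ suc) (g ∘ suc)))
    (arith (f 0) (g 0) _ _)
    where
    arith : ∀ a b c d → (a + b) + (c + d) ≡ (a + c) + (b + d)
    arith = solve-∀

  Σ<-* : ∀ n c (f : ℕ → ℕ) → Σ< n (λ i → c * f i) ≡ c * Σ< n f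
  Σ<-* zero    c f = sym (*-zeroʳ c)
  Σ<-* (suc n) c f = trans (cong (c * f 0 +_) (Σ<-* n c (f ∘ suc))) (sym (*-distribˡ-+ c (f 0) _))

  Σ<-zero : ∀ n → Σ< n (λ _ → 0) ≡ 0
  Σ<-zero zero    = refl
  Σ<-zero (suc n) = Σ<-zero n

  Σ<-const : ∀ n c → Σ< n (λ _ → c) ≡ n * c
  Σ<-const zero    c = refl
  Σ<-const (suc n) c = cong (c +_) (Σ<-const n c)

  Σ<-split : ∀ m n (f : ℕ → ℕ) → Σ< (m + n) f ≡ Σ< m f + Σ< n (λ i → f (m + i))
  Σ<-split zero    n f = refl
  Σ<-split (suc m) n f = trans (cong (f 0 +_) (Σ<-split m n (f ∘ suc))) (sym (+-assoc (f 0) _ _))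

  Σ<-last : ∀ n (f : ℕ → ℕ) → Σ< (suc n) f ≡ Σ< n f + f n
  Σ<-last zero    f = +-comm (f 0) 0
  Σ<-last (suc n) f = trans (cong (f 0 +_) (Σ<-last n (f ∘ suc))) (sym (+-assoc (f 0) _ _))

  Σ<-swap : ∀ m n (f : ℕ → ℕ → ℕ) → Σ< m (λ i → Σ< n (f i)) ≡ Σ< n (λ j → Σ< m (λ i → f i j))
  Σ<-swap zero    n f = sym (Σ<-zero n)
  Σ<-swap (suc m) n f = trans (cong (Σ< n (f 0) +_) (Σ<-swap m n (f ∘ suc))) (sym (Σ<-+ n (f 0) _))

  Σ<-reverse : ∀ n (f : ℕ → ℕ) → Σ< (suc n) f ≡ Σ< (suc n) (λ i → f (n ∸ i))
  Σ<-reverse zero    f = refl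
  Σ<-reverse (suc n) f = trans (Σ<-last (suc n) f)
    (trans (+-comm (Σ< (suc n) f) (f (suc n))) (cong (f (suc n) +_) (Σ<-reverse n f)))

  centralBinomial : ℕ → ℕ
  centralBinomial t = (t + t) C t

  centralBinomial-! : ∀ t → centralBinomial t * (t ! * t !) ≡ (t + t) !
  centralBinomial-! t = begin
    centralBinomial t * (t ! * t !)
      ≡⟨ cong (λ k → centralBinomial t * (t ! * k !)) (m+n∸n≡m t t) ⟨
    centralBinomial t * (t ! * (t + t ∸ t) !)
      ≡⟨ cong (_* (t ! * (t + t ∸ t) !)) (nCk≡n!/k![n-k]! (m≤m+n t t)) ⟩
    ((t + t) ! / (t ! * (t + t ∸ t) !)) * (t ! * (t + t ∸ t) !)
      ≡⟨ m/n*n≡m (k![n∸k]!∣n! (m≤m+n t t)) ⟩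
    (t + t) ! ∎
    where
    open ≡-Reasoning
    instance _ = t !* (t + t ∸ t) !≢0

  centralBinomial-step : ∀ t → suc t * centralBinomial (suc t) ≡ (4 * t + 2) * centralBinomial t
  centralBinomial-step t = *-cancelʳ-≡ _ _ (suc t * (t ! * t !)) (begin
    suc t * b′ * (suc t * (t ! * t !)) ≡⟨ arith₁ t b′ (t !) ⟩
    b′ * (suc t * t ! * (suc t * t !)) ≡⟨ centralBinomial-! (suc t) ⟩
    (suc t + suc t) ! ≡⟨ cong (λ k → suc k !) (+-suc t t) ⟩
    suc (suc (t + t)) * (suc (t + t) * (t + t) !)
      ≡⟨ cong (λ k → suc (suc (t + t)) * (suc (t + t) * k)) (centralBinomial-! t) ⟨
    suc (suc (t + t)) * (suc (t + t) * (b * (t ! * t !))) ≡⟨ arith₂ t b (t !) ⟩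
    (4 * t + 2) * b * (suc t * (t ! * t !)) ∎)
    where
    open ≡-Reasoning
    b b′ : ℕ
    b  = centralBinomial t
    b′ = centralBinomial (suc t)
    instance
      t!t!≢0 : NonZero (t ! * t !)
      t!t!≢0 = t !* t !≢0
      product≢0 : NonZero (suc t * (t ! * t !))
      product≢0 = m*n≢0 (suc t) (t ! * t !)
    arith₁ : ∀ t b f → suc t * b * (suc t * (f * f)) ≡ b * (suc t * f * (suc t * f))
    arith₁ = solve-∀
    arith₂ : ∀ t b f → suc (suc (t + t)) * (suc (t + t) * (b * (f * f))) ≡ (4 * t + 2) * b * (suc t * (f * f))
    arith₂ = solve-∀

  centralBinomial-≤ : ∀ t → centralBinomial (suc t) ≤ 4 * centralBinomial t
  centralBinomial-≤ t = *-cancelˡ-≤ (suc t) (begin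
    suc t * centralBinomial (suc t) ≡⟨ centralBinomial-step t ⟩
    (4 * t + 2) * centralBinomial t ≤⟨ *-monoˡ-≤ (centralBinomial t) (m≤m+n (4 * t + 2) 2) ⟩
    (4 * t + 2 + 2) * centralBinomial t ≡⟨ arith t (centralBinomial t) ⟩
    suc t * (4 * centralBinomial t) ∎)
    where
    open ≤-Reasoning
    arith : ∀ t b → (4 * t + 2 + 2) * b ≡ suc t * (4 * b)
    arith = solve-∀

  -- For t ≥ 1 the coefficient is at least 4^t / (2 √t): the square of its quotient by 4^t,
  -- multiplied by t, starts at 1/4 and increases, because 16 t (t + 1) < (4 t + 2)².
  centralBinomial-lower : ∀ t → 16 ^ suc t ≤ 4 * suc t * (centralBinomial (suc t) * centralBinomial (suc t))
  centralBinomial-lower zero    = ≤-refl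
  centralBinomial-lower (suc t) = *-cancelˡ-≤ (suc (suc t) * suc t) (begin
    suc (suc t) * suc t * (16 * 16 ^ suc t) ≡⟨ arith₁ t (16 ^ suc t) ⟩
    16 * (suc (suc t) * suc t) * 16 ^ suc t ≤⟨ *-mono-≤ (≤-trans (m≤m+n _ 4) (≤-reflexive (arith₂ t))) (centralBinomial-lower t) ⟩
    (4 * suc t + 2) * (4 * suc t + 2) * (4 * suc t * (b * b)) ≡⟨ arith₃ t b ⟩
    4 * suc t * ((4 * suc t + 2) * b * ((4 * suc t + 2) * b))
      ≡⟨ cong (λ k → 4 * suc t * (k * k)) (centralBinomial-step (suc t)) ⟨
    4 * suc t * (suc (suc t) * b′ * (suc (suc t) * b′)) ≡⟨ arith₄ t b′ ⟩
    suc (suc t) * suc t * (4 * suc (suc t) * (b′ * b′)) ∎)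
    where
    open ≤-Reasoning
    b b′ : ℕ
    b  = centralBinomial (suc t)
    b′ = centralBinomial (suc (suc t))
    arith₁ : ∀ t p → suc (suc t) * suc t * (16 * p) ≡ 16 * (suc (suc t) * suc t) * p
    arith₁ = solve-∀
    arith₂ : ∀ t → 16 * (suc (suc t) * suc t) + 4 ≡ (4 * suc t + 2) * (4 * suc t + 2)
    arith₂ = solve-∀
    arith₃ : ∀ t b → (4 * suc t + 2) * (4 * suc t + 2) * (4 * suc t * (b * b)) ≡
                     4 * suc t * ((4 * suc t + 2) * b * ((4 * suc t + 2) * b))
    arith₃ = solve-∀
    arith₄ : ∀ t b → 4 * suc t * (suc (suc t) * b * (suc (suc t) * b)) ≡
                     suc (suc t) * suc t * (4 * suc (suc t) * (b * b))
    arith₄ = solve-∀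

  -- This is the square of the power series (1 - 4x)^(-1/2). Instead of series, the sum `M` weighted
  -- by k is evaluated twice: the symmetry between k and t - k makes it t/2 times the plain sum `c`,
  -- and `centralBinomial-step` reduces it from `suc t` to `t`.
  centralBinomial-convolution : ∀ t →
    Σ< (suc t) (λ k → centralBinomial k * centralBinomial (t ∸ k)) ≡ 4 ^ t
  centralBinomial-convolution zero    = refl
  centralBinomial-convolution (suc t) = *-cancelˡ-≡ _ _ (suc t) (begin
    suc t * c (suc t) ≡⟨ double (suc t) ⟨
    -- The summand of `M (suc t)` at 0 computes to 0, which leaves the sum over `suc k`.
    2 * M (suc t) ≡⟨ cong (2 *_) (Σ<-cong (suc t) λ k _ → step k) ⟩
    2 * Σ< (suc t) (λ k → 4 * (k * (a k * a (t ∸ k))) + 2 * (a k * a (t ∸ k)))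
      ≡⟨ cong (2 *_) (trans (Σ<-+ (suc t) (λ k → 4 * (k * (a k * a (t ∸ k)))) (λ k → 2 * (a k * a (t ∸ k))))
           (cong₂ _+_ (Σ<-* (suc t) 4 (λ k → k * (a k * a (t ∸ k)))) (Σ<-* (suc t) 2 (λ k → a k * a (t ∸ k))))) ⟩
    2 * (4 * M t + 2 * c t) ≡⟨ arith₁ (M t) (c t) ⟩
    4 * (2 * M t + c t) ≡⟨ cong (λ z → 4 * (z + c t)) (double t) ⟩
    4 * (t * c t + c t) ≡⟨ cong (λ z → 4 * (t * z + z)) (centralBinomial-convolution t) ⟩
    4 * (t * 4 ^ t + 4 ^ t) ≡⟨ arith₂ t (4 ^ t) ⟩
    suc t * 4 ^ suc t ∎)
    where
    open ≡-Reasoning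
    a : ℕ → ℕ
    a = centralBinomial
    c M : ℕ → ℕ
    c t = Σ< (suc t) (λ k → a k * a (t ∸ k))
    M t = Σ< (suc t) (λ k → k * (a k * a (t ∸ k)))
    arith₁ : ∀ m c → 2 * (4 * m + 2 * c) ≡ 4 * (2 * m + c)
    arith₁ = solve-∀
    arith₂ : ∀ t p → 4 * (t * p + p) ≡ suc t * (4 * p)
    arith₂ = solve-∀
    step : ∀ k → suc k * (a (suc k) * a (t ∸ k)) ≡ 4 * (k * (a k * a (t ∸ k))) + 2 * (a k * a (t ∸ k))
    step k = trans (sym (*-assoc (suc k) (a (suc k)) (a (t ∸ k))))
      (trans (cong (_* a (t ∸ k)) (centralBinomial-step k)) (arith k (a k) (a (t ∸ k))))
      where
      arith : ∀ k x y → (4 * k + 2) * x * y ≡ 4 * (k * (x * y)) + 2 * (x * y)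
      arith = solve-∀
    double : ∀ t → 2 * M t ≡ t * c t
    double t = begin
      2 * M t ≡⟨ cong (M t +_) (+-identityʳ (M t)) ⟩
      M t + M t ≡⟨ cong (M t +_) (Σ<-reverse t (λ k → k * (a k * a (t ∸ k)))) ⟩
      M t + Σ< (suc t) (λ k → (t ∸ k) * (a (t ∸ k) * a (t ∸ (t ∸ k))))
        ≡⟨ Σ<-+ (suc t) (λ k → k * (a k * a (t ∸ k)))
             (λ k → (t ∸ k) * (a (t ∸ k) * a (t ∸ (t ∸ k)))) ⟨
      Σ< (suc t) (λ k → k * (a k * a (t ∸ k)) + (t ∸ k) * (a (t ∸ k) * a (t ∸ (t ∸ k))))
        ≡⟨ Σ<-cong (suc t) (λ { k (s≤s k≤t) → pair k k≤t }) ⟩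
      Σ< (suc t) (λ k → t * (a k * a (t ∸ k))) ≡⟨ Σ<-* (suc t) t (λ k → a k * a (t ∸ k)) ⟩
      t * c t ∎
      where
      pair : ∀ k → k ≤ t → k * (a k * a (t ∸ k)) + (t ∸ k) * (a (t ∸ k) * a (t ∸ (t ∸ k))) ≡ t * (a k * a (t ∸ k))
      pair k k≤t = begin
        k * (a k * a (t ∸ k)) + (t ∸ k) * (a (t ∸ k) * a (t ∸ (t ∸ k)))
          ≡⟨ cong (λ z → k * (a k * a (t ∸ k)) + (t ∸ k) * (a (t ∸ k) * a z)) (m∸[m∸n]≡n k≤t) ⟩
        k * (a k * a (t ∸ k)) + (t ∸ k) * (a (t ∸ k) * a k)
          ≡⟨ cong (λ z → k * (a k * a (t ∸ k)) + (t ∸ k) * z) (*-comm (a (t ∸ k)) (a k)) ⟩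
        k * (a k * a (t ∸ k)) + (t ∸ k) * (a k * a (t ∸ k)) ≡⟨ *-distribʳ-+ (a k * a (t ∸ k)) k (t ∸ k) ⟨
        (k + (t ∸ k)) * (a k * a (t ∸ k)) ≡⟨ cong (_* (a k * a (t ∸ k))) (m+[n∸m]≡n k≤t) ⟩
        t * (a k * a (t ∸ k)) ∎

-- Signed words drawn without replacement, and their symmetries.

module Words where

  open import Data.Integer as ℤ using (ℤ)
  import Data.Integer.Properties as ℤP
  open import Data.List using (List; []; _∷_; _++_)
  open import Data.Nat
  open import Data.Nat.Properties
  open import Data.Nat.Tactic.RingSolver using (solve-∀)
  open import Data.Product using (_×_; _,_; proj₁; proj₂)
  open import Relation.Binary.PropositionalEquality

  Word : Set
  Word = List ℤ

  data Pick (a : ℤ) : List ℤ → List ℤ → Set where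
    here  : ∀ {A} → Pick a A (a ∷ A)
    there : ∀ {b A B} → Pick a B A → Pick a (b ∷ B) (b ∷ A)

  picks : (ℤ → List ℤ → ℕ) → List ℤ → ℕ
  picks f []      = 0
  picks f (a ∷ A) = f a A + picks (λ b B → f b (a ∷ B)) A

  picks± : (ℤ → List ℤ → ℕ) → List ℤ → ℕ
  picks± f = picks (λ a B → f a B + f (ℤ.- a) B)

  -- The sum of F over the words of t signed letters drawn from A without replacement;
  -- the second argument of F is the list of letters left over.
  words : ℕ → List ℤ → (Word → List ℤ → ℕ) → ℕ
  words zero    A F = F [] A
  words (suc t) A F = picks± (λ v B → words t B (λ w → F (v ∷ w))) A

  interchange : ∀ a b c d → (a + b) + (c + d) ≡ (a + c) + (b + d)
  interchange = solve-∀

  picks-cong : ∀ {f g : ℤ → List ℤ → ℕ} A → (∀ a B → Pick a B A → f a B ≡ g a B) → picks f A ≡ picks g A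
  picks-cong []      f≡g = refl
  picks-cong (a ∷ A) f≡g = cong₂ _+_ (f≡g a A here) (picks-cong A (λ b B p → f≡g b (a ∷ B) (there p)))

  picks-+ : ∀ (f g : ℤ → List ℤ → ℕ) A → picks (λ a B → f a B + g a B) A ≡ picks f A + picks g A
  picks-+ f g []      = refl
  picks-+ f g (a ∷ A) = trans (cong (f a A + g a A +_) (picks-+ (λ b B → f b (a ∷ B)) (λ b B → g b (a ∷ B)) A))
    (interchange (f a A) (g a A) _ _)

  picks-* : ∀ c (f : ℤ → List ℤ → ℕ) A → picks (λ a B → c * f a B) A ≡ c * picks f A
  picks-* c f []      = sym (*-zeroʳ c)
  picks-* c f (a ∷ A) = trans (cong (c * f a A +_) (picks-* c (λ b B → f b (a ∷ B)) A))
    (sym (*-distribˡ-+ c (f a A) _))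

  picks-swap : ∀ (H : ℤ → ℤ → List ℤ → ℕ) A →
    picks (λ a B → picks (λ b C → H a b C) B) A ≡ picks (λ a B → picks (λ b C → H b a C) B) A
  picks-swap H []      = refl
  picks-swap H (c ∷ A) = begin
    P₁ + picks (λ a B → H a c B + picks (λ b C → H a b (c ∷ C)) B) A
      ≡⟨ cong (P₁ +_) (picks-+ (λ a B → H a c B) (λ a B → picks (λ b C → H a b (c ∷ C)) B) A) ⟩
    P₁ + (P₂ + picks (λ a B → picks (λ b C → H a b (c ∷ C)) B) A)
      ≡⟨ cong (λ z → P₁ + (P₂ + z)) (picks-swap (λ a b C → H a b (c ∷ C)) A) ⟩
    P₁ + (P₂ + P₃) ≡⟨ arith P₁ P₂ P₃ ⟩
    P₂ + (P₁ + P₃)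
      ≡⟨ cong (P₂ +_) (picks-+ (λ a B → H c a B) (λ a B → picks (λ b C → H b a (c ∷ C)) B) A) ⟨
    P₂ + picks (λ a B → H c a B + picks (λ b C → H b a (c ∷ C)) B) A ∎
    where
    open ≡-Reasoning
    P₁ P₂ P₃ : ℕ
    P₁ = picks (λ b C → H c b C) A
    P₂ = picks (λ a B → H a c B) A
    P₃ = picks (λ a B → picks (λ b C → H b a (c ∷ C)) B) A
    arith : ∀ a b c → a + (b + c) ≡ b + (a + c)
    arith = solve-∀

  picks±-cong : ∀ {f g : ℤ → List ℤ → ℕ} A →
    (∀ a B → Pick a B A → f a B ≡ g a B × f (ℤ.- a) B ≡ g (ℤ.- a) B) → picks± f A ≡ picks± g A
  picks±-cong A f≡g = picks-cong A λ a B p → cong₂ _+_ (proj₁ (f≡g a B p)) (proj₂ (f≡g a B p))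

  picks±-+ : ∀ (f g : ℤ → List ℤ → ℕ) A → picks± (λ a B → f a B + g a B) A ≡ picks± f A + picks± g A
  picks±-+ f g A = trans
    (picks-cong A λ a B _ → interchange (f a B) (g a B) (f (ℤ.- a) B) (g (ℤ.- a) B))
    (picks-+ (λ a B → f a B + f (ℤ.- a) B) (λ a B → g a B + g (ℤ.- a) B) A)

  picks±-* : ∀ c (f : ℤ → List ℤ → ℕ) A → picks± (λ a B → c * f a B) A ≡ c * picks± f A
  picks±-* c f A = trans
    (picks-cong A λ a B _ → sym (*-distribˡ-+ c (f a B) (f (ℤ.- a) B)))
    (picks-* c (λ a B → f a B + f (ℤ.- a) B) A)

  picks±-neg : ∀ (f : ℤ → List ℤ → ℕ) A → picks± f A ≡ picks± (λ a B → f (ℤ.- a) B) A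
  picks±-neg f A = picks-cong A λ a B _ → trans (+-comm (f a B) (f (ℤ.- a) B))
    (cong (λ z → f (ℤ.- a) B + f z B) (sym (ℤP.neg-involutive a)))

  picks±-swap : ∀ (G : ℤ → ℤ → List ℤ → ℕ) A →
    picks± (λ a B → picks± (λ b C → G a b C) B) A ≡ picks± (λ a B → picks± (λ b C → G b a C) B) A
  picks±-swap G A = begin
    picks± (λ a B → picks± (λ b C → G a b C) B) A ≡⟨ expand G ⟩
    picks (λ a B → picks (λ b C → quad G a b C) B) A
      ≡⟨ picks-swap (quad G) A ⟩
    picks (λ a B → picks (λ b C → quad G b a C) B) A
      ≡⟨ picks-cong A (λ a B _ → picks-cong B λ b C _ →
           interchange (G b a C) (G b (ℤ.- a) C) (G (ℤ.- b) a C) (G (ℤ.- b) (ℤ.- a) C)) ⟩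
    picks (λ a B → picks (λ b C → quad (λ x y → G y x) a b C) B) A ≡⟨ expand (λ x y → G y x) ⟨
    picks± (λ a B → picks± (λ b C → G b a C) B) A ∎
    where
    open ≡-Reasoning
    quad : (ℤ → ℤ → List ℤ → ℕ) → ℤ → ℤ → List ℤ → ℕ
    quad G a b C = (G a b C + G a (ℤ.- b) C) + (G (ℤ.- a) b C + G (ℤ.- a) (ℤ.- b) C)
    expand : ∀ G → picks± (λ a B → picks± (λ b C → G a b C) B) A ≡
                   picks (λ a B → picks (λ b C → quad G a b C) B) A
    expand G = picks-cong A λ a B _ → sym (picks-+ (λ b C → G a b C + G a (ℤ.- b) C)
      (λ b C → G (ℤ.- a) b C + G (ℤ.- a) (ℤ.- b) C) B)

  words-ext : ∀ t A {F G : Word → List ℤ → ℕ} → (∀ w C → F w C ≡ G w C) → words t A F ≡ words t A G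
  words-ext zero    A eq = eq [] A
  words-ext (suc t) A eq = picks±-cong A λ a B _ →
    words-ext t B (λ w → eq (a ∷ w)) , words-ext t B (λ w → eq (ℤ.- a ∷ w))

  words-+ : ∀ t A (F G : Word → List ℤ → ℕ) →
    words t A (λ w C → F w C + G w C) ≡ words t A F + words t A G
  words-+ zero    A F G = refl
  words-+ (suc t) A F G = trans
    (picks±-cong A λ a B _ → words-+ t B (λ w → F (a ∷ w)) _ , words-+ t B (λ w → F (ℤ.- a ∷ w)) _)
    (picks±-+ (λ v B → words t B (λ w → F (v ∷ w))) (λ v B → words t B (λ w → G (v ∷ w))) A)

  words-* : ∀ t A c (F : Word → List ℤ → ℕ) → words t A (λ w C → c * F w C) ≡ c * words t A F
  words-* zero    A c F = refl
  words-* (suc t) A c F = trans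
    (picks±-cong A λ a B _ → words-* t B c (λ w → F (a ∷ w)) , words-* t B c (λ w → F (ℤ.- a ∷ w)))
    (picks±-* c (λ v B → words t B (λ w → F (v ∷ w))) A)

  -- Exchangeability: the letter drawn first may as well be written last, since `picks±-swap` moves
  -- it past one letter at a time.
  words-snoc : ∀ t A (F : Word → List ℤ → ℕ) →
    words (suc t) A F ≡ picks± (λ v B → words t B (λ w → F (w ++ v ∷ []))) A
  words-snoc zero    A F = refl
  words-snoc (suc t) A F = trans
    (picks±-cong A λ a B _ → words-snoc t B (λ w → F (a ∷ w)) , words-snoc t B (λ w → F (ℤ.- a ∷ w)))
    (picks±-swap (λ v u C → words t C (λ w → F (v ∷ w ++ u ∷ []))) A)

  -- Reversal with all signs changed. The partial sums of `flip u` are the heights of the earlier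
  -- points of the path `u` above its endpoint.
  flip : Word → Word
  flip []      = []
  flip (v ∷ w) = flip w ++ ℤ.- v ∷ []

  words-flip : ∀ t A (F : Word → List ℤ → ℕ) → words t A (λ w → F (flip w)) ≡ words t A F
  words-flip zero    A F = refl
  words-flip (suc t) A F = begin
    picks± (λ v B → words t B (λ w → F (flip w ++ ℤ.- v ∷ []))) A
      ≡⟨ picks±-cong A (λ a B _ → words-flip t B (λ w → F (w ++ ℤ.- a ∷ [])) ,
                                  words-flip t B (λ w → F (w ++ ℤ.- (ℤ.- a) ∷ []))) ⟩
    picks± (λ v B → words t B (λ w → F (w ++ ℤ.- v ∷ []))) A
      ≡⟨ picks±-neg (λ v B → words t B (λ w → F (w ++ v ∷ []))) A ⟨
    picks± (λ v B → words t B (λ w → F (w ++ v ∷ []))) A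
      ≡⟨ words-snoc t A F ⟨
    words (suc t) A F ∎
    where open ≡-Reasoning

-- Sparre Andersen's theorem for exchangeable symmetric steps.

module Sparre where

  open Walk using (ν)
  open Words
  open Sums
  open import Data.Bool using (Bool; true; false; if_then_else_; _∧_)
  open import Data.Empty using (⊥-elim)
  open import Data.Integer as ℤ using (ℤ; 0ℤ)
  import Data.Integer.Properties as ℤP
  import Data.Integer.Tactic.RingSolver as ℤSolver
  open import Data.List using (List; []; _∷_; _++_; length)
  open import Data.List.Properties using (++-assoc; ++-identityʳ)
  open import Data.Nat
  open import Data.Nat.Properties
  open import Data.Nat.Tactic.RingSolver using (solve-∀)
  open import Data.Product using (_,_)
  open import Function using (_∘_; mk⇔)
  open import Relation.Binary.Definitions using (tri<; tri≈; tri>)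
  open import Relation.Binary.PropositionalEquality
  open import Relation.Nullary using (yes; no; does; Dec)
  open import Relation.Nullary.Decidable using (does-⇔; dec-true; dec-false)

  ⟦_⟧ : Bool → ℕ
  ⟦ b ⟧ = if b then 1 else 0

  positiveFrom : ℤ → Word → Bool
  positiveFrom s []      = true
  positiveFrom s (v ∷ w) = does (0ℤ ℤ.<? s ℤ.+ v) ∧ positiveFrom (s ℤ.+ v) w

  minPrefix : Word → ℤ
  minPrefix []      = 0ℤ
  minPrefix (v ∷ w) = 0ℤ ℤ.⊓ (v ℤ.+ minPrefix w)

  nonneg : Word → Bool
  nonneg w = does (0ℤ ℤ.≤? minPrefix w)

  minPrefix≤0 : ∀ w → minPrefix w ℤ.≤ 0ℤ
  minPrefix≤0 []      = ℤP.≤-refl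
  minPrefix≤0 (v ∷ w) = ℤP.i⊓j≤i 0ℤ (v ℤ.+ minPrefix w)

  -- The number of ways to cut w at its last lowest point, where φ is the flip of the
  -- letters already passed: everything before the cut is higher, nothing after it is lower.
  cuts : Word → Word → ℕ
  cuts φ []      = ⟦ positiveFrom 0ℤ φ ⟧
  cuts φ (v ∷ w) = ⟦ positiveFrom 0ℤ φ ⟧ * ⟦ nonneg (v ∷ w) ⟧ + cuts (ℤ.- v ∷ φ) w

  -- A cut within `w` exists exactly if the past lies strictly above the minimum still to come. It
  -- is then unique: strictly higher before and nowhere lower after select the first point at which
  -- the minimum is attained. The sign of `q` tells whether this is the current point.
  cuts-value : ∀ w φ → cuts φ w ≡ ⟦ positiveFrom (ℤ.- minPrefix w) φ ⟧
  cuts-value []      φ = refl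
  cuts-value (v ∷ w) φ = trans (cong (⟦ positiveFrom 0ℤ φ ⟧ * ⟦ nonneg (v ∷ w) ⟧ +_) (cuts-value w (ℤ.- v ∷ φ)))
      (by-sign (q ℤ.<? 0ℤ))
    where
    q : ℤ
    q = v ℤ.+ minPrefix w
    shift : ℤ.- minPrefix w ℤ.+ ℤ.- v ≡ ℤ.- q
    shift = arith v (minPrefix w)
      where
      arith : ∀ v m → ℤ.- m ℤ.+ ℤ.- v ≡ ℤ.- (v ℤ.+ m)
      arith = ℤSolver.solve-∀
    by-sign : Dec (q ℤ.< 0ℤ) →
      ⟦ positiveFrom 0ℤ φ ⟧ * ⟦ nonneg (v ∷ w) ⟧ + ⟦ positiveFrom (ℤ.- minPrefix w) (ℤ.- v ∷ φ) ⟧ ≡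
      ⟦ positiveFrom (ℤ.- (0ℤ ℤ.⊓ q)) φ ⟧
    by-sign (yes q<0)
      rewrite shift
            | ℤP.i≥j⇒i⊓j≡j (ℤP.<⇒≤ q<0)
            | dec-false (0ℤ ℤ.≤? q) (ℤP.<⇒≱ q<0)
            | dec-true (0ℤ ℤ.<? ℤ.- q) (ℤP.neg-mono-< q<0)
            | *-zeroʳ ⟦ positiveFrom 0ℤ φ ⟧ = refl
    by-sign (no q≮0)
      rewrite shift
            | ℤP.i≤j⇒i⊓j≡i (ℤP.≮⇒≥ q≮0)
            | dec-false (0ℤ ℤ.<? ℤ.- q) (λ 0<-q → q≮0 (subst (ℤ._< 0ℤ) (ℤP.neg-involutive q) (ℤP.neg-mono-< 0<-q)))
            | *-identityʳ ⟦ positiveFrom 0ℤ φ ⟧ = +-identityʳ _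

  cuts-unique : ∀ w → cuts [] w ≡ 1
  cuts-unique w = cuts-value w []

  wordCount positiveCount nonnegCount : ℕ → List ℤ → ℕ
  wordCount     t A = words t A (λ _ _ → 1)
  positiveCount t A = words t A (λ w _ → ⟦ positiveFrom 0ℤ w ⟧)
  nonnegCount   t A = words t A (λ w _ → ⟦ nonneg w ⟧)

  picks±-Σ : ∀ n (f : ℕ → ℤ → List ℤ → ℕ) A →
    picks± (λ v B → Σ< n (λ k → f k v B)) A ≡ Σ< n (λ k → picks± (f k) A)
  picks±-Σ zero    f A = zeroes A
    where
    zeroes : ∀ A → picks (λ _ _ → 0) A ≡ 0
    zeroes []      = refl
    zeroes (_ ∷ A) = zeroes A
  picks±-Σ (suc n) f A = trans (picks±-+ (f 0) (λ v B → Σ< n (λ k → f (suc k) v B)) A)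
    (cong (picks± (f 0) A +_) (picks±-Σ n (f ∘ suc) A))

  -- A word with a marked cut is a word `u` whose flip has positive partial sums, followed by a word
  -- with nonnegative ones in the letters that `u` leaves over.
  words-cuts : ∀ t A φ → words t A (λ w _ → cuts φ w) ≡
    Σ< (suc t) (λ k → words k A (λ u C → ⟦ positiveFrom 0ℤ (flip u ++ φ) ⟧ * nonnegCount (t ∸ k) C))
  words-cuts zero    A φ = trans (sym (*-identityʳ _)) (sym (+-identityʳ _))
  words-cuts (suc t) A φ = begin
    words (suc t) A (λ w _ → cuts φ w)
      ≡⟨ picks±-cong A (λ a B _ → split a B , split (ℤ.- a) B) ⟩
    picks± (λ v B → c * words t B (λ w _ → ⟦ nonneg (v ∷ w) ⟧) + words t B (λ w _ → cuts (ℤ.- v ∷ φ) w)) A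
      ≡⟨ picks±-+ (λ v B → c * words t B (λ w _ → ⟦ nonneg (v ∷ w) ⟧)) (λ v B → words t B (λ w _ → cuts (ℤ.- v ∷ φ) w)) A ⟩
    picks± (λ v B → c * words t B (λ w _ → ⟦ nonneg (v ∷ w) ⟧)) A + picks± (λ v B → words t B (λ w _ → cuts (ℤ.- v ∷ φ) w)) A
      ≡⟨ cong₂ _+_ (picks±-* c (λ v B → words t B (λ w _ → ⟦ nonneg (v ∷ w) ⟧)) A)
           (trans (picks±-cong A (λ a B _ → later a B , later (ℤ.- a) B))
                  (picks±-Σ (suc t) (λ k v B → words k B (λ u C → ⟦ positiveFrom 0ℤ (flip (v ∷ u) ++ φ) ⟧ * nonnegCount (t ∸ k) C)) A)) ⟩
    Σ< (suc (suc t)) (λ k → words k A (λ u C → ⟦ positiveFrom 0ℤ (flip u ++ φ) ⟧ * nonnegCount (suc t ∸ k) C)) ∎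
    where
    open ≡-Reasoning
    c : ℕ
    c = ⟦ positiveFrom 0ℤ φ ⟧
    split : ∀ v B → words t B (λ w _ → c * ⟦ nonneg (v ∷ w) ⟧ + cuts (ℤ.- v ∷ φ) w) ≡
      c * words t B (λ w _ → ⟦ nonneg (v ∷ w) ⟧) + words t B (λ w _ → cuts (ℤ.- v ∷ φ) w)
    split v B = trans (words-+ t B (λ w _ → c * ⟦ nonneg (v ∷ w) ⟧) (λ w _ → cuts (ℤ.- v ∷ φ) w))
      (cong (_+ words t B (λ w _ → cuts (ℤ.- v ∷ φ) w)) (words-* t B c (λ w _ → ⟦ nonneg (v ∷ w) ⟧)))
    later : ∀ v B → words t B (λ w _ → cuts (ℤ.- v ∷ φ) w) ≡
      Σ< (suc t) (λ k → words k B (λ u C → ⟦ positiveFrom 0ℤ (flip (v ∷ u) ++ φ) ⟧ * nonnegCount (t ∸ k) C))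
    later v B = trans (words-cuts t B (ℤ.- v ∷ φ)) (Σ<-cong (suc t) λ k _ → words-ext k B λ u C →
      cong (λ z → ⟦ positiveFrom 0ℤ z ⟧ * nonnegCount (t ∸ k) C) (sym (++-assoc (flip u) (ℤ.- v ∷ []) φ)))

  data SignedSum : List ℤ → ℤ → Set where
    plus  : ∀ {a A} → SignedSum (a ∷ A) a
    minus : ∀ {a A} → SignedSum (a ∷ A) (ℤ.- a)
    skip  : ∀ {a A s} → SignedSum A s → SignedSum (a ∷ A) s
    plus∷  : ∀ {a A s} → SignedSum A s → SignedSum (a ∷ A) (a ℤ.+ s)
    minus∷ : ∀ {a A s} → SignedSum A s → SignedSum (a ∷ A) (ℤ.- a ℤ.+ s)

  -- The difference of two partial sums of a word in `A` is a signed sum of a nonempty sublist, so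
  -- for generic letters all partial sums of a word are distinct.
  Generic : List ℤ → Set
  Generic A = ∀ s → SignedSum A s → s ≢ 0ℤ

  comm-left : ∀ a b s → b ℤ.+ (a ℤ.+ s) ≡ a ℤ.+ (b ℤ.+ s)
  comm-left = ℤSolver.solve-∀

  pick-+ : ∀ {a A B} → Pick a B A → SignedSum A a
  pick-+ here      = plus
  pick-+ (there p) = skip (pick-+ p)

  pick-− : ∀ {a A B} → Pick a B A → SignedSum A (ℤ.- a)
  pick-− here      = minus
  pick-− (there p) = skip (pick-− p)

  pick-skip : ∀ {a A B s} → Pick a B A → SignedSum B s → SignedSum A s
  pick-skip here      σ          = skip σ
  pick-skip (there p) plus       = plus
  pick-skip (there p) minus      = minus
  pick-skip (there p) (skip σ)   = skip (pick-skip p σ)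
  pick-skip (there p) (plus∷ σ)  = plus∷ (pick-skip p σ)
  pick-skip (there p) (minus∷ σ) = minus∷ (pick-skip p σ)

  pick-+∷ : ∀ {a A B s} → Pick a B A → SignedSum B s → SignedSum A (a ℤ.+ s)
  pick-+∷ here σ = plus∷ σ
  pick-+∷ {a} {b ∷ _} (there p) plus       = subst (SignedSum _) (ℤP.+-comm b a) (plus∷ (pick-+ p))
  pick-+∷ {a} {b ∷ _} (there p) minus      = subst (SignedSum _) (ℤP.+-comm (ℤ.- b) a) (minus∷ (pick-+ p))
  pick-+∷ {a} {b ∷ _} (there p) (skip σ)   = skip (pick-+∷ p σ)
  pick-+∷ {a} {b ∷ _} (there p) (plus∷ {s = s} σ)  = subst (SignedSum _) (comm-left a b s) (plus∷ (pick-+∷ p σ))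
  pick-+∷ {a} {b ∷ _} (there p) (minus∷ {s = s} σ) = subst (SignedSum _) (comm-left a (ℤ.- b) s) (minus∷ (pick-+∷ p σ))

  pick-−∷ : ∀ {a A B s} → Pick a B A → SignedSum B s → SignedSum A (ℤ.- a ℤ.+ s)
  pick-−∷ here σ = minus∷ σ
  pick-−∷ {a} {b ∷ _} (there p) plus       = subst (SignedSum _) (ℤP.+-comm b (ℤ.- a)) (plus∷ (pick-− p))
  pick-−∷ {a} {b ∷ _} (there p) minus      = subst (SignedSum _) (ℤP.+-comm (ℤ.- b) (ℤ.- a)) (minus∷ (pick-− p))
  pick-−∷ {a} {b ∷ _} (there p) (skip σ)   = skip (pick-−∷ p σ)
  pick-−∷ {a} {b ∷ _} (there p) (plus∷ {s = s} σ)  = subst (SignedSum _) (comm-left (ℤ.- a) b s) (plus∷ (pick-−∷ p σ))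
  pick-−∷ {a} {b ∷ _} (there p) (minus∷ {s = s} σ) = subst (SignedSum _) (comm-left (ℤ.- a) (ℤ.- b) s) (minus∷ (pick-−∷ p σ))

  pick-generic : ∀ {a A B} → Pick a B A → Generic A → Generic B
  pick-generic p gen s σ = gen s (pick-skip p σ)

  pick-length : ∀ {a A B} → Pick a B A → length A ≡ suc (length B)
  pick-length here      = refl
  pick-length (there p) = cong suc (pick-length p)

  -- Equality is demanded only for leftovers that can occur. Their genericity and length are what
  -- `sparre-andersen-<` needs to apply its induction hypothesis to the part after a cut.
  words-cong : ∀ k A {F G : Word → List ℤ → ℕ} → Generic A →
    (∀ w C → Generic C → length A ≡ k + length C → F w C ≡ G w C) → words k A F ≡ words k A G
  words-cong zero    A gen eq = eq [] A gen refl
  words-cong (suc k) A {F} {G} gen eq = picks±-cong A λ a B p → below a B p , below (ℤ.- a) B p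
    where
    below : ∀ {a} v B → Pick a B A → words k B (λ w → F (v ∷ w)) ≡ words k B (λ w → G (v ∷ w))
    below v B p = words-cong k B (pick-generic p gen) λ w C genC len →
      eq (v ∷ w) C genC (trans (pick-length p) (cong suc len))

  -- The two conditions can differ only for a word with a nonempty prefix of sum -`s`, and the last
  -- hypothesis excludes such words.
  positive≡nonneg-from : ∀ t A s → 0ℤ ℤ.≤ s → (∀ x → SignedSum A x → s ℤ.+ x ≢ 0ℤ) →
    words t A (λ w _ → ⟦ positiveFrom s w ⟧) ≡ words t A (λ w _ → ⟦ does (0ℤ ℤ.≤? s ℤ.+ minPrefix w) ⟧)
  positive≡nonneg-from zero    A s 0≤s _ =
    sym (cong ⟦_⟧ (dec-true (0ℤ ℤ.≤? s ℤ.+ 0ℤ) (subst (0ℤ ℤ.≤_) (sym (ℤP.+-identityʳ s)) 0≤s)))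
  positive≡nonneg-from (suc t) A s 0≤s s+x≢0 = picks±-cong A λ a B p →
      case a B (s+x≢0 a (pick-+ p)) (λ x σ → s+x≢0 (a ℤ.+ x) (pick-+∷ p σ)) ,
      case (ℤ.- a) B (s+x≢0 (ℤ.- a) (pick-− p)) (λ x σ → s+x≢0 (ℤ.- a ℤ.+ x) (pick-−∷ p σ))
    where
    case : ∀ v B → s ℤ.+ v ≢ 0ℤ → (∀ x → SignedSum B x → s ℤ.+ (v ℤ.+ x) ≢ 0ℤ) →
      words t B (λ w _ → ⟦ positiveFrom s (v ∷ w) ⟧) ≡
      words t B (λ w _ → ⟦ does (0ℤ ℤ.≤? s ℤ.+ minPrefix (v ∷ w)) ⟧)
    case v B s+v≢0 next with ℤP.<-cmp 0ℤ (s ℤ.+ v)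
    ... | tri≈ _ 0≡s+v _ = ⊥-elim (s+v≢0 (sym 0≡s+v))
    ... | tri< 0<s+v _ _ = trans
        (words-ext t B λ w _ → cong (λ b → ⟦ b ∧ positiveFrom (s ℤ.+ v) w ⟧) (dec-true (0ℤ ℤ.<? s ℤ.+ v) 0<s+v))
        (trans (positive≡nonneg-from t B (s ℤ.+ v) (ℤP.<⇒≤ 0<s+v)
                 (λ x σ → subst (_≢ 0ℤ) (sym (ℤP.+-assoc s v x)) (next x σ)))
               (words-ext t B λ w _ → cong ⟦_⟧ (does-⇔ (mk⇔ (to w) (from w)) (0ℤ ℤ.≤? _) (0ℤ ℤ.≤? _))))
      where
      to : ∀ w → 0ℤ ℤ.≤ s ℤ.+ v ℤ.+ minPrefix w → 0ℤ ℤ.≤ s ℤ.+ (0ℤ ℤ.⊓ (v ℤ.+ minPrefix w))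
      to w le = subst (0ℤ ℤ.≤_) (sym (ℤP.mono-≤-distrib-⊓ {λ z → s ℤ.+ z} (ℤP.+-monoʳ-≤ s) 0ℤ (v ℤ.+ minPrefix w)))
        (ℤP.⊓-glb (subst (0ℤ ℤ.≤_) (sym (ℤP.+-identityʳ s)) 0≤s) (subst (0ℤ ℤ.≤_) (ℤP.+-assoc s v (minPrefix w)) le))
      from : ∀ w → 0ℤ ℤ.≤ s ℤ.+ (0ℤ ℤ.⊓ (v ℤ.+ minPrefix w)) → 0ℤ ℤ.≤ s ℤ.+ v ℤ.+ minPrefix w
      from w le = subst (0ℤ ℤ.≤_) (sym (ℤP.+-assoc s v (minPrefix w)))
        (ℤP.≤-trans le (ℤP.+-monoʳ-≤ s (ℤP.i⊓j≤j 0ℤ (v ℤ.+ minPrefix w))))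
    ... | tri> _ _ s+v<0 = words-ext t B λ w _ → trans
        (cong (λ b → ⟦ b ∧ positiveFrom (s ℤ.+ v) w ⟧) (dec-false (0ℤ ℤ.<? s ℤ.+ v) (ℤP.<-asym s+v<0)))
        (sym (cong ⟦_⟧ (dec-false (0ℤ ℤ.≤? s ℤ.+ (0ℤ ℤ.⊓ (v ℤ.+ minPrefix w))) (ℤP.<⇒≱ (negative w)))))
      where
      negative : ∀ w → s ℤ.+ (0ℤ ℤ.⊓ (v ℤ.+ minPrefix w)) ℤ.< 0ℤ
      negative w = ℤP.≤-<-trans (ℤP.≤-trans
        (ℤP.+-monoʳ-≤ s (ℤP.i⊓j≤j 0ℤ (v ℤ.+ minPrefix w)))
        (ℤP.≤-trans (ℤP.+-monoʳ-≤ s (ℤP.+-monoʳ-≤ v (minPrefix≤0 w)))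
                    (ℤP.≤-reflexive (cong (λ z → s ℤ.+ z) (ℤP.+-identityʳ v))))) s+v<0

  positive≡nonneg : ∀ t A → Generic A → positiveCount t A ≡ nonnegCount t A
  positive≡nonneg t A gen = trans
    (positive≡nonneg-from t A 0ℤ ℤP.≤-refl (λ x σ → subst (_≢ 0ℤ) (sym (ℤP.+-identityˡ x)) (gen x σ)))
    (words-ext t A λ w _ → cong (λ z → ⟦ does (0ℤ ℤ.≤? z) ⟧) (ℤP.+-identityˡ (minPrefix w)))

  wordCount≡ν : ∀ t A → wordCount t A ≡ ν t (length A)
  wordCount≡ν zero    A = refl
  wordCount≡ν (suc t) A = begin
    picks± (λ _ B → wordCount t B) A
      ≡⟨ picks-cong A (λ a B p → cong₂ _+_ (trans (wordCount≡ν t B) (cong (ν t) (sym (cong pred (pick-length p)))))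
                                           (trans (wordCount≡ν t B) (cong (ν t) (sym (cong pred (pick-length p)))))) ⟩
    picks (λ _ _ → ν t (pred (length A)) + ν t (pred (length A))) A
      ≡⟨ picks-const A _ ⟩
    length A * (ν t (pred (length A)) + ν t (pred (length A))) ≡⟨ step (length A) ⟩
    ν (suc t) (length A) ∎
    where
    open ≡-Reasoning
    picks-const : ∀ A c → picks (λ _ _ → c) A ≡ length A * c
    picks-const []      c = refl
    picks-const (a ∷ A) c = cong (c +_) (picks-const A c)
    step : ∀ z → z * (ν t (pred z) + ν t (pred z)) ≡ ν (suc t) z
    step zero    = refl
    step (suc z) = arith (suc z) (ν t z)
      where
      arith : ∀ z v → z * (v + v) ≡ 2 * z * v
      arith = solve-∀

  ν-split : ∀ k t z → k ≤ t → ν k z * ν (t ∸ k) (z ∸ k) ≡ ν t z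
  ν-split zero    t       z       _         = +-identityʳ (ν t z)
  ν-split (suc k) (suc t) zero    _         = refl
  ν-split (suc k) (suc t) (suc z) (s≤s k≤t) =
    trans (*-assoc (2 * suc z) (ν k z) _) (cong (2 * suc z *_) (ν-split k t z k≤t))

  -- Cutting every word at its last lowest point expresses 4^t through the counts for k < t
  -- and twice the count for t; the convolution identity of the central binomial
  -- coefficients does the same for them.
  sparre-andersen-< : ∀ n t → t < n → ∀ A → Generic A →
    4 ^ t * positiveCount t A ≡ ν t (length A) * centralBinomial t
  sparre-andersen-< (suc n) zero    _ A gen = refl
  sparre-andersen-< (suc n) (suc r) (s≤s r<n) A gen =
      *-cancelˡ-≡ X Y 2 (+-cancelʳ-≡ (V * R) (2 * X) (2 * Y) both)
    where
    open ≡-Reasoning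
    t z V R X Y : ℕ
    t = suc r
    z = length A
    V = ν t z
    X = 4 ^ t * positiveCount t A
    Y = V * centralBinomial t
    g f : ℕ → ℕ
    g k = centralBinomial k * centralBinomial (t ∸ k)
    R = Σ< r (g ∘ suc)
    f k = words k A (λ u C → ⟦ positiveFrom 0ℤ (flip u ++ []) ⟧ * nonnegCount (t ∸ k) C)

    -- Applied both to the k letters before a cut and to the `t ∸ k` letters after it, hence the
    -- strong induction through the bound `n`.
    IH : ∀ k → k ≤ r → ∀ B → Generic B → 4 ^ k * positiveCount k B ≡ ν k (length B) * centralBinomial k
    IH k k≤r = sparre-andersen-< n k (≤-<-trans k≤r r<n)

    ends : ∀ h → Σ< (suc t) h ≡ h 0 + (Σ< r (h ∘ suc) + h t)
    ends h = cong (h 0 +_) (Σ<-last r (h ∘ suc))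

    -- The two extreme cuts, in front of the word and behind it, both contribute the unknown
    -- `positiveCount t A`: the former by genericity, the latter by `words-flip`.
    first : f 0 ≡ positiveCount t A
    first = trans (+-identityʳ _) (sym (positive≡nonneg t A gen))

    final : f t ≡ positiveCount t A
    final = trans (words-ext t A λ u C → trans
        (cong₂ (λ φ k → ⟦ positiveFrom 0ℤ φ ⟧ * nonnegCount k C) (++-identityʳ (flip u)) (n∸n≡0 r))
        (*-identityʳ ⟦ positiveFrom 0ℤ (flip u) ⟧))
      (words-flip t A (λ u _ → ⟦ positiveFrom 0ℤ u ⟧))

    middle : ∀ k → k ≤ r → 1 ≤ k → 4 ^ t * f k ≡ V * g k
    middle k k≤r 1≤k = begin
      4 ^ t * f k ≡⟨ cong (λ e → 4 ^ e * f k) (m+[n∸m]≡n k≤t) ⟨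
      4 ^ (k + (t ∸ k)) * f k ≡⟨ cong (_* f k) (^-distribˡ-+-* 4 k (t ∸ k)) ⟩
      4 ^ k * 4 ^ (t ∸ k) * f k ≡⟨ *-assoc (4 ^ k) (4 ^ (t ∸ k)) (f k) ⟩
      4 ^ k * (4 ^ (t ∸ k) * f k) ≡⟨ cong (4 ^ k *_) inner ⟩
      4 ^ k * (M * positiveCount k A) ≡⟨ arith₁ (4 ^ k) M (positiveCount k A) ⟩
      M * (4 ^ k * positiveCount k A) ≡⟨ cong (M *_) (IH k k≤r A gen) ⟩
      M * (ν k z * centralBinomial k)
        ≡⟨ arith₂ (ν (t ∸ k) (z ∸ k)) (centralBinomial (t ∸ k)) (ν k z) (centralBinomial k) ⟩
      ν k z * ν (t ∸ k) (z ∸ k) * g k ≡⟨ cong (_* g k) (ν-split k t z k≤t) ⟩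
      V * g k ∎
      where
      k≤t : k ≤ t
      k≤t = m≤n⇒m≤1+n k≤r
      t∸k≤r : t ∸ k ≤ r
      t∸k≤r = ∸-monoʳ-≤ t 1≤k
      M : ℕ
      M = ν (t ∸ k) (z ∸ k) * centralBinomial (t ∸ k)
      arith₁ : ∀ p m c → p * (m * c) ≡ m * (p * c)
      arith₁ = solve-∀
      arith₂ : ∀ a b c d → a * b * (c * d) ≡ c * a * (d * b)
      arith₂ = solve-∀
      arith₃ : ∀ p x y → p * (x * y) ≡ p * y * x
      arith₃ = solve-∀
      letter : ∀ u C → Generic C → z ≡ k + length C →
        4 ^ (t ∸ k) * (⟦ positiveFrom 0ℤ (flip u ++ []) ⟧ * nonnegCount (t ∸ k) C) ≡ M * ⟦ positiveFrom 0ℤ (flip u) ⟧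
      letter u C genC len = begin
        4 ^ (t ∸ k) * (⟦ positiveFrom 0ℤ (flip u ++ []) ⟧ * nonnegCount (t ∸ k) C)
          ≡⟨ arith₃ (4 ^ (t ∸ k)) ⟦ positiveFrom 0ℤ (flip u ++ []) ⟧ (nonnegCount (t ∸ k) C) ⟩
        4 ^ (t ∸ k) * nonnegCount (t ∸ k) C * ⟦ positiveFrom 0ℤ (flip u ++ []) ⟧
          ≡⟨ cong₂ (λ x φ → 4 ^ (t ∸ k) * x * ⟦ positiveFrom 0ℤ φ ⟧) (sym (positive≡nonneg (t ∸ k) C genC)) (++-identityʳ (flip u)) ⟩
        4 ^ (t ∸ k) * positiveCount (t ∸ k) C * ⟦ positiveFrom 0ℤ (flip u) ⟧
          ≡⟨ cong (_* ⟦ positiveFrom 0ℤ (flip u) ⟧) (IH (t ∸ k) t∸k≤r C genC) ⟩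
        ν (t ∸ k) (length C) * centralBinomial (t ∸ k) * ⟦ positiveFrom 0ℤ (flip u) ⟧
          ≡⟨ cong (λ l → ν (t ∸ k) l * centralBinomial (t ∸ k) * ⟦ positiveFrom 0ℤ (flip u) ⟧)
               (trans (sym (m+n∸m≡n k (length C))) (cong (_∸ k) (sym len))) ⟩
        M * ⟦ positiveFrom 0ℤ (flip u) ⟧ ∎
      inner : 4 ^ (t ∸ k) * f k ≡ M * positiveCount k A
      inner = begin
        4 ^ (t ∸ k) * f k ≡⟨ words-* k A (4 ^ (t ∸ k)) _ ⟨
        words k A (λ u C → 4 ^ (t ∸ k) * (⟦ positiveFrom 0ℤ (flip u ++ []) ⟧ * nonnegCount (t ∸ k) C))
          ≡⟨ words-cong k A gen letter ⟩
        words k A (λ u _ → M * ⟦ positiveFrom 0ℤ (flip u) ⟧)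
          ≡⟨ words-* k A M (λ u _ → ⟦ positiveFrom 0ℤ (flip u) ⟧) ⟩
        M * words k A (λ u _ → ⟦ positiveFrom 0ℤ (flip u) ⟧)
          ≡⟨ cong (M *_) (words-flip k A (λ u _ → ⟦ positiveFrom 0ℤ u ⟧)) ⟩
        M * positiveCount k A ∎

    -- The number of all words and the convolution identity have the same shape: two equal end terms
    -- and a middle. The middles agree by induction, so the ends agree too.
    both : 2 * X + V * R ≡ 2 * Y + V * R
    both = begin
      2 * X + V * R
        ≡⟨ cong (2 * X +_) (trans (sym (Σ<-* r V (g ∘ suc)))
             (sym (trans (sym (Σ<-* r (4 ^ t) (f ∘ suc))) (Σ<-cong r λ i i<r → middle (suc i) i<r (s≤s z≤n))))) ⟩
      2 * X + 4 ^ t * Σ< r (f ∘ suc)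
        ≡⟨ arith (4 ^ t) (positiveCount t A) (Σ< r (f ∘ suc)) ⟩
      4 ^ t * (positiveCount t A + (Σ< r (f ∘ suc) + positiveCount t A))
        ≡⟨ cong₂ (λ x y → 4 ^ t * (x + (Σ< r (f ∘ suc) + y))) first final ⟨
      4 ^ t * (f 0 + (Σ< r (f ∘ suc) + f t)) ≡⟨ cong (4 ^ t *_) (ends f) ⟨
      4 ^ t * Σ< (suc t) f ≡⟨ cong (4 ^ t *_) (words-cuts t A []) ⟨
      4 ^ t * words t A (λ w _ → cuts [] w) ≡⟨ cong (4 ^ t *_) (words-ext t A λ w _ → cuts-unique w) ⟩
      4 ^ t * wordCount t A ≡⟨ cong (4 ^ t *_) (wordCount≡ν t A) ⟩
      4 ^ t * V ≡⟨ *-comm (4 ^ t) V ⟩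
      V * 4 ^ t ≡⟨ cong (V *_) (centralBinomial-convolution t) ⟨
      V * Σ< (suc t) g ≡⟨ cong (V *_) (ends g) ⟩
      V * (1 * a + (R + a * centralBinomial (r ∸ r)))
        ≡⟨ cong (λ e → V * (1 * a + (R + a * centralBinomial e))) (n∸n≡0 r) ⟩
      V * (1 * a + (R + a * 1)) ≡⟨ arith′ V a R ⟩
      2 * Y + V * R ∎
      where
      a : ℕ
      a = centralBinomial t
      arith : ∀ p c s → 2 * (p * c) + p * s ≡ p * (c + (s + c))
      arith = solve-∀
      arith′ : ∀ v a r → v * (1 * a + (r + a * 1)) ≡ 2 * (v * a) + v * r
      arith′ = solve-∀

  sparre-andersen : ∀ t A → Generic A → 4 ^ t * positiveCount t A ≡ ν t (length A) * centralBinomial t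
  sparre-andersen t = sparre-andersen-< (suc t) t ≤-refl

-- Gordan's theorem of the alternative over the integers.

module Gordan where

  open import Data.Integer hiding (suc)
  open import Data.Integer.Properties
  open import Data.Integer.Tactic.RingSolver using (solve-∀)
  open import Data.List using (List; []; _∷_; _++_; concatMap)
  open import Data.List.Membership.Propositional using (_∈_)
  open import Data.List.Relation.Unary.All as All using (All; []; _∷_)
  import Data.List.Relation.Unary.All.Properties as All
  open import Data.List.Relation.Unary.Any using (here; there)
  open import Data.Nat as ℕ using (ℕ; zero; suc)
  open import Data.Product using (_×_; _,_; ∃-syntax; proj₁; proj₂)
  open import Data.Sum using (_⊎_; inj₁; inj₂)
  open import Data.Vec as Vec using (Vec; []; _∷_; zipWith; replicate)
  open import Relation.Binary.PropositionalEquality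

  infixl 6 _⊕_
  infixl 7 _∙_

  _⊕_ : ∀ {n} → Vec ℤ n → Vec ℤ n → Vec ℤ n
  _⊕_ = zipWith _+_

  _∙_ : ∀ {n} → Vec ℤ n → Vec ℤ n → ℤ
  []       ∙ []       = 0ℤ
  (a ∷ as) ∙ (d ∷ ds) = a * d + as ∙ ds

  zeroVec : ∀ {n} → Vec ℤ n
  zeroVec = replicate _ 0ℤ

  scale : ∀ {n} → ℤ → Vec ℤ n → Vec ℤ n
  scale c = Vec.map (c *_)

  ∙-⊕ : ∀ {n} (a d e : Vec ℤ n) → a ∙ (d ⊕ e) ≡ a ∙ d + a ∙ e
  ∙-⊕ []       []       []       = refl
  ∙-⊕ (a ∷ as) (d ∷ ds) (e ∷ es) = trans (cong (λ z → a * (d + e) + z) (∙-⊕ as ds es)) (arith a d e _ _)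
    where
    arith : ∀ a d e x y → a * (d + e) + (x + y) ≡ a * d + x + (a * e + y)
    arith = solve-∀

  ∙-scaleʳ : ∀ {n} c (a d : Vec ℤ n) → a ∙ scale c d ≡ c * (a ∙ d)
  ∙-scaleʳ c []       []       = sym (*-zeroʳ c)
  ∙-scaleʳ c (a ∷ as) (d ∷ ds) = trans (cong (λ z → a * (c * d) + z) (∙-scaleʳ c as ds)) (arith c a d _)
    where
    arith : ∀ c a d x → a * (c * d) + c * x ≡ c * (a * d + x)
    arith = solve-∀

  ∙-scaleˡ : ∀ {n} c (a d : Vec ℤ n) → scale c a ∙ d ≡ c * (a ∙ d)
  ∙-scaleˡ c []       []       = sym (*-zeroʳ c)
  ∙-scaleˡ c (a ∷ as) (d ∷ ds) = trans (cong (λ z → c * a * d + z) (∙-scaleˡ c as ds)) (arith c a d _)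
    where
    arith : ∀ c a d x → c * a * d + c * x ≡ c * (a * d + x)
    arith = solve-∀

  scale-1 : ∀ {n} (d : Vec ℤ n) → scale 1ℤ d ≡ d
  scale-1 []       = refl
  scale-1 (d ∷ ds) = cong₂ _∷_ (*-identityˡ d) (scale-1 ds)

  scale-suc : ∀ {n} c (d : Vec ℤ n) → scale (1ℤ + c) d ≡ d ⊕ scale c d
  scale-suc c []       = refl
  scale-suc c (d ∷ ds) = cong₂ _∷_ (arith c d) (scale-suc c ds)
    where
    arith : ∀ c d → (1ℤ + c) * d ≡ d + c * d
    arith = solve-∀

  -- Repetition of terms takes the place of positive integer coefficients.
  data Sum {n} (D : List (Vec ℤ n)) : Vec ℤ n → Set where
    term : ∀ {d} → d ∈ D → Sum D d
    _⊕ˢ_ : ∀ {d e} → Sum D d → Sum D e → Sum D (d ⊕ e)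

  Sum-scale : ∀ {n} {D : List (Vec ℤ n)} k {d} → Sum D d → Sum D (scale +[1+ k ] d)
  Sum-scale zero    {d} s = subst (Sum _) (sym (scale-1 d)) s
  Sum-scale (suc k) {d} s = subst (Sum _) (sym (scale-suc +[1+ k ] d)) (s ⊕ˢ Sum-scale k s)

  -- The pair (i , c) stands for the fraction c / (i + 1).
  Fraction : Set
  Fraction = ℕ × ℤ

  _⊑_ : Fraction → Fraction → Set
  (i , c) ⊑ (j , d) = c * +[1+ j ] ≤ d * +[1+ i ]

  ⊑-trans : ∀ x y z → x ⊑ y → y ⊑ z → x ⊑ z
  ⊑-trans (i , c) (j , d) (k , e) p q = *-cancelʳ-≤-pos (c * +[1+ k ]) (e * +[1+ i ]) +[1+ j ] (begin
    c * +[1+ k ] * +[1+ j ] ≡⟨ arith c +[1+ k ] +[1+ j ] ⟩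
    c * +[1+ j ] * +[1+ k ] ≤⟨ *-monoʳ-≤-nonNeg +[1+ k ] p ⟩
    d * +[1+ i ] * +[1+ k ] ≡⟨ arith d +[1+ i ] +[1+ k ] ⟩
    d * +[1+ k ] * +[1+ i ] ≤⟨ *-monoʳ-≤-nonNeg +[1+ i ] q ⟩
    e * +[1+ j ] * +[1+ i ] ≡⟨ arith e +[1+ j ] +[1+ i ] ⟩
    e * +[1+ i ] * +[1+ j ] ∎)
    where
    open ≤-Reasoning
    arith : ∀ a b c → a * b * c ≡ a * c * b
    arith = solve-∀

  maximum : ∀ x xs → ∃[ m ] m ∈ (x ∷ xs) × All (_⊑ m) (x ∷ xs)
  maximum x []       = x , here refl , ≤-refl ∷ []
  maximum x (y ∷ ys) with maximum y ys
  ... | m , m∈ , below with ≤-total (proj₂ x * +[1+ proj₁ m ]) (proj₂ m * +[1+ proj₁ x ])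
  ...   | inj₁ x⊑m = m , there m∈ , x⊑m ∷ below
  ...   | inj₂ m⊑x = x , here refl , ≤-refl ∷ All.map (λ {z} z⊑m → ⊑-trans z m x z⊑m m⊑x) below

  module _ (P Q : List Fraction) where

    -- For positive `K` this says that a / K is less than -c / (i + 1) for every fraction of `P` and
    -- greater than c / (j + 1) for every fraction of `Q`.
    Between : ℤ → ℤ → Set
    Between K a = All (λ (i , c) → a * +[1+ i ] + K * c < 0ℤ) P ×
                  All (λ (j , c) → a * -[1+ j ] + K * c < 0ℤ) Q

    between : ∀ i c j d → All (_⊑ (i , c)) P → All (_⊑ (j , d)) Q →
      +[1+ j ] * c + +[1+ i ] * d < 0ℤ → ∃[ K ] 0ℤ < K × (∃[ a ] Between K a)
    between i c j d P⊑ Q⊑ gap =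
        -- The midpoint of d / q and -c / p is (p d - q c) / (2 p q).
        + 2 * (p * q) , 0<K , (p * d - q * c) ,
        All.map (λ {(k , e)} le → upper +[1+ k ] e le) P⊑ , All.map (λ {(k , e)} le → lower k e le) Q⊑
      where
      open ≤-Reasoning
      p q : ℤ
      p = +[1+ i ]
      q = +[1+ j ]
      0<K : 0ℤ < + 2 * (p * q)
      0<K = +<+ (ℕ.s≤s ℕ.z≤n)
      scaled : ∀ k → +[1+ k ] * (q * c + p * d) < 0ℤ
      scaled k = subst (+[1+ k ] * (q * c + p * d) <_) (*-zeroʳ +[1+ k ]) (*-monoˡ-<-pos +[1+ k ] gap)
      arith₁ : ∀ p q c d k e → (p * d - q * c) * k + + 2 * (p * q) * e ≡ (p * d - q * c) * k + + 2 * q * (e * p)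
      arith₁ = solve-∀
      arith₂ : ∀ p q c d k → (p * d - q * c) * k + + 2 * q * (c * k) ≡ k * (q * c + p * d)
      arith₂ = solve-∀
      arith₃ : ∀ p q c d k e → (p * d - q * c) * - k + + 2 * (p * q) * e ≡ (p * d - q * c) * - k + + 2 * p * (e * q)
      arith₃ = solve-∀
      arith₄ : ∀ p q c d k → (p * d - q * c) * - k + + 2 * p * (d * k) ≡ k * (q * c + p * d)
      arith₄ = solve-∀
      upper : ∀ k e → e * p ≤ c * k → {{Positive k}} → (p * d - q * c) * k + + 2 * (p * q) * e < 0ℤ
      upper k@(+[1+ k′ ]) e le = begin-strict
        (p * d - q * c) * k + + 2 * (p * q) * e ≡⟨ arith₁ p q c d k e ⟩
        (p * d - q * c) * k + + 2 * q * (e * p) ≤⟨ +-monoʳ-≤ ((p * d - q * c) * k) (*-monoˡ-≤-nonNeg (+ 2 * q) le) ⟩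
        (p * d - q * c) * k + + 2 * q * (c * k) ≡⟨ arith₂ p q c d k ⟩
        k * (q * c + p * d) <⟨ scaled k′ ⟩
        0ℤ ∎
      lower : ∀ k e → e * q ≤ d * +[1+ k ] → (p * d - q * c) * -[1+ k ] + + 2 * (p * q) * e < 0ℤ
      lower k e le = begin-strict
        (p * d - q * c) * -[1+ k ] + + 2 * (p * q) * e ≡⟨ arith₃ p q c d +[1+ k ] e ⟩
        (p * d - q * c) * -[1+ k ] + + 2 * p * (e * q) ≤⟨ +-monoʳ-≤ ((p * d - q * c) * -[1+ k ]) (*-monoˡ-≤-nonNeg (+ 2 * p) le) ⟩
        (p * d - q * c) * -[1+ k ] + + 2 * p * (d * +[1+ k ]) ≡⟨ arith₄ p q c d +[1+ k ] ⟩
        +[1+ k ] * (q * c + p * d) <⟨ scaled k ⟩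
        0ℤ ∎

  separate : ∀ P Q → (∀ {i c j d} → (i , c) ∈ P → (j , d) ∈ Q → +[1+ j ] * c + +[1+ i ] * d < 0ℤ) →
    ∃[ K ] 0ℤ < K × (∃[ a ] Between P Q K a)
  -- An empty side is given an artificial extreme fraction, chosen so that a gap remains.
  separate [] [] _ = between [] [] 0 0ℤ 0 -1ℤ [] [] -<+
  separate (x ∷ P) [] _ with maximum x P
  ... | (i , c) , _ , below = between (x ∷ P) [] i c i (- c - 1ℤ) below []
        (subst (_< 0ℤ) (sym (arith +[1+ i ] c)) -<+)
    where
    arith : ∀ p c → p * c + p * (- c - 1ℤ) ≡ - p
    arith = solve-∀
  separate [] (y ∷ Q) _ with maximum y Q
  ... | (j , d) , _ , below = between [] (y ∷ Q) j (- d - 1ℤ) j d [] below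
        (subst (_< 0ℤ) (sym (arith +[1+ j ] d)) -<+)
    where
    arith : ∀ p c → p * (- c - 1ℤ) + p * c ≡ - p
    arith = solve-∀
  separate (x ∷ P) (y ∷ Q) gap with maximum x P | maximum y Q
  ... | (i , c) , m∈ , P⊑ | (j , d) , m′∈ , Q⊑ = between (x ∷ P) (y ∷ Q) i c j d P⊑ Q⊑ (gap m∈ m′∈)

  module _ {n : ℕ} where

    zeroTail : Vec ℤ (suc n) → List (Vec ℤ n)
    zeroTail (+0 ∷ d) = d ∷ []
    zeroTail _        = []

    cancel : Vec ℤ (suc n) → Vec ℤ (suc n) → List (Vec ℤ n)
    cancel (+[1+ i ] ∷ p) (-[1+ j ] ∷ q) = (scale +[1+ j ] p ⊕ scale +[1+ i ] q) ∷ []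
    cancel _              _              = []

    -- Fourier–Motzkin elimination of the first coordinate.
    eliminate : List (Vec ℤ (suc n)) → List (Vec ℤ n)
    eliminate D = concatMap zeroTail D ++ concatMap (λ p → concatMap (cancel p) D) D

    eliminate-Sum : ∀ D → All (λ v → Sum D (0ℤ ∷ v)) (eliminate D)
    eliminate-Sum D = All.++⁺
        (All.concat⁺ (All.map⁺ (All.tabulate λ {d} → tail d)))
        (All.concat⁺ (All.map⁺ (All.tabulate λ {p} p∈ → All.concat⁺ (All.map⁺ (All.tabulate λ {q} → both p q p∈)))))
      where
      tail : ∀ d → d ∈ D → All (λ v → Sum D (0ℤ ∷ v)) (zeroTail d)
      tail (+0 ∷ _)       d∈ = term d∈ ∷ []
      tail (+[1+ _ ] ∷ _) d∈ = []
      tail (-[1+ _ ] ∷ _) d∈ = []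
      opposite : ∀ p q → p * - q + q * p ≡ 0ℤ
      opposite = solve-∀
      both : ∀ p q → p ∈ D → q ∈ D → All (λ v → Sum D (0ℤ ∷ v)) (cancel p q)
      both (+0 ∷ _)       _              _  _  = []
      both (-[1+ _ ] ∷ _) _              _  _  = []
      both (+[1+ _ ] ∷ _) (+ _ ∷ _)      _  _  = []
      both (+[1+ i ] ∷ p) (-[1+ j ] ∷ q) p∈ q∈ =
        subst (λ z → Sum D (z ∷ (scale +[1+ j ] p ⊕ scale +[1+ i ] q)))
          (trans (+-comm (+[1+ j ] * +[1+ i ]) (+[1+ i ] * -[1+ j ])) (opposite +[1+ i ] +[1+ j ]))
          (Sum-scale j (term p∈) ⊕ˢ Sum-scale i (term q∈)) ∷ []

    lift-Sum : ∀ {D v} → Sum (eliminate D) v → Sum D (0ℤ ∷ v)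
    lift-Sum {D} (term v∈) = All.lookup (eliminate-Sum D) v∈
    lift-Sum     (s ⊕ˢ t)  = lift-Sum s ⊕ˢ lift-Sum t

    module _ (a : Vec ℤ n) where

      uppers lowers : Vec ℤ (suc n) → List Fraction
      uppers (+[1+ i ] ∷ d) = (i , a ∙ d) ∷ []
      uppers _              = []
      lowers (-[1+ j ] ∷ d) = (j , a ∙ d) ∷ []
      lowers _              = []

      -- Vectors with positive first entry bound the new coordinate from above, those with negative
      -- first entry from below, and the vectors made by `cancel` say that every lower bound is less
      -- than every upper bound. The factor `K` clears the denominator of a value in between.
      extend : ∀ D → All (λ d → a ∙ d < 0ℤ) (eliminate D) → ∃[ b ] All (λ d → b ∙ d < 0ℤ) D
      extend D neg with separate (concatMap uppers D) (concatMap lowers D)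
                         (λ x∈ y∈ → All.lookup (All.lookup gaps x∈) y∈)
        where
        negCancel : ∀ {p q} → p ∈ D → q ∈ D → All (λ d → a ∙ d < 0ℤ) (cancel p q)
        negCancel p∈ q∈ = All.lookup (All.map⁻ (All.concat⁻ (All.lookup (All.map⁻ (All.concat⁻
          (All.++⁻ʳ (concatMap zeroTail D) neg))) p∈))) q∈

        Gap : Fraction → Fraction → Set
        Gap (i , c) (j , d) = +[1+ j ] * c + +[1+ i ] * d < 0ℤ

        gap : ∀ p q → p ∈ D → q ∈ D → All (λ x → All (Gap x) (lowers q)) (uppers p)
        gap (+0 ∷ _)       _              _  _  = []
        gap (-[1+ _ ] ∷ _) _              _  _  = []
        gap (+[1+ _ ] ∷ _) (+0 ∷ _)       _  _  = [] ∷ []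
        gap (+[1+ _ ] ∷ _) (+[1+ _ ] ∷ _) _  _  = [] ∷ []
        gap (+[1+ i ] ∷ p) (-[1+ j ] ∷ q) p∈ q∈ =
          (subst (_< 0ℤ) (trans (∙-⊕ a (scale +[1+ j ] p) (scale +[1+ i ] q))
            (cong₂ _+_ (∙-scaleʳ +[1+ j ] a p) (∙-scaleʳ +[1+ i ] a q)))
            (All.head (negCancel p∈ q∈)) ∷ []) ∷ []

        gaps : All (λ x → All (Gap x) (concatMap lowers D)) (concatMap uppers D)
        gaps = All.concat⁺ (All.map⁺ (All.tabulate λ {p} p∈ → All.tabulate λ {x} x∈ →
          All.concat⁺ (All.map⁺ (All.tabulate λ {q} q∈ → All.lookup (gap p q p∈ q∈) x∈))))
      ... | K , 0<K , a₀ , above , below = a₀ ∷ scale K a , All.tabulate λ {d} d∈ → check d d∈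
        where
        value : ∀ d₀ d → (a₀ ∷ scale K a) ∙ (d₀ ∷ d) ≡ a₀ * d₀ + K * (a ∙ d)
        value d₀ d = cong (λ z → a₀ * d₀ + z) (∙-scaleˡ K a d)
        check : ∀ d → d ∈ D → (a₀ ∷ scale K a) ∙ d < 0ℤ
        check (+[1+ i ] ∷ d) d∈ = subst (_< 0ℤ) (sym (value +[1+ i ] d))
          (All.head (All.lookup (All.map⁻ (All.concat⁻ above)) d∈))
        check (-[1+ j ] ∷ d) d∈ = subst (_< 0ℤ) (sym (value -[1+ j ] d))
          (All.head (All.lookup (All.map⁻ (All.concat⁻ below)) d∈))
        check (+0 ∷ d) d∈ = subst (_< 0ℤ) (sym (trans (value +0 d)
            (trans (cong (_+ K * (a ∙ d)) (*-zeroʳ a₀)) (+-identityˡ (K * (a ∙ d))))))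
          (subst (K * (a ∙ d) <_) (*-zeroʳ K) (*-monoˡ-<-pos K {{positive 0<K}}
            (All.head (All.lookup (All.map⁻ (All.concat⁻ (All.++⁻ˡ (concatMap zeroTail D) neg))) d∈))))

  gordan : ∀ n (D : List (Vec ℤ n)) → Sum D zeroVec ⊎ ∃[ a ] All (λ d → a ∙ d < 0ℤ) D
  -- In dimension 0 the only vector is zero, so a single term of `D` is already a vanishing sum.
  gordan zero    []       = inj₂ ([] , [])
  gordan zero    ([] ∷ D) = inj₁ (term (here refl))
  gordan (suc n) D with gordan n (eliminate D)
  ... | inj₁ s         = inj₁ (lift-Sum s)
  ... | inj₂ (a , neg) = inj₂ (extend a D neg)

-- Generic separating functionals and the walks that they keep outside the set.

module Separation where

  open Walk
  open Words
  open Sparre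
  open Sums using (centralBinomial)
  open Gordan using (_∙_; scale; ∙-scaleˡ)
  open import Data.Bool using (Bool; true; false; _∧_)
  open import Data.Integer as ℤ using (ℤ; 0ℤ; 1ℤ; -1ℤ)
  import Data.Integer.Properties as ℤP
  import Data.Integer.Tactic.RingSolver as ℤSolver
  open import Data.List using (List; []; _∷_; length; map)
  open import Data.Nat
  open import Data.Nat.Properties
  open import Data.Product using (_×_; _,_; ∃-syntax)
  open import Data.Sum using (inj₂)
  open import Data.Vec as Vec using (Vec; []; _∷_)
  open import Data.Empty using (⊥-elim)
  open import Function using (_∘_)
  open import Relation.Binary.PropositionalEquality
  open import Relation.Nullary using (yes; no; Dec)
  open import Relation.Nullary.Decidable using (dec-true; dec-false)
  open import Defs using (−1; O; +1; Point; toℤ)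

  vec : ∀ {n} → Point n → Vec ℤ n
  vec = Vec.map toℤ

  difference : ∀ {n} → Point n → Point n → Vec ℤ n
  difference = Vec.zipWith (λ s t → toℤ s ℤ.- toℤ t)

  difference≤2 : ∀ s t → toℤ s ℤ.- toℤ t ℤ.≤ ℤ.+ 2
  difference≤2 s t = ℤP.+-mono-≤ (upper s) (lower t)
    where
    upper : ∀ t → toℤ t ℤ.≤ 1ℤ
    upper −1 = ℤ.-≤+
    upper O  = ℤ.+≤+ z≤n
    upper +1 = ℤP.≤-refl
    lower : ∀ t → ℤ.- toℤ t ℤ.≤ 1ℤ
    lower −1 = ℤP.≤-refl
    lower O  = ℤ.+≤+ z≤n
    lower +1 = ℤ.-≤+

  ∙-difference : ∀ {n} (a : Vec ℤ n) x y → a ∙ vec x ≡ a ∙ vec y ℤ.+ a ∙ difference x y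
  ∙-difference []       []      []      = refl
  ∙-difference (a ∷ as) (s ∷ x) (t ∷ y) = trans
    (cong (λ z → a ℤ.* toℤ s ℤ.+ z) (∙-difference as x y)) (arith a (toℤ s) (toℤ t) _ _)
    where
    arith : ∀ a s t p q → a ℤ.* s ℤ.+ (p ℤ.+ q) ≡ a ℤ.* t ℤ.+ p ℤ.+ (a ℤ.* (s ℤ.- t) ℤ.+ q)
    arith = ℤSolver.solve-∀

  -- The vector with entries 3ⁿ aᵢ + 3ⁱ: its nonempty signed sums are nonzero because their
  -- ternary expansions are.
  perturb : ∀ {n} → Vec ℤ n → Vec ℤ n
  perturb             []       = []
  perturb {n = suc n} (a ∷ as) = (ℤ.+ 3 ℤ.* (ℤ.+ (3 ^ n) ℤ.* a) ℤ.+ 1ℤ) ∷ scale (ℤ.+ 3) (perturb as)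

  -- The entries of `difference x y` are at most 2, so the added powers of 3 contribute at most 2 (1
  -- + 3 + ... + 3ⁿ⁻¹) = 3ⁿ - 1.
  perturb-≤ : ∀ {n} (a : Vec ℤ n) x y →
    perturb a ∙ difference x y ℤ.≤ ℤ.+ (3 ^ n) ℤ.* (a ∙ difference x y) ℤ.+ (ℤ.+ (3 ^ n) ℤ.- 1ℤ)
  perturb-≤             []       []      []      = ℤP.≤-refl
  perturb-≤ {n = suc n} (a ∷ as) (s ∷ x) (t ∷ y) = begin
    (ℤ.+ 3 ℤ.* (p ℤ.* a) ℤ.+ 1ℤ) ℤ.* d ℤ.+ scale (ℤ.+ 3) (perturb as) ∙ difference x y
      ≡⟨ cong (λ z → (ℤ.+ 3 ℤ.* (p ℤ.* a) ℤ.+ 1ℤ) ℤ.* d ℤ.+ z) (∙-scaleˡ (ℤ.+ 3) (perturb as) (difference x y)) ⟩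
    (ℤ.+ 3 ℤ.* (p ℤ.* a) ℤ.+ 1ℤ) ℤ.* d ℤ.+ ℤ.+ 3 ℤ.* (perturb as ∙ difference x y)
      ≡⟨ arith₁ p a d _ ⟩
    ℤ.+ 3 ℤ.* (p ℤ.* a) ℤ.* d ℤ.+ (d ℤ.+ ℤ.+ 3 ℤ.* (perturb as ∙ difference x y))
      ≤⟨ ℤP.+-monoʳ-≤ (ℤ.+ 3 ℤ.* (p ℤ.* a) ℤ.* d) (ℤP.+-mono-≤ (difference≤2 s t)
           (ℤP.*-monoˡ-≤-nonNeg (ℤ.+ 3) (perturb-≤ as x y))) ⟩
    ℤ.+ 3 ℤ.* (p ℤ.* a) ℤ.* d ℤ.+ (ℤ.+ 2 ℤ.+ ℤ.+ 3 ℤ.* (p ℤ.* e ℤ.+ (p ℤ.- 1ℤ)))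
      ≡⟨ arith₂ p a d e ⟩
    ℤ.+ 3 ℤ.* p ℤ.* (a ℤ.* d ℤ.+ e) ℤ.+ (ℤ.+ 3 ℤ.* p ℤ.- 1ℤ)
      ≡⟨ cong (λ q → q ℤ.* (a ℤ.* d ℤ.+ e) ℤ.+ (q ℤ.- 1ℤ)) (ℤP.pos-* 3 (3 ^ n)) ⟨
    ℤ.+ (3 * 3 ^ n) ℤ.* (a ℤ.* d ℤ.+ e) ℤ.+ (ℤ.+ (3 * 3 ^ n) ℤ.- 1ℤ) ∎
    where
    open ℤP.≤-Reasoning
    p d e : ℤ
    p = ℤ.+ (3 ^ n)
    d = toℤ s ℤ.- toℤ t
    e = as ∙ difference x y
    arith₁ : ∀ p a d x → (ℤ.+ 3 ℤ.* (p ℤ.* a) ℤ.+ 1ℤ) ℤ.* d ℤ.+ ℤ.+ 3 ℤ.* x ≡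
                         ℤ.+ 3 ℤ.* (p ℤ.* a) ℤ.* d ℤ.+ (d ℤ.+ ℤ.+ 3 ℤ.* x)
    arith₁ = ℤSolver.solve-∀
    arith₂ : ∀ p a d e → ℤ.+ 3 ℤ.* (p ℤ.* a) ℤ.* d ℤ.+ (ℤ.+ 2 ℤ.+ ℤ.+ 3 ℤ.* (p ℤ.* e ℤ.+ (p ℤ.- 1ℤ))) ≡
                         ℤ.+ 3 ℤ.* p ℤ.* (a ℤ.* d ℤ.+ e) ℤ.+ (ℤ.+ 3 ℤ.* p ℤ.- 1ℤ)
    arith₂ = ℤSolver.solve-∀

  -- A negative integer is at most -1, and -3ⁿ outweighs the 3ⁿ - 1 that the perturbation can add.
  perturb-< : ∀ {n} (a : Vec ℤ n) x y → a ∙ difference x y ℤ.< 0ℤ → perturb a ∙ difference x y ℤ.< 0ℤ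
  perturb-< {n} a x y neg = ℤP.≤-<-trans (ℤP.≤-trans (perturb-≤ a x y)
      (ℤP.≤-trans (ℤP.+-monoˡ-≤ (p ℤ.- 1ℤ) (ℤP.*-monoˡ-≤-nonNeg p (ℤP.i<j⇒i≤pred[j] neg)))
                  (ℤP.≤-reflexive (arith p)))) ℤ.-<+
    where
    p : ℤ
    p = ℤ.+ (3 ^ n)
    arith : ∀ p → p ℤ.* -1ℤ ℤ.+ (p ℤ.- 1ℤ) ≡ -1ℤ
    arith = ℤSolver.solve-∀

  -- The letters still available to a walk at `x`: each further step changes the functional by one
  -- of them, with either sign, and uses it up.
  atZeros : ∀ {n} → Vec ℤ n → Point n → List ℤ
  atZeros []       []       = []
  atZeros (a ∷ as) (O ∷ x)  = a ∷ atZeros as x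
  atZeros (a ∷ as) (−1 ∷ x) = atZeros as x
  atZeros (a ∷ as) (+1 ∷ x) = atZeros as x

  atZeros-length : ∀ {n} (a : Vec ℤ n) x → length (atZeros a x) ≡ zeros x
  atZeros-length []       []       = refl
  atZeros-length (a ∷ as) (O ∷ x)  = cong suc (atZeros-length as x)
  atZeros-length (a ∷ as) (−1 ∷ x) = atZeros-length as x
  atZeros-length (a ∷ as) (+1 ∷ x) = atZeros-length as x

  atZeros-scale : ∀ {n} c (a : Vec ℤ n) x → atZeros (scale c a) x ≡ map (λ z → c ℤ.* z) (atZeros a x)
  atZeros-scale c []       []       = refl
  atZeros-scale c (a ∷ as) (O ∷ x)  = cong (c ℤ.* a ∷_) (atZeros-scale c as x)
  atZeros-scale c (a ∷ as) (−1 ∷ x) = atZeros-scale c as x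
  atZeros-scale c (a ∷ as) (+1 ∷ x) = atZeros-scale c as x

  signedSum-scale : ∀ c A {s} → SignedSum (map (λ z → c ℤ.* z) A) s → ∃[ r ] SignedSum A r × s ≡ c ℤ.* r
  signedSum-scale c (a ∷ A) plus       = a , plus , refl
  signedSum-scale c (a ∷ A) minus      = ℤ.- a , minus , ℤP.neg-distribʳ-* c a
  signedSum-scale c (a ∷ A) (skip σ) with signedSum-scale c A σ
  ... | r , τ , eq = r , skip τ , eq
  signedSum-scale c (a ∷ A) (plus∷ σ) with signedSum-scale c A σ
  ... | r , τ , eq = a ℤ.+ r , plus∷ τ ,
    trans (cong (λ z → c ℤ.* a ℤ.+ z) eq) (sym (ℤP.*-distribˡ-+ c a r))
  signedSum-scale c (a ∷ A) (minus∷ σ) with signedSum-scale c A σ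
  ... | r , τ , eq = ℤ.- a ℤ.+ r , minus∷ τ ,
    trans (cong₂ ℤ._+_ (ℤP.neg-distribʳ-* c a) eq) (sym (ℤP.*-distribˡ-+ c (ℤ.- a) r))

  3x≢±1 : ∀ x → ℤ.∣ ℤ.+ 3 ℤ.* x ∣ ≢ 1
  3x≢±1 x eq = absurd ℤ.∣ x ∣ (trans (sym (ℤP.abs-* (ℤ.+ 3) x)) eq)
    where
    absurd : ∀ k → 3 * k ≢ 1
    absurd (suc k) eq with trans (sym eq) (*-suc 3 k)
    ... | ()

  perturb-generic : ∀ {n} (a : Vec ℤ n) x → Generic (atZeros (perturb a) x)
  perturb-generic []       []      s ()
  perturb-generic {n = suc n} (a ∷ as) (t ∷ x) = by-trit t
    where
    A : List ℤ
    A = atZeros (perturb as) x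
    b : ℤ
    b = ℤ.+ (3 ^ n) ℤ.* a
    tail : Generic (map (λ z → ℤ.+ 3 ℤ.* z) A)
    tail s σ s≡0 with signedSum-scale (ℤ.+ 3) A σ
    ... | r , τ , eq with ℤP.i*j≡0⇒i≡0∨j≡0 (ℤ.+ 3) (trans (sym eq) s≡0)
    ...   | inj₂ r≡0 = perturb-generic as x r τ r≡0
    remainder : ∀ r s → s ≡ ℤ.+ 3 ℤ.* r ℤ.+ 1ℤ → s ≢ 0ℤ
    remainder r _ refl s≡0 = 3x≢±1 r (cong ℤ.∣_∣ (trans (arith (ℤ.+ 3 ℤ.* r)) (cong (ℤ._- 1ℤ) s≡0)))
      where
      arith : ∀ x → x ≡ x ℤ.+ 1ℤ ℤ.- 1ℤ
      arith = ℤSolver.solve-∀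
    -- A signed sum that involves the first coefficient is ±1 modulo 3; any other one is 3 times a
    -- signed sum for the shorter vector.
    whole : Generic ((ℤ.+ 3 ℤ.* b ℤ.+ 1ℤ) ∷ map (λ z → ℤ.+ 3 ℤ.* z) A)
    whole s plus     = remainder b s refl
    whole s minus    = remainder b (ℤ.+ 3 ℤ.* b ℤ.+ 1ℤ) refl ∘ ℤP.neg-injective
    whole s (skip σ) = tail s σ
    whole s (plus∷ σ) with signedSum-scale (ℤ.+ 3) A σ
    ... | r , _ , refl = remainder (b ℤ.+ r) s (arith b r)
      where
      arith : ∀ b r → ℤ.+ 3 ℤ.* b ℤ.+ 1ℤ ℤ.+ ℤ.+ 3 ℤ.* r ≡ ℤ.+ 3 ℤ.* (b ℤ.+ r) ℤ.+ 1ℤ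
      arith = ℤSolver.solve-∀
    whole s (minus∷ σ) with signedSum-scale (ℤ.+ 3) A σ
    ... | r , _ , refl = remainder (b ℤ.- r) (ℤ.- s) (arith b r) ∘ cong (λ z → ℤ.- z)
      where
      arith : ∀ b r → ℤ.- (ℤ.- (ℤ.+ 3 ℤ.* b ℤ.+ 1ℤ) ℤ.+ ℤ.+ 3 ℤ.* r) ≡ ℤ.+ 3 ℤ.* (b ℤ.- r) ℤ.+ 1ℤ
      arith = ℤSolver.solve-∀
    by-trit : ∀ t → Generic (atZeros (perturb (a ∷ as)) (t ∷ x))
    by-trit O  = subst (λ B → Generic ((ℤ.+ 3 ℤ.* b ℤ.+ 1ℤ) ∷ B)) (sym (atZeros-scale (ℤ.+ 3) (perturb as) x)) whole
    by-trit −1 = subst Generic (sym (atZeros-scale (ℤ.+ 3) (perturb as) x)) tail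
    by-trit +1 = subst Generic (sym (atZeros-scale (ℤ.+ 3) (perturb as) x)) tail

  data Step : ∀ {n} → Vec ℤ n → Point n → ℤ → Point n → Set where
    up   : ∀ {n a} {as : Vec ℤ n} {x} → Step (a ∷ as) (O ∷ x) a (+1 ∷ x)
    down : ∀ {n a} {as : Vec ℤ n} {x} → Step (a ∷ as) (O ∷ x) (ℤ.- a) (−1 ∷ x)
    next : ∀ {n a} {as : Vec ℤ n} {t x v y} → Step as x v y → Step (a ∷ as) (t ∷ x) v (t ∷ y)

  step-∙ : ∀ {n} {a : Vec ℤ n} {x v y} → Step a x v y → a ∙ vec y ≡ a ∙ vec x ℤ.+ v
  step-∙ (up {a = a} {as} {x}) = arith a (as ∙ vec x)
    where
    arith : ∀ a p → a ℤ.* 1ℤ ℤ.+ p ≡ a ℤ.* 0ℤ ℤ.+ p ℤ.+ a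
    arith = ℤSolver.solve-∀
  step-∙ (down {a = a} {as} {x}) = arith a (as ∙ vec x)
    where
    arith : ∀ a p → a ℤ.* -1ℤ ℤ.+ p ≡ a ℤ.* 0ℤ ℤ.+ p ℤ.- a
    arith = ℤSolver.solve-∀
  step-∙ (next {a = a} {as} {t} {x} {v} σ) =
    trans (cong (λ z → a ℤ.* toℤ t ℤ.+ z) (step-∙ σ)) (sym (ℤP.+-assoc (a ℤ.* toℤ t) (as ∙ vec x) v))

  -- Signed letters at `x` correspond to successors of `x`, and drawing a letter leaves exactly the
  -- letters of that successor.
  picks±≤U : ∀ {n} (a : Vec ℤ n) x (F : ℤ → List ℤ → ℕ) (f : Point n → ℕ) →
    (∀ v y → Step a x v y → F v (atZeros a y) ≤ f y) → picks± F (atZeros a x) ≤ U f x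
  picks±≤U []       []       F f F≤f = z≤n
  picks±≤U (a ∷ as) (O ∷ x)  F f F≤f = +-mono-≤
    (+-mono-≤ (F≤f a (+1 ∷ x) up) (F≤f (ℤ.- a) (−1 ∷ x) down))
    (picks±≤U as x (λ b B → F b (a ∷ B)) (λ y → f (O ∷ y)) (λ v y σ → F≤f v (O ∷ y) (next σ)))
  picks±≤U (a ∷ as) (−1 ∷ x) F f F≤f =
    picks±≤U as x F (λ y → f (−1 ∷ y)) (λ v y σ → F≤f v (−1 ∷ y) (next σ))
  picks±≤U (a ∷ as) (+1 ∷ x) F f F≤f =
    picks±≤U as x F (λ y → f (+1 ∷ y)) (λ v y σ → F≤f v (+1 ∷ y) (next σ))

  words-0 : ∀ t A → words t A (λ _ _ → 0) ≡ 0
  words-0 t A = words-* t A 0 (λ _ _ → 0)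

  module _ {n} (S : Point n → Bool) (a : Vec ℤ n) (y : Point n)
           (below : ∀ x → S x ≡ true → a ∙ vec x ℤ.< a ∙ vec y) where

    outside-above : ∀ x → a ∙ vec y ℤ.≤ a ∙ vec x → S x ≡ false
    outside-above x y≤x with S x in eq
    ... | false = refl
    ... | true  = ⊥-elim (ℤP.<⇒≱ (below x eq) y≤x)

    -- Here `s` is the excess of the functional over its value at `y`; as long as it is nonnegative,
    -- the walk is outside `S`. Walks whose excess fails to stay positive after a step are given up,
    -- which is why only an inequality results.
    positive≤stay : ∀ t x s → a ∙ vec x ≡ a ∙ vec y ℤ.+ s → 0ℤ ℤ.≤ s →
      words t (atZeros a x) (λ w _ → ⟦ positiveFrom s w ⟧) ≤ stay S t x
    positive≤stay t x s x≡y+s 0≤s with outside-above x (subst (a ∙ vec y ℤ.≤_) (sym x≡y+s)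
      (subst (ℤ._≤ a ∙ vec y ℤ.+ s) (ℤP.+-identityʳ (a ∙ vec y)) (ℤP.+-monoʳ-≤ (a ∙ vec y) 0≤s)))
    positive≤stay zero    x s _     _   | x∉S rewrite x∉S = ≤-refl
    positive≤stay (suc t) x s x≡y+s 0≤s | x∉S rewrite x∉S = picks±≤U a x
        (λ v B → words t B (λ w _ → ⟦ positiveFrom s (v ∷ w) ⟧)) (stay S t) one
      where
      one : ∀ v z → Step a x v z →
        words t (atZeros a z) (λ w _ → ⟦ positiveFrom s (v ∷ w) ⟧) ≤ stay S t z
      one v z σ = by-sign (0ℤ ℤ.<? s ℤ.+ v)
        where
        by-sign : Dec (0ℤ ℤ.< s ℤ.+ v) →
          words t (atZeros a z) (λ w _ → ⟦ positiveFrom s (v ∷ w) ⟧) ≤ stay S t z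
        by-sign (yes 0<s+v) = ≤-trans
          (≤-reflexive (words-ext t (atZeros a z) λ w _ →
            cong (λ b → ⟦ b ∧ positiveFrom (s ℤ.+ v) w ⟧) (dec-true (0ℤ ℤ.<? s ℤ.+ v) 0<s+v)))
          (positive≤stay t z (s ℤ.+ v)
            (trans (step-∙ σ) (trans (cong (ℤ._+ v) x≡y+s) (ℤP.+-assoc (a ∙ vec y) s v)))
            (ℤP.<⇒≤ 0<s+v))
        by-sign (no 0≮s+v) = ≤-trans
          (≤-reflexive (trans (words-ext t (atZeros a z) λ w _ →
            cong (λ b → ⟦ b ∧ positiveFrom (s ℤ.+ v) w ⟧) (dec-false (0ℤ ℤ.<? s ℤ.+ v) 0≮s+v))
            (words-0 t (atZeros a z)))) z≤n

    stay-lower : Generic (atZeros a y) → ∀ t → centralBinomial t * ν t (zeros y) ≤ 4 ^ t * stay S t y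
    stay-lower gen t = begin
      centralBinomial t * ν t (zeros y) ≡⟨ *-comm (centralBinomial t) (ν t (zeros y)) ⟩
      ν t (zeros y) * centralBinomial t ≡⟨ cong (λ z → ν t z * centralBinomial t) (atZeros-length a y) ⟨
      ν t (length (atZeros a y)) * centralBinomial t ≡⟨ sparre-andersen t (atZeros a y) gen ⟨
      4 ^ t * positiveCount t (atZeros a y)
        ≤⟨ *-monoʳ-≤ (4 ^ t) (positive≤stay t y 0ℤ (sym (ℤP.+-identityʳ _)) ℤP.≤-refl) ⟩
      4 ^ t * stay S t y ∎
      where open ≤-Reasoning

  stay-lower-separated : ∀ {n} (S : Point n → Bool) (y : Point n) (a : Vec ℤ n) →
    (∀ x → S x ≡ true → a ∙ difference x y ℤ.< 0ℤ) →
    ∀ t → centralBinomial t * ν t (zeros y) ≤ 4 ^ t * stay S t y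
  stay-lower-separated S y a neg = stay-lower S (perturb a) y below (perturb-generic a y)
    where
    below : ∀ x → S x ≡ true → perturb a ∙ vec x ℤ.< perturb a ∙ vec y
    below x x∈S = subst₂ ℤ._<_ (sym (∙-difference (perturb a) x y)) (ℤP.+-identityʳ (perturb a ∙ vec y))
      (ℤP.+-monoʳ-< (perturb a ∙ vec y) (perturb-< a x y (neg x x∈S)))

-- From discrete convexity to a separating functional.

module Hull where

  open import Defs using (seq; fromℚ; _≃_; _·_; ∑; −1; O; +1; Point; toℤ; toℚ; allPoints;
    Subset; Convex; _∈Conv_; embed)
  open Walk
  open Gordan using (Sum; term; _⊕ˢ_; _∙_; zeroVec; gordan)
  open Sums using (centralBinomial)
  open Separation
  open import Data.Bool using (true; false; T)
  open import Data.Bool.Properties using (T-≡)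
  open import Data.Empty using (⊥-elim)
  open import Data.Integer as ℤ using (ℤ; 0ℤ)
  import Data.Integer.Properties as ℤP
  import Data.Integer.Tactic.RingSolver as ℤSolver
  open import Data.List as List using (List; []; _∷_; _++_; length)
  import Data.List.Membership.Propositional as List
  open import Data.List.Membership.Propositional.Properties using (∈-map⁺; ∈-map⁻; ∈-filter⁺; ∈-filter⁻; ∈-cartesianProductWith⁺; ∈-lookup)
  open import Data.List.Relation.Unary.All as All using (All; []; _∷_)
  import Data.List.Relation.Unary.All.Properties as All
  open import Data.List.Relation.Unary.Any using (here; there)
  open import Data.Nat as ℕ using (ℕ; zero; suc)
  open import Data.Product using (_×_; _,_; ∃-syntax)
  open import Data.Rational as ℚ using (ℚ; 0ℚ; 1ℚ)
  import Data.Rational.Properties as ℚP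
  import Data.Rational.Unnormalised as ℚᵘ
  import Data.Rational.Unnormalised.Properties as ℚᵘP
  open import Data.Sum using (inj₁; inj₂)
  open import Data.Vec as Vec using (Vec; []; _∷_; lookup)
  open import Data.Vec.Properties using (lookup-zipWith; lookup-replicate)
  open import Function using (_∘_; Equivalence)
  open import Relation.Binary.PropositionalEquality
  open import Relation.Nullary.Decidable using (T?)

  /1-+ : ∀ a b → (a ℤ.+ b) ℚ./ 1 ≡ (a ℚ./ 1) ℚ.+ (b ℚ./ 1)
  /1-+ a b = ℚP.toℚᵘ-injective (ℚᵘP.≃-trans (ℚP.toℚᵘ-fromℚᵘ (ℚᵘ.mkℚᵘ (a ℤ.+ b) 0)) (ℚᵘP.≃-trans
    (ℚᵘ.*≡* (arith a b)) (ℚᵘP.≃-sym (ℚᵘP.≃-trans (ℚP.toℚᵘ-homo-+ (a ℚ./ 1) (b ℚ./ 1))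
    (ℚᵘP.+-cong (ℚP.toℚᵘ-fromℚᵘ (ℚᵘ.mkℚᵘ a 0)) (ℚP.toℚᵘ-fromℚᵘ (ℚᵘ.mkℚᵘ b 0)))))))
    where
    arith : ∀ a b → (a ℤ.+ b) ℤ.* ℤ.1ℤ ≡ (a ℤ.* ℤ.1ℤ ℤ.+ b ℤ.* ℤ.1ℤ) ℤ.* ℤ.1ℤ
    arith = ℤSolver.solve-∀

  /1-* : ∀ a b → (a ℤ.* b) ℚ./ 1 ≡ (a ℚ./ 1) ℚ.* (b ℚ./ 1)
  /1-* a b = ℚP.toℚᵘ-injective (ℚᵘP.≃-trans (ℚP.toℚᵘ-fromℚᵘ (ℚᵘ.mkℚᵘ (a ℤ.* b) 0)) (ℚᵘP.≃-sym
    (ℚᵘP.≃-trans (ℚP.toℚᵘ-homo-* (a ℚ./ 1) (b ℚ./ 1))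
    (ℚᵘP.*-cong (ℚP.toℚᵘ-fromℚᵘ (ℚᵘ.mkℚᵘ a 0)) (ℚP.toℚᵘ-fromℚᵘ (ℚᵘ.mkℚᵘ b 0))))))

  m*1/m : ∀ k → (ℤ.+ suc k ℚ./ 1) ℚ.* (ℤ.+ 1 ℚ./ suc k) ≡ 1ℚ
  m*1/m k = ℚP.toℚᵘ-injective (ℚᵘP.≃-trans (ℚP.toℚᵘ-homo-* (ℤ.+ suc k ℚ./ 1) (ℤ.+ 1 ℚ./ suc k))
    (ℚᵘP.≃-trans (ℚᵘP.*-cong (ℚP.toℚᵘ-fromℚᵘ (ℚᵘ.mkℚᵘ (ℤ.+ suc k) 0)) (ℚP.toℚᵘ-fromℚᵘ (ℚᵘ.mkℚᵘ (ℤ.+ 1) k)))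
    (ℚᵘ.*≡* (arith (ℤ.+ suc k)))))
    where
    arith : ∀ m → m ℤ.* ℤ.1ℤ ℤ.* ℤ.1ℤ ≡ ℤ.1ℤ ℤ.* (ℤ.1ℤ ℤ.* m)
    arith = ℤSolver.solve-∀

  seq≡⇒≃ : ∀ x y → (∀ k → seq x k ≡ seq y k) → x ≃ y
  seq≡⇒≃ x y x≡y = (λ ε 0<ε → 0 , λ k _ → le (x≡y k) ε 0<ε) , (λ ε 0<ε → 0 , λ k _ → le (sym (x≡y k)) ε 0<ε)
    where
    le : ∀ {p q} → p ≡ q → ∀ ε → 0ℚ ℚ.< ε → p ℚ.≤ q ℚ.+ ε
    le {p} refl ε 0<ε = subst (ℚ._≤ p ℚ.+ ε) (ℚP.+-identityʳ p) (ℚP.+-monoʳ-≤ p (ℚP.<⇒≤ 0<ε))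

  ∈-allPoints : ∀ {n} (x : Point n) → x List.∈ allPoints n
  ∈-allPoints []      = here refl
  ∈-allPoints (t ∷ x) = ∈-cartesianProductWith⁺ _∷_ (trit t) (∈-allPoints x)
    where
    trit : ∀ t → t List.∈ (−1 ∷ O ∷ +1 ∷ [])
    trit −1 = here refl
    trit O  = there (here refl)
    trit +1 = there (there (here refl))

  sumOver : ∀ {A : Set} → (A → ℤ) → List A → ℤ
  sumOver f []      = 0ℤ
  sumOver f (x ∷ L) = f x ℤ.+ sumOver f L

  sumOver-++ : ∀ {A : Set} (f : A → ℤ) L M → sumOver f (L ++ M) ≡ sumOver f L ℤ.+ sumOver f M
  sumOver-++ f []      M = sym (ℤP.+-identityˡ (sumOver f M))
  sumOver-++ f (x ∷ L) M = trans (cong (λ z → f x ℤ.+ z) (sumOver-++ f L M))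
    (sym (ℤP.+-assoc (f x) (sumOver f L) (sumOver f M)))

  sumOver-minus : ∀ {A : Set} (f : A → ℤ) c L →
    sumOver (λ x → f x ℤ.- c) L ≡ sumOver f L ℤ.- ℤ.+ length L ℤ.* c
  sumOver-minus f c []      = refl
  sumOver-minus f c (x ∷ L) = trans (cong (λ z → f x ℤ.- c ℤ.+ z) (sumOver-minus f c L))
    (arith (f x) c (sumOver f L) (ℤ.+ length L))
    where
    arith : ∀ a c s l → a ℤ.- c ℤ.+ (s ℤ.- l ℤ.* c) ≡ a ℤ.+ s ℤ.- (ℤ.1ℤ ℤ.+ l) ℤ.* c
    arith = ℤSolver.solve-∀

  module _ {n} (S : Subset n) (y : Point n) where

    members : List (Point n)
    members = List.filter (T? ∘ S) (allPoints n)

    differences : List (Vec ℤ n)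
    differences = List.map (λ x → difference x y) members

    -- The points behind the summands, listed with repetition. The list is nonempty, so its points
    -- have an average.
    toList : ∀ {v} → Sum differences v → ∃[ x ] ∃[ L ] All (T ∘ S) (x ∷ L) ×
      (∀ i → lookup v i ≡ sumOver (λ x → toℤ (lookup x i) ℤ.- toℤ (lookup y i)) (x ∷ L))
    toList (term d∈) with ∈-map⁻ (λ x → difference x y) d∈
    ... | x , x∈ , refl with ∈-filter⁻ (T? ∘ S) {xs = allPoints n} x∈
    ...   | _ , x∈S = x , [] , x∈S ∷ [] , λ i →
      trans (lookup-zipWith (λ s t → toℤ s ℤ.- toℤ t) i x y) (sym (ℤP.+-identityʳ _))
    toList (_⊕ˢ_ {d} {e} s t) with toList s | toList t
    ... | x , L , xL∈S , eq | x′ , L′ , xL′∈S , eq′ = x , L ++ x′ ∷ L′ , All.++⁺ xL∈S xL′∈S , λ i →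
      trans (lookup-zipWith ℤ._+_ i d e) (trans (cong₂ ℤ._+_ (eq i) (eq′ i)) 
        (sym (sumOver-++ (λ x → toℤ (lookup x i) ℤ.- toℤ (lookup y i)) (x ∷ L) (x′ ∷ L′))))

    -- All listed points get weight 1 / (k + 1), and repetitions supply unequal weights. Every real
    -- number involved is a constant sequence, so the required equalities can be checked term by
    -- term.
    convexHull : ∀ x L → All (T ∘ S) (x ∷ L) →
      (∀ i → sumOver (λ x → toℤ (lookup x i)) (x ∷ L) ≡ ℤ.+ suc (length L) ℤ.* toℤ (lookup y i)) →
      embed y ∈Conv S
    convexHull x L xL∈S average = record
      { size        = suc k
      ; point       = List.lookup (x ∷ L)
      ; weight      = λ _ → fromℚ w
      ; point∈S     = λ j → All.lookup xL∈S (∈-lookup j)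
      ; weight≥0    = λ _ ε 0<ε → 0 , λ _ _ → ℚP.≤-trans 0≤w
          (subst (ℚ._≤ w ℚ.+ ε) (ℚP.+-identityʳ w) (ℚP.+-monoʳ-≤ w (ℚP.<⇒≤ 0<ε)))
      ; ∑weight≃1   = seq≡⇒≃ (∑ {suc k} (λ _ → fromℚ w)) (fromℚ 1ℚ) λ l → trans (weights (suc k) l) (m*1/m k)
      ; combination = λ i → seq≡⇒≃ (fromℚ (toℚ (lookup y i))) (∑ λ j → toℚ (lookup (List.lookup (x ∷ L) j) i) · fromℚ w)
          λ l → sym (trans (values i (x ∷ L) l) (scaled (average i)))
      }
      where
      k : ℕ
      k = length L
      w : ℚ
      w = ℤ.+ 1 ℚ./ suc k
      0≤w : 0ℚ ℚ.≤ w
      0≤w = ℚP.nonNegative⁻¹ w {{ℚP.normalize-nonNeg 1 (suc k)}}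

      weights : ∀ m l → seq (∑ {m} (λ _ → fromℚ w)) l ≡ (ℤ.+ m ℚ./ 1) ℚ.* w
      weights zero    l = sym (ℚP.*-zeroˡ w)
      weights (suc m) l = begin
        w ℚ.+ seq (∑ {m} (λ _ → fromℚ w)) l ≡⟨ cong₂ ℚ._+_ (sym (ℚP.*-identityˡ w)) (weights m l) ⟩
        1ℚ ℚ.* w ℚ.+ (ℤ.+ m ℚ./ 1) ℚ.* w ≡⟨ ℚP.*-distribʳ-+ w 1ℚ (ℤ.+ m ℚ./ 1) ⟨
        (1ℚ ℚ.+ (ℤ.+ m ℚ./ 1)) ℚ.* w ≡⟨ cong (ℚ._* w) (/1-+ (ℤ.+ 1) (ℤ.+ m)) ⟨
        (ℤ.+ suc m ℚ./ 1) ℚ.* w ∎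
        where open ≡-Reasoning

      values : ∀ i L l → seq (∑ λ j → toℚ (lookup (List.lookup L j) i) · fromℚ w) l ≡
        (sumOver (λ x → toℤ (lookup x i)) L ℚ./ 1) ℚ.* w
      values i []      l = sym (ℚP.*-zeroˡ w)
      values i (x ∷ L) l = trans (cong (toℚ (lookup x i) ℚ.* w ℚ.+_) (values i L l))
        (trans (sym (ℚP.*-distribʳ-+ w (toℚ (lookup x i)) (s ℚ./ 1))) (cong (ℚ._* w) (sym (/1-+ (toℤ (lookup x i)) s))))
        where
        s : ℤ
        s = sumOver (λ x → toℤ (lookup x i)) L

      scaled : ∀ {s c} → s ≡ ℤ.+ suc k ℤ.* c → (s ℚ./ 1) ℚ.* w ≡ c ℚ./ 1
      scaled {c = c} refl = begin
        ((ℤ.+ suc k ℤ.* c) ℚ./ 1) ℚ.* w ≡⟨ cong (ℚ._* w) (trans (cong (ℚ._/ 1) (ℤP.*-comm (ℤ.+ suc k) c)) (/1-* c (ℤ.+ suc k))) ⟩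
        (c ℚ./ 1) ℚ.* (ℤ.+ suc k ℚ./ 1) ℚ.* w ≡⟨ ℚP.*-assoc (c ℚ./ 1) (ℤ.+ suc k ℚ./ 1) w ⟩
        (c ℚ./ 1) ℚ.* ((ℤ.+ suc k ℚ./ 1) ℚ.* w) ≡⟨ cong ((c ℚ./ 1) ℚ.*_) (m*1/m k) ⟩
        (c ℚ./ 1) ℚ.* 1ℚ ≡⟨ ℚP.*-identityʳ (c ℚ./ 1) ⟩
        c ℚ./ 1 ∎
        where open ≡-Reasoning

    zero-difference : Sum differences zeroVec → embed y ∈Conv S
    zero-difference s with toList s
    ... | x , L , xL∈S , eq = convexHull x L xL∈S λ i → ℤP.i-j≡0⇒i≡j _ _ (trans
      (sym (sumOver-minus (λ x → toℤ (lookup x i)) (toℤ (lookup y i)) (x ∷ L)))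
      (trans (sym (eq i)) (lookup-replicate i 0ℤ)))

    module _ (conv : Convex S) (y∉S : S y ≡ false) where

      -- In Gordan's alternative, a vanishing sum of differences x - y would make `y` an average of
      -- points of `S`, against convexity.
      separating : ∃[ a ] ∀ x → S x ≡ true → a ∙ difference x y ℤ.< 0ℤ
      separating with gordan n differences
      ... | inj₁ s = ⊥-elim (subst T y∉S (Equivalence.from (conv y) (zero-difference s)))
      ... | inj₂ (a , neg) = a , λ x x∈S → All.lookup neg (∈-map⁺ (λ x → difference x y)
        (∈-filter⁺ (T? ∘ S) (∈-allPoints x) (Equivalence.from T-≡ x∈S)))

      convex-stay : ∀ t → centralBinomial t ℕ.* ν t (zeros y) ℕ.≤ 4 ℕ.^ t ℕ.* stay S t y
      convex-stay with separating
      ... | a , neg = stay-lower-separated S y a neg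

-- Levels of the cube and the crossing rates of the edges between them.

module Levels where

  open Walk
  open Sums
  open import Data.Bool using (Bool; true; false)
  open import Data.Nat
  open import Data.Nat.Properties
  open import Data.Nat.Tactic.RingSolver using (solve-∀)
  open import Data.Vec using ([]; _∷_)
  open import Relation.Binary.PropositionalEquality
  open import Defs using (−1; O; +1; Point)

  -- The sum of f over the points with exactly j nonzero coordinates.
  level : ∀ {n} → ℕ → (Point n → ℕ) → ℕ
  level {zero}  zero    f = f []
  level {zero}  (suc j) f = 0
  level {suc n} zero    f = level zero (λ x → f (O ∷ x))
  level {suc n} (suc j) f = level (suc j) (λ x → f (O ∷ x)) + (level j (λ x → f (+1 ∷ x)) + level j (λ x → f (−1 ∷ x)))

  level-mono : ∀ {n} j {f g : Point n → ℕ} → (∀ x → zeros x + j ≡ n → f x ≤ g x) → level j f ≤ level j g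
  level-mono {zero}  zero    f≤g = f≤g [] refl
  level-mono {zero}  (suc j) f≤g = z≤n
  level-mono {suc n} zero    f≤g = level-mono zero (λ x p → f≤g (O ∷ x) (cong suc p))
  level-mono {suc n} (suc j) f≤g = +-mono-≤ (level-mono (suc j) (λ x p → f≤g (O ∷ x) (cong suc p)))
    (+-mono-≤ (level-mono j (λ x p → f≤g (+1 ∷ x) (trans (+-suc (zeros x) j) (cong suc p))))
              (level-mono j (λ x p → f≤g (−1 ∷ x) (trans (+-suc (zeros x) j) (cong suc p)))))

  level-cong : ∀ {n} j {f g : Point n → ℕ} → (∀ x → zeros x + j ≡ n → f x ≡ g x) → level j f ≡ level j g
  level-cong j f≡g = ≤-antisym (level-mono j (λ x p → ≤-reflexive (f≡g x p)))
                               (level-mono j (λ x p → ≤-reflexive (sym (f≡g x p))))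

  level-+ : ∀ {n} j (f g : Point n → ℕ) → level j (λ x → f x + g x) ≡ level j f + level j g
  level-+ {zero}  zero    f g = refl
  level-+ {zero}  (suc j) f g = refl
  level-+ {suc n} zero    f g = level-+ {n} zero _ _
  level-+ {suc n} (suc j) f g = trans
    (cong₂ _+_ (level-+ {n} (suc j) _ _) (cong₂ _+_ (level-+ {n} j _ _) (level-+ {n} j _ _)))
    (arith (level {n} (suc j) _) (level {n} (suc j) _) (level {n} j _) (level {n} j _) (level {n} j _) (level {n} j _))
    where
    arith : ∀ a b c d e f → a + b + (c + d + (e + f)) ≡ a + (c + e) + (b + (d + f))
    arith = solve-∀

  level-* : ∀ {n} j c (f : Point n → ℕ) → level j (λ x → c * f x) ≡ c * level j f
  level-* {zero}  zero    c f = refl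
  level-* {zero}  (suc j) c f = sym (*-zeroʳ c)
  level-* {suc n} zero    c f = level-* {n} zero c _
  level-* {suc n} (suc j) c f = trans
    (cong₂ _+_ (level-* {n} (suc j) c _) (cong₂ _+_ (level-* {n} j c _) (level-* {n} j c _)))
    (arith c (level {n} (suc j) _) (level {n} j _) (level {n} j _))
    where
    arith : ∀ c x y z → c * x + (c * y + c * z) ≡ c * (x + (y + z))
    arith = solve-∀

  level-0 : ∀ {n} j → level {n} j (λ _ → 0) ≡ 0
  level-0 {n} j = level-* {n} j 0 (λ _ → 0)

  level-beyond : ∀ {n} j (f : Point n → ℕ) → n < j → level j f ≡ 0
  level-beyond {zero}  (suc j) f _         = refl
  level-beyond {suc n} (suc j) f (s≤s n<j) =
    cong₂ _+_ (level-beyond (suc j) _ (m≤n⇒m≤1+n n<j))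
              (cong₂ _+_ (level-beyond j _ n<j) (level-beyond j _ n<j))

  -- A point with j + 1 nonzero coordinates is a successor of exactly j + 1 points: any one of these
  -- coordinates may be reset to zero.
  level-U : ∀ {n} j (f : Point n → ℕ) → level j (U f) ≡ suc j * level (suc j) f
  level-U {zero}  zero    f = refl
  level-U {zero}  (suc j) f = sym (*-zeroʳ (suc (suc j)))
  level-U {suc n} zero    f = begin
    level {n} 0 (λ x → f (+1 ∷ x) + f (−1 ∷ x) + U (λ y → f (O ∷ y)) x)
      ≡⟨ level-+ {n} 0 (λ x → f (+1 ∷ x) + f (−1 ∷ x)) _ ⟩
    level {n} 0 (λ x → f (+1 ∷ x) + f (−1 ∷ x)) + level {n} 0 (U (λ y → f (O ∷ y)))
      ≡⟨ cong₂ _+_ (level-+ {n} 0 (λ x → f (+1 ∷ x)) _) (level-U {n} 0 (λ y → f (O ∷ y))) ⟩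
    level {n} 0 (λ x → f (+1 ∷ x)) + level {n} 0 (λ x → f (−1 ∷ x)) + 1 * level {n} 1 (λ y → f (O ∷ y))
      ≡⟨ arith (level {n} 0 (λ x → f (+1 ∷ x))) (level {n} 0 (λ x → f (−1 ∷ x))) (level {n} 1 (λ y → f (O ∷ y))) ⟩
    1 * level {suc n} 1 f ∎
    where
    open ≡-Reasoning
    arith : ∀ a b c → a + b + 1 * c ≡ 1 * (c + (a + b))
    arith = solve-∀
  level-U {suc n} (suc j) f = begin
    level {n} (suc j) (λ x → f (+1 ∷ x) + f (−1 ∷ x) + U (λ y → f (O ∷ y)) x)
      + (level {n} j (U (λ y → f (+1 ∷ y))) + level {n} j (U (λ y → f (−1 ∷ y))))
      ≡⟨ cong₂ _+_ (trans (level-+ {n} (suc j) (λ x → f (+1 ∷ x) + f (−1 ∷ x)) _)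
           (cong₂ _+_ (level-+ {n} (suc j) (λ x → f (+1 ∷ x)) _) (level-U {n} (suc j) (λ y → f (O ∷ y)))))
           (cong₂ _+_ (level-U {n} j (λ y → f (+1 ∷ y))) (level-U {n} j (λ y → f (−1 ∷ y)))) ⟩
    p + m + suc (suc j) * o + (suc j * p + suc j * m) ≡⟨ arith j p m o ⟩
    suc (suc j) * (o + (p + m)) ∎
    where
    open ≡-Reasoning
    p m o : ℕ
    p = level {n} (suc j) (λ x → f (+1 ∷ x))
    m = level {n} (suc j) (λ x → f (−1 ∷ x))
    o = level {n} (suc (suc j)) (λ x → f (O ∷ x))
    arith : ∀ j p m o → p + m + suc (suc j) * o + (suc j * p + suc j * m) ≡ suc (suc j) * (o + (p + m))
    arith = solve-∀

  levelSize : ℕ → ℕ → ℕ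
  levelSize n j = level {n} j (λ _ → 1)

  -- Both sides count the edges between levels j and j + 1, from above and from below.
  levelSize-step : ∀ {n} k j → k + j ≡ n → suc j * levelSize n (suc j) ≡ 2 * k * levelSize n j
  levelSize-step {n} k j k+j≡n = begin
    suc j * levelSize n (suc j) ≡⟨ level-U {n} j (λ _ → 1) ⟨
    level {n} j (U (λ _ → 1))
      ≡⟨ level-cong {n} j (λ x p → trans (U-1 x) (trans
           (cong (2 *_) (+-cancelʳ-≡ j (zeros x) k (trans p (sym k+j≡n)))) (sym (*-identityʳ (2 * k))))) ⟩
    level {n} j (λ _ → 2 * k * 1) ≡⟨ level-* {n} j (2 * k) (λ _ → 1) ⟩
    2 * k * levelSize n j ∎
    where open ≡-Reasoning

  levelSize-0 : ∀ n → levelSize n 0 ≡ 1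
  levelSize-0 zero    = refl
  levelSize-0 (suc n) = levelSize-0 n

  levelSize-! : ∀ {n} k j → k + j ≡ n → levelSize n j * (j ! * k !) ≡ n ! * 2 ^ j
  levelSize-! {n} k zero    p rewrite trans (sym (+-identityʳ k)) p | levelSize-0 n = arith (n !)
    where
    arith : ∀ f → 1 * (1 * f) ≡ f * 1
    arith = solve-∀
  levelSize-! {n} k (suc j) p = begin
    levelSize n (suc j) * (suc j * j ! * k !) ≡⟨ arith₁ (levelSize n (suc j)) j (j !) (k !) ⟩
    suc j * levelSize n (suc j) * (j ! * k !) ≡⟨ cong (_* (j ! * k !)) (levelSize-step (suc k) j p′) ⟩
    2 * suc k * levelSize n j * (j ! * k !) ≡⟨ arith₂ k (levelSize n j) (j !) (k !) ⟩
    2 * (levelSize n j * (j ! * (suc k * k !))) ≡⟨ cong (2 *_) (levelSize-! (suc k) j p′) ⟩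
    2 * (n ! * 2 ^ j) ≡⟨ arith₃ (n !) (2 ^ j) ⟩
    n ! * 2 ^ suc j ∎
    where
    open ≡-Reasoning
    p′ : suc k + j ≡ n
    p′ = trans (sym (+-suc k j)) p
    arith₁ : ∀ w j f g → w * (suc j * f * g) ≡ suc j * w * (f * g)
    arith₁ = solve-∀
    arith₂ : ∀ k w f g → 2 * suc k * w * (f * g) ≡ 2 * (w * (f * (suc k * g)))
    arith₂ = solve-∀
    arith₃ : ∀ f p → 2 * (f * p) ≡ f * (2 * p)
    arith₃ = solve-∀

  ν-! : ∀ t r → ν t (t + r) * r ! ≡ 2 ^ t * (t + r) !
  ν-! zero    r = refl
  ν-! (suc t) r = trans (arith₁ (t + r) (ν t (t + r)) (r !))
    (trans (cong (2 * suc (t + r) *_) (ν-! t r)) (arith₂ (t + r) (2 ^ t) ((t + r) !)))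
    where
    arith₁ : ∀ z v f → 2 * suc z * v * f ≡ 2 * suc z * (v * f)
    arith₁ = solve-∀
    arith₂ : ∀ z p f → 2 * suc z * (p * f) ≡ 2 * p * (suc z * f)
    arith₂ = solve-∀

  sumPoints : ∀ n → (Point n → ℕ) → ℕ
  sumPoints zero    f = f []
  sumPoints (suc n) f = sumPoints n (λ x → f (−1 ∷ x)) + (sumPoints n (λ x → f (O ∷ x)) + sumPoints n (λ x → f (+1 ∷ x)))

  sum-levels : ∀ n (f : Point n → ℕ) → Σ< (suc n) (λ j → level j f) ≡ sumPoints n f
  sum-levels zero    f = +-identityʳ (f [])
  sum-levels (suc n) f = begin
    level {n} 0 fO + Σ< (suc n) (λ j → level {n} (suc j) fO + (level j f+ + level j f−))
      ≡⟨ cong (level {n} 0 fO +_) (trans (Σ<-+ (suc n) (λ j → level {n} (suc j) fO) (λ j → level j f+ + level j f−))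
           (cong (Σ< (suc n) (λ j → level {n} (suc j) fO) +_) (Σ<-+ (suc n) (λ j → level j f+) (λ j → level j f−)))) ⟩
    level {n} 0 fO + (Σ< (suc n) (λ j → level {n} (suc j) fO) + (Σ< (suc n) (λ j → level j f+) + Σ< (suc n) (λ j → level j f−)))
      ≡⟨ +-assoc (level {n} 0 fO) _ _ ⟨
    Σ< (suc (suc n)) (λ j → level j fO) + (Σ< (suc n) (λ j → level j f+) + Σ< (suc n) (λ j → level j f−))
      ≡⟨ cong₂ _+_ (trans (Σ<-last (suc n) (λ j → level j fO))
           (trans (cong (Σ< (suc n) (λ j → level j fO) +_) (level-beyond {n} (suc n) fO ≤-refl)) (+-identityʳ _)))
           refl ⟩
    Σ< (suc n) (λ j → level j fO) + (Σ< (suc n) (λ j → level j f+) + Σ< (suc n) (λ j → level j f−))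
      ≡⟨ cong₂ _+_ (sum-levels n fO) (cong₂ _+_ (sum-levels n f+) (sum-levels n f−)) ⟩
    sumPoints n fO + (sumPoints n f+ + sumPoints n f−)
      ≡⟨ arith (sumPoints n fO) (sumPoints n f+) (sumPoints n f−) ⟩
    sumPoints (suc n) f ∎
    where
    open ≡-Reasoning
    fO f+ f− : Point n → ℕ
    fO x = f (O ∷ x)
    f+ x = f (+1 ∷ x)
    f− x = f (−1 ∷ x)
    arith : ∀ a b c → a + (b + c) ≡ c + (a + b)
    arith = solve-∀

  sumPoints-1 : ∀ n → sumPoints n (λ _ → 1) ≡ 3 ^ n
  sumPoints-1 zero    = refl
  sumPoints-1 (suc n) rewrite sumPoints-1 n = cong (λ z → 3 ^ n + (3 ^ n + z)) (sym (+-identityʳ (3 ^ n)))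

  module _ {n} (S : Point n → Bool) where

    crossingAt : ℕ → ℕ
    crossingAt i = level {n} i (crossing S)

    -- n! 2ⁿ times the probability that a uniformly random edge from level i to
    -- level i + 1 crosses the boundary of S.
    crossingRate : ℕ → ℕ
    crossingRate i = i ! * ((n ∸ suc i) ! * 2 ^ (n ∸ suc i)) * crossingAt i

    -- There are 2^(j + t) n! / (j! r!) walks of t steps from level j, where r is the number of
    -- zeros at their ends. The factors on the left normalise this to n! 2ⁿ for all j and t. All
    -- edges above level j + s are used equally often in step s, which yields
    -- `crossingRate (j + s)`.
    crossings-window : ∀ t r j → j + t + r ≡ n →
      2 ^ r * r ! * (j ! * level j (crossings S t)) ≡ Σ< t (λ s → crossingRate (j + s))
    crossings-window zero    r j _ rewrite level-0 {n} j = trans (cong (2 ^ r * r ! *_) (*-zeroʳ (j !))) (*-zeroʳ (2 ^ r * r !))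
    crossings-window (suc t) r j p = begin
      2 ^ r * r ! * (j ! * level j (crossings S (suc t)))
        ≡⟨ cong (λ z → 2 ^ r * r ! * (j ! * z)) (trans
             (level-+ {n} j (λ x → ν t (pred (zeros x)) * crossing S x) (U (crossings S t)))
             (cong₂ _+_ (trans (level-cong {n} j (λ x q → cong (λ z → ν t (pred z) * crossing S x) (zeros≡ x q)))
                               (level-* {n} j (ν t (t + r)) (crossing S)))
                        (level-U {n} j (crossings S t)))) ⟩
      2 ^ r * r ! * (j ! * (ν t (t + r) * crossingAt j + suc j * L))
        ≡⟨ arith₁ (2 ^ r) (r !) (j !) (ν t (t + r)) (crossingAt j) j L ⟩
      2 ^ r * (ν t (t + r) * r !) * (j ! * crossingAt j) + 2 ^ r * r ! * (suc j * j ! * L)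
        ≡⟨ cong₂ _+_ first (trans (crossings-window t r (suc j) (trans (cong (_+ r) (sym (+-suc j t))) p))
             (Σ<-cong t (λ s _ → cong crossingRate (sym (+-suc j s))))) ⟩
      crossingRate (j + 0) + Σ< t (λ s → crossingRate (j + suc s)) ∎
      where
      open ≡-Reasoning
      L : ℕ
      L = level {n} (suc j) (crossings S t)
      p′ : suc (t + r) + j ≡ n
      p′ = trans (arith j t r) p
        where
        arith : ∀ j t r → suc (t + r) + j ≡ j + suc t + r
        arith = solve-∀
      zeros≡ : ∀ x → zeros x + j ≡ n → zeros x ≡ suc (t + r)
      zeros≡ x q = +-cancelʳ-≡ j (zeros x) (suc (t + r)) (trans q (sym p′))
      above : n ∸ suc j ≡ t + r
      above = trans (cong (_∸ suc j) (trans (sym p′) (sym (+-suc (t + r) j)))) (m+n∸n≡m (t + r) (suc j))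
      arith₁ : ∀ p f g v x j l → p * f * (g * (v * x + suc j * l)) ≡ p * (v * f) * (g * x) + p * f * (suc j * g * l)
      arith₁ = solve-∀
      arith₂ : ∀ p q f g x → p * (q * f) * (g * x) ≡ g * (f * (q * p)) * x
      arith₂ = solve-∀
      first : 2 ^ r * (ν t (t + r) * r !) * (j ! * crossingAt j) ≡ crossingRate (j + 0)
      first rewrite +-identityʳ j | above | ν-! t r | ^-distribˡ-+-* 2 t r =
        arith₂ (2 ^ r) (2 ^ t) ((t + r) !) (j !) (crossingAt j)

    -- An edge from level i to level i + 1 consists of a coordinate, a sign, and a point with i
    -- nonzero entries on the other n - 1 coordinates. This makes 2 n · `levelSize (k + i) i` edges,
    -- so the rates are averaged with the level sizes of dimension n - 1 as weights.
    crossingRate-crossingAt : ∀ k i → n ≡ suc (k + i) →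
      n ! * 2 ^ n * crossingAt i ≡ 2 * n * levelSize (k + i) i * crossingRate i
    crossingRate-crossingAt k i refl = begin
      suc (k + i) * (k + i) ! * (2 * 2 ^ (k + i)) * crossingAt i
        ≡⟨ cong (λ z → suc (k + i) * (k + i) ! * (2 * z) * crossingAt i) (^-distribˡ-+-* 2 k i) ⟩
      suc (k + i) * (k + i) ! * (2 * (2 ^ k * 2 ^ i)) * crossingAt i
        ≡⟨ arith₁ (k + i) ((k + i) !) (2 ^ k) (2 ^ i) (crossingAt i) ⟩
      2 * suc (k + i) * ((k + i) ! * 2 ^ i) * (2 ^ k * crossingAt i)
        ≡⟨ cong (λ z → 2 * suc (k + i) * z * (2 ^ k * crossingAt i)) (levelSize-! k i refl) ⟨
      2 * suc (k + i) * (levelSize (k + i) i * (i ! * k !)) * (2 ^ k * crossingAt i)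
        ≡⟨ arith₂ (k + i) (levelSize (k + i) i) (i !) (k !) (2 ^ k) (crossingAt i) ⟩
      2 * suc (k + i) * levelSize (k + i) i * (i ! * (k ! * 2 ^ k) * crossingAt i)
        ≡⟨ cong (λ q → 2 * suc (k + i) * levelSize (k + i) i * (i ! * (q ! * 2 ^ q) * crossingAt i)) (m+n∸n≡m k i) ⟨
      2 * suc (k + i) * levelSize (k + i) i * crossingRate i ∎
      where
      open ≡-Reasoning
      arith₁ : ∀ m f p q x → suc m * f * (2 * (p * q)) * x ≡ 2 * suc m * (f * q) * (p * x)
      arith₁ = solve-∀
      arith₂ : ∀ m w f g p x → 2 * suc m * (w * (f * g)) * (p * x) ≡ 2 * suc m * w * (f * (g * p) * x)
      arith₂ = solve-∀

    sum-crossingAt : Σ< n crossingAt ≡ sumPoints n (crossing S)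
    sum-crossingAt = trans (sym (trans (Σ<-last n crossingAt)
        (trans (cong (Σ< n crossingAt +_) top) (+-identityʳ (Σ< n crossingAt))))) (sum-levels n (crossing S))
      where
      none : ∀ x → zeros x ≡ 0 → crossing S x ≡ 0
      none x eq with S x
      ... | true  = U-full (outside S) x eq
      ... | false = U-full (inside S) x eq
      top : crossingAt n ≡ 0
      top = trans (level-cong {n} n {g = λ _ → 0} (λ x p → none x (+-cancelʳ-≡ n (zeros x) 0 p))) (level-0 {n} n)

    module _ (stay-bound : ∀ t x → S x ≡ false → centralBinomial t * ν t (zeros x) ≤ 4 ^ t * stay S t x) where

      -- This is `crossings-bound` summed over the starting points in level j. After division by n!
      -- 2ⁿ the crossing rates of t consecutive levels add up to O(√t).
      window-bound : ∀ t r j → j + t + r ≡ n →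
        centralBinomial t * Σ< t (λ s → crossingRate (j + s)) ≤ 3 * 4 ^ t * (n ! * 2 ^ n)
      window-bound t r j p = begin
        a * Σ< t (λ s → crossingRate (j + s)) ≡⟨ cong (a *_) (crossings-window t r j p) ⟨
        a * (2 ^ r * r ! * (j ! * level j (crossings S t))) ≡⟨ arith₁ a (2 ^ r * r !) (j !) (level j (crossings S t)) ⟩
        2 ^ r * r ! * (j ! * (a * level j (crossings S t)))
          ≤⟨ *-monoʳ-≤ (2 ^ r * r !) (*-monoʳ-≤ (j !) level-bound) ⟩
        2 ^ r * r ! * (j ! * (3 * 4 ^ t * (ν t (t + r) * levelSize n j)))
          ≡⟨ arith₂ (2 ^ r) (r !) (j !) (3 * 4 ^ t) (ν t (t + r)) (levelSize n j) ⟩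
        3 * 4 ^ t * (2 ^ r * (ν t (t + r) * r !) * (levelSize n j * j !))
          ≡⟨ cong (λ z → 3 * 4 ^ t * (2 ^ r * z * (levelSize n j * j !))) (ν-! t r) ⟩
        3 * 4 ^ t * (2 ^ r * (2 ^ t * (t + r) !) * (levelSize n j * j !))
          ≡⟨ arith₃ (3 * 4 ^ t) (2 ^ r) (2 ^ t) ((t + r) !) (levelSize n j) (j !) ⟩
        3 * 4 ^ t * (2 ^ t * 2 ^ r * (levelSize n j * (j ! * (t + r) !)))
          ≡⟨ cong (λ z → 3 * 4 ^ t * (2 ^ t * 2 ^ r * z)) (levelSize-! (t + r) j p′) ⟩
        3 * 4 ^ t * (2 ^ t * 2 ^ r * (n ! * 2 ^ j)) ≡⟨ arith₄ (3 * 4 ^ t) (2 ^ t) (2 ^ r) (n !) (2 ^ j) ⟩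
        3 * 4 ^ t * (n ! * (2 ^ j * 2 ^ t * 2 ^ r))
          ≡⟨ cong (λ z → 3 * 4 ^ t * (n ! * z)) (trans (cong (_* 2 ^ r) (sym (^-distribˡ-+-* 2 j t)))
               (trans (sym (^-distribˡ-+-* 2 (j + t) r)) (cong (2 ^_) p))) ⟩
        3 * 4 ^ t * (n ! * 2 ^ n) ∎
        where
        open ≤-Reasoning
        a : ℕ
        a = centralBinomial t
        p′ : t + r + j ≡ n
        p′ = trans (+-comm (t + r) j) (trans (sym (+-assoc j t r)) p)
        level-bound : a * level j (crossings S t) ≤ 3 * 4 ^ t * (ν t (t + r) * levelSize n j)
        level-bound = begin
          a * level j (crossings S t) ≡⟨ level-* {n} j a (crossings S t) ⟨
          level {n} j (λ x → a * crossings S t x) ≤⟨ level-mono {n} j (λ x q → ≤-trans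
            (crossings-bound S centralBinomial ≤-refl centralBinomial-≤ stay-bound t x)
            (≤-reflexive (trans (cong (λ z → 3 * 4 ^ t * ν t z) (+-cancelʳ-≡ j (zeros x) (t + r) (trans q (sym p′))))
              (sym (*-identityʳ _))))) ⟩
          level {n} j (λ _ → 3 * 4 ^ t * ν t (t + r) * 1) ≡⟨ level-* {n} j (3 * 4 ^ t * ν t (t + r)) (λ _ → 1) ⟩
          3 * 4 ^ t * ν t (t + r) * levelSize n j ≡⟨ *-assoc (3 * 4 ^ t) _ _ ⟩
          3 * 4 ^ t * (ν t (t + r) * levelSize n j) ∎
        arith₁ : ∀ a p f l → a * (p * (f * l)) ≡ p * (f * (a * l))
        arith₁ = solve-∀
        arith₂ : ∀ p f g c v w → p * f * (g * (c * (v * w))) ≡ c * (p * (v * f) * (w * g))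
        arith₂ = solve-∀
        arith₃ : ∀ c p q f w g → c * (p * (q * f) * (w * g)) ≡ c * (q * p * (w * (g * f)))
        arith₃ = solve-∀
        arith₄ : ∀ c p q f r → c * (p * q * (f * r)) ≡ c * (f * (r * p * q))
        arith₄ = solve-∀

-- Slow decrease of the level sizes on the way towards and past their peak.

module Flat where

  open Sums
  open Levels using (levelSize; levelSize-step)
  open import Data.Nat
  open import Data.Nat.Properties
  open import Data.Nat.Tactic.RingSolver using (solve-∀)
  open import Data.Product using (_×_; _,_; ∃-syntax)
  open import Data.Sum using (_⊎_; inj₁; inj₂)
  open import Relation.Binary.PropositionalEquality

  -- In fractions, (1 - β / N)(1 - γ / N) ≥ 1 - (β + γ) / N; where the subtraction is truncated, the
  -- left side of the lemma is 0.
  ∸-product : ∀ N β γ → N * (N ∸ (β + γ)) ≤ (N ∸ γ) * (N ∸ β)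
  ∸-product N β γ with ≤-total (β + γ) N
  ... | inj₁ β+γ≤N with m≤n⇒∃[o]m+o≡n β+γ≤N
  ...   | r , refl = begin
    (β + γ + r) * (β + γ + r ∸ (β + γ)) ≡⟨ cong ((β + γ + r) *_) (m+n∸m≡n (β + γ) r) ⟩
    (β + γ + r) * r ≤⟨ m≤m+n _ (β * γ) ⟩
    (β + γ + r) * r + β * γ ≡⟨ arith β γ r ⟩
    (β + r) * (γ + r) ≡⟨ cong₂ _*_ (trans (cong (_∸ γ) (arith₁ β γ r)) (m+n∸m≡n γ (β + r)))
                                   (trans (cong (_∸ β) (+-assoc β γ r)) (m+n∸m≡n β (γ + r))) ⟨
    (β + γ + r ∸ γ) * (β + γ + r ∸ β) ∎
    where
    open ≤-Reasoning
    arith : ∀ b c r → (b + c + r) * r + b * c ≡ (b + r) * (c + r)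
    arith = solve-∀
    arith₁ : ∀ b c r → b + c + r ≡ c + (b + r)
    arith₁ = solve-∀
  ∸-product N β γ | inj₂ N≤β+γ =
    ≤-trans (≤-reflexive (trans (cong (N *_) (m≤n⇒m∸n≡0 N≤β+γ)) (*-zeroʳ N))) z≤n

  -- Bernoulli's inequality for the product of the factors 1 - (5 l + 3) / N.
  slow-decay : ∀ N .{{_ : NonZero N}} (g : ℕ → ℕ) L →
    (∀ l → l < L → (N ∸ (5 * l + 3)) * g l ≤ N * g (suc l)) →
    ∀ l → l ≤ L → (N ∸ 5 * (l * l)) * g 0 ≤ N * g l
  slow-decay N g L step zero    _   = ≤-refl
  slow-decay N g L step (suc l) l<L = *-cancelˡ-≤ N (begin
    N * ((N ∸ 5 * (suc l * suc l)) * g 0) ≡⟨ *-assoc N _ (g 0) ⟨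
    N * (N ∸ 5 * (suc l * suc l)) * g 0
      ≤⟨ *-monoˡ-≤ (g 0) (*-monoʳ-≤ N (∸-monoʳ-≤ N (≤-trans (m≤m+n (5 * (l * l) + (5 * l + 3)) (5 * l + 2)) (≤-reflexive (arith₁ l))))) ⟩
    N * (N ∸ (5 * (l * l) + (5 * l + 3))) * g 0 ≤⟨ *-monoˡ-≤ (g 0) (∸-product N (5 * (l * l)) (5 * l + 3)) ⟩
    (N ∸ (5 * l + 3)) * (N ∸ 5 * (l * l)) * g 0 ≡⟨ *-assoc (N ∸ (5 * l + 3)) _ (g 0) ⟩
    (N ∸ (5 * l + 3)) * ((N ∸ 5 * (l * l)) * g 0)
      ≤⟨ *-monoʳ-≤ (N ∸ (5 * l + 3)) (slow-decay N g L step l (<⇒≤ l<L)) ⟩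
    (N ∸ (5 * l + 3)) * (N * g l) ≡⟨ arith₂ (N ∸ (5 * l + 3)) N (g l) ⟩
    N * ((N ∸ (5 * l + 3)) * g l) ≤⟨ *-monoʳ-≤ N (step l l<L) ⟩
    N * (N * g (suc l)) ∎)
    where
    open ≤-Reasoning
    arith₁ : ∀ l → 5 * (l * l) + (5 * l + 3) + (5 * l + 2) ≡ 5 * (suc l * suc l)
    arith₁ = solve-∀
    arith₂ : ∀ a b c → a * (b * c) ≡ b * (a * c)
    arith₂ = solve-∀

  slow-decay-half : ∀ N .{{_ : NonZero N}} (g : ℕ → ℕ) L → 10 * (L * L) ≤ N →
    (∀ l → l < L → (N ∸ (5 * l + 3)) * g l ≤ N * g (suc l)) →
    ∀ l → l ≤ L → g 0 ≤ 2 * g l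
  slow-decay-half N g L 10L²≤N step l l≤L = *-cancelˡ-≤ N (begin
    N * g 0 ≤⟨ *-monoˡ-≤ (g 0) N≤2[N∸β] ⟩
    2 * (N ∸ 5 * (l * l)) * g 0 ≡⟨ *-assoc 2 (N ∸ 5 * (l * l)) (g 0) ⟩
    2 * ((N ∸ 5 * (l * l)) * g 0) ≤⟨ *-monoʳ-≤ 2 (slow-decay N g L step l l≤L) ⟩
    2 * (N * g l) ≡⟨ arith N (g l) ⟩
    N * (2 * g l) ∎)
    where
    open ≤-Reasoning
    arith : ∀ a b → 2 * (a * b) ≡ a * (2 * b)
    arith = solve-∀
    N≤2[N∸β] : N ≤ 2 * (N ∸ 5 * (l * l))
    N≤2[N∸β] with m≤n⇒∃[o]m+o≡n (≤-trans (*-monoʳ-≤ 10 (*-mono-≤ l≤L l≤L)) 10L²≤N)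
    ... | o , refl = begin
      10 * (l * l) + o ≤⟨ m≤m+n _ o ⟩
      10 * (l * l) + o + o ≡⟨ arith₁ (l * l) o ⟩
      2 * (5 * (l * l) + o) ≡⟨ cong (2 *_) (trans (cong (_∸ 5 * (l * l)) (arith₂ (l * l) o)) (m+n∸m≡n (5 * (l * l)) (5 * (l * l) + o))) ⟨
      2 * (10 * (l * l) + o ∸ 5 * (l * l)) ∎
      where
      arith₁ : ∀ x o → 10 * x + o + o ≡ 2 * (5 * x + o)
      arith₁ = solve-∀
      arith₂ : ∀ x o → 10 * x + o ≡ 5 * x + (5 * x + o)
      arith₂ = solve-∀

  ∸-*-≤ : ∀ N γ p q → N * p ≤ N * q + γ * p → (N ∸ γ) * p ≤ N * q
  ∸-*-≤ N γ p q le = ≤-trans (≤-reflexive (*-distribʳ-∸ p N γ))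
    (m≤n+o⇒m∸n≤o (N * p) (γ * p) (≤-trans le (≤-reflexive (+-comm (N * q) (γ * p)))))

  -- levelSize N i is 2ⁱ (N choose i), which peaks at i ≈ 2N/3.
  ascending-ratio : ∀ N i l k → 3 * i ≤ 2 * N → k + (i + l) ≡ N →
    (N ∸ (5 * l + 3)) * levelSize N (i + l) ≤ N * levelSize N (suc (i + l))
  ascending-ratio N i l k 3i≤2N k+i+l≡N = *-cancelˡ-≤ (suc (i + l)) (begin
    m * ((N ∸ γ) * C) ≡⟨ arith₁ m (N ∸ γ) C ⟩
    (N ∸ γ) * m * C ≤⟨ *-monoˡ-≤ C (∸-*-≤ N γ m (2 * k) bound) ⟩
    N * (2 * k) * C ≡⟨ *-assoc N (2 * k) C ⟩
    N * (2 * k * C) ≡⟨ cong (N *_) (levelSize-step k (i + l) k+i+l≡N) ⟨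
    N * (m * levelSize N m) ≡⟨ arith₂ N m (levelSize N m) ⟩
    m * (N * levelSize N m) ∎)
    where
    open ≤-Reasoning
    m γ C : ℕ
    m = suc (i + l)
    γ = 5 * l + 3
    C = levelSize N (i + l)
    arith₁ : ∀ m a c → m * (a * c) ≡ a * m * c
    arith₁ = solve-∀
    arith₂ : ∀ a b c → a * (b * c) ≡ b * (a * c)
    arith₂ = solve-∀
    i≤2k+2l : i ≤ 2 * k + 2 * l
    i≤2k+2l = +-cancelˡ-≤ (2 * i) i (2 * k + 2 * l) (begin
      2 * i + i ≡⟨ arith₃ i ⟩
      3 * i ≤⟨ 3i≤2N ⟩
      2 * N ≡⟨ cong (2 *_) k+i+l≡N ⟨
      2 * (k + (i + l)) ≡⟨ arith₄ k i l ⟩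
      2 * i + (2 * k + 2 * l) ∎)
      where
      arith₃ : ∀ i → 2 * i + i ≡ 3 * i
      arith₃ = solve-∀
      arith₄ : ∀ k i l → 2 * (k + (i + l)) ≡ 2 * i + (2 * k + 2 * l)
      arith₄ = solve-∀
    -- The quotient of the two level sizes is 2 k / m. When it is at most 1, m is at least 2 N / 3,
    -- and the deficit m - 2 k ≤ 3 l + 1 relative to m is at most (3/2)(3 l + 1) / N, within the
    -- allowance `γ` / N.
    bound : N * m ≤ N * (2 * k) + γ * m
    bound with ≤-total m (2 * k)
    ... | inj₁ m≤2k = ≤-trans (*-monoʳ-≤ N m≤2k) (m≤m+n _ _)
    ... | inj₂ 2k≤m = begin
      N * m ≤⟨ *-monoʳ-≤ N (≤-trans (s≤s (+-monoˡ-≤ l i≤2k+2l)) (≤-reflexive (arith₃ k l))) ⟩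
      N * (2 * k + (3 * l + 1)) ≡⟨ *-distribˡ-+ N (2 * k) (3 * l + 1) ⟩
      N * (2 * k) + N * (3 * l + 1) ≤⟨ +-monoʳ-≤ (N * (2 * k)) (*-cancelˡ-≤ 2 (begin
        2 * (N * (3 * l + 1)) ≡⟨ arith₄ N l ⟩
        (3 * l + 1) * (2 * N) ≤⟨ *-monoʳ-≤ (3 * l + 1) 2N≤3m ⟩
        (3 * l + 1) * (3 * m) ≤⟨ m≤m+n _ ((l + 3) * m) ⟩
        (3 * l + 1) * (3 * m) + (l + 3) * m ≡⟨ arith₅ l m ⟩
        2 * (γ * m) ∎)) ⟩
      N * (2 * k) + γ * m ∎
      where
      arith₃ : ∀ k l → suc (2 * k + 2 * l + l) ≡ 2 * k + (3 * l + 1)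
      arith₃ = solve-∀
      arith₄ : ∀ N l → 2 * (N * (3 * l + 1)) ≡ (3 * l + 1) * (2 * N)
      arith₄ = solve-∀
      arith₅ : ∀ l m → (3 * l + 1) * (3 * m) + (l + 3) * m ≡ 2 * ((5 * l + 3) * m)
      arith₅ = solve-∀
      2N≤3m : 2 * N ≤ 3 * m
      2N≤3m = begin
        2 * N ≡⟨ cong (2 *_) k+i+l≡N ⟨
        2 * (k + (i + l)) ≡⟨ *-distribˡ-+ 2 k (i + l) ⟩
        2 * k + 2 * (i + l) ≤⟨ +-mono-≤ 2k≤m (*-monoʳ-≤ 2 (n≤1+n (i + l))) ⟩
        3 * m ∎

  -- The mirror image above the peak, with quotient `suc p` / (2 k). In the critical case N ≤ 3 k
  -- and the deficit is at most 3 l + 2, so (3/2)(3 l + 2) has to fit under `γ`; the constant term 3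
  -- of `γ` is what this requires.
  descending-ratio : ∀ N p l k → 2 * N ≤ 3 * (suc p + l) → k + p ≡ N →
    (N ∸ (5 * l + 3)) * levelSize N (suc p) ≤ N * levelSize N p
  descending-ratio N p l k 2N≤3i k+p≡N = *-cancelˡ-≤ (suc p) (begin
    suc p * ((N ∸ γ) * levelSize N (suc p)) ≡⟨ arith₁ (suc p) (N ∸ γ) (levelSize N (suc p)) ⟩
    (N ∸ γ) * (suc p * levelSize N (suc p)) ≡⟨ cong ((N ∸ γ) *_) (levelSize-step k p k+p≡N) ⟩
    (N ∸ γ) * (2 * k * levelSize N p) ≡⟨ *-assoc (N ∸ γ) (2 * k) (levelSize N p) ⟨
    (N ∸ γ) * (2 * k) * levelSize N p ≤⟨ *-monoˡ-≤ (levelSize N p) (∸-*-≤ N γ (2 * k) (suc p) bound) ⟩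
    N * suc p * levelSize N p ≡⟨ arith₂ N (suc p) (levelSize N p) ⟩
    suc p * (N * levelSize N p) ∎)
    where
    open ≤-Reasoning
    γ : ℕ
    γ = 5 * l + 3
    arith₁ : ∀ a b c → a * (b * c) ≡ b * (a * c)
    arith₁ = solve-∀
    arith₂ : ∀ a b c → a * b * c ≡ b * (a * c)
    arith₂ = solve-∀
    2k≤ : 2 * k ≤ suc p + (3 * l + 2)
    2k≤ = +-cancelʳ-≤ (2 * p) (2 * k) (suc p + (3 * l + 2)) (begin
      2 * k + 2 * p ≡⟨ *-distribˡ-+ 2 k p ⟨
      2 * (k + p) ≡⟨ cong (2 *_) k+p≡N ⟩
      2 * N ≤⟨ 2N≤3i ⟩
      3 * (suc p + l) ≡⟨ arith₃ p l ⟩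
      suc p + (3 * l + 2) + 2 * p ∎)
      where
      arith₃ : ∀ p l → 3 * (suc p + l) ≡ suc p + (3 * l + 2) + 2 * p
      arith₃ = solve-∀
    bound : N * (2 * k) ≤ N * suc p + γ * (2 * k)
    bound with ≤-total (2 * k) (suc p)
    ... | inj₁ 2k≤p = ≤-trans (*-monoʳ-≤ N 2k≤p) (m≤m+n _ _)
    ... | inj₂ p≤2k = begin
      N * (2 * k) ≤⟨ *-monoʳ-≤ N 2k≤ ⟩
      N * (suc p + (3 * l + 2)) ≡⟨ *-distribˡ-+ N (suc p) (3 * l + 2) ⟩
      N * suc p + N * (3 * l + 2) ≤⟨ +-monoʳ-≤ (N * suc p) (begin
        N * (3 * l + 2) ≤⟨ *-monoˡ-≤ (3 * l + 2) N≤3k ⟩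
        3 * k * (3 * l + 2) ≤⟨ m≤m+n _ (l * k) ⟩
        3 * k * (3 * l + 2) + l * k ≡⟨ arith₄ k l ⟩
        γ * (2 * k) ∎) ⟩
      N * suc p + γ * (2 * k) ∎
      where
      arith₄ : ∀ k l → 3 * k * (3 * l + 2) + l * k ≡ (5 * l + 3) * (2 * k)
      arith₄ = solve-∀
      N≤3k : N ≤ 3 * k
      N≤3k = begin
        N ≡⟨ k+p≡N ⟨
        k + p ≤⟨ +-monoʳ-≤ k (≤-trans (n≤1+n p) p≤2k) ⟩
        k + 2 * k ∎

  -- The window runs from `i` in the direction of the peak: it begins at `i` if `i` is at most 2N /
  -- 3 and ends there otherwise. Along it sizes can drop only after the peak is passed, and over t ≤
  -- √(N / 10) levels they drop at most by half.
  flat-window : ∀ N t → 1 ≤ t → 10 * (t * t) ≤ N → ∀ i → i ≤ N →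
    ∃[ j ] j + t ≤ suc N × (∀ s → s < t → ∣ i - (j + s) ∣ < t × levelSize N i ≤ 2 * levelSize N (j + s))
  flat-window N t 1≤t 10t²≤N i i≤N = by-side (≤-total (3 * i) (2 * N))
    where
    open ≤-Reasoning
    10t≤N : 10 * t ≤ N
    10t≤N = ≤-trans (*-monoʳ-≤ 10 (m≤m*n t t {{>-nonZero 1≤t}})) 10t²≤N
    instance
      N≢0 : NonZero N
      N≢0 = >-nonZero (≤-trans 1≤t (≤-trans (m≤n*m t 10) 10t≤N))
    by-side : 3 * i ≤ 2 * N ⊎ 2 * N ≤ 3 * i →
      ∃[ j ] j + t ≤ suc N × (∀ s → s < t → ∣ i - (j + s) ∣ < t × levelSize N i ≤ 2 * levelSize N (j + s))
    by-side (inj₁ 3i≤2N) = i , m≤n⇒m≤1+n i+t≤N , λ s s<t →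
        subst (_< t) (sym (∣m-m+n∣≡n i s)) s<t ,
        subst (λ z → levelSize N z ≤ 2 * levelSize N (i + s)) (+-identityʳ i)
          (slow-decay-half N (λ l → levelSize N (i + l)) t 10t²≤N
            (λ l l<t → subst (λ z → (N ∸ (5 * l + 3)) * levelSize N (i + l) ≤ N * levelSize N z) (sym (+-suc i l))
              (ascending-ratio N i l (N ∸ (i + l)) 3i≤2N (m∸n+n≡m (≤-trans (+-monoʳ-≤ i (<⇒≤ l<t)) i+t≤N))))
            s (<⇒≤ s<t))
      where
      i+t≤N : i + t ≤ N
      i+t≤N = *-cancelˡ-≤ 3 (begin
        3 * (i + t) ≡⟨ *-distribˡ-+ 3 i t ⟩
        3 * i + 3 * t ≤⟨ +-mono-≤ 3i≤2N (≤-trans (*-monoˡ-≤ t {3} {10} (s≤s (s≤s (s≤s z≤n)))) 10t≤N) ⟩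
        2 * N + N ≡⟨ +-comm (2 * N) N ⟩
        3 * N ∎)
    by-side (inj₂ 2N≤3i) with m≤n⇒∃[o]m+o≡n 1≤t
    ... | t′ , refl = i ∸ t′ , ≤-trans (≤-reflexive (+-suc (i ∸ t′) t′)) (s≤s (≤-trans (≤-reflexive (m∸n+n≡m t′≤i)) i≤N)) ,
        λ { s (s≤s s≤t′) → close s s≤t′ }
      where
      t′≤i : t′ ≤ i
      t′≤i = *-cancelˡ-≤ 3 (begin
        3 * t′ ≤⟨ *-mono-≤ {3} {10} (s≤s (s≤s (s≤s z≤n))) (n≤1+n t′) ⟩
        10 * suc t′ ≤⟨ 10t≤N ⟩
        N ≤⟨ m≤n*m N 2 ⟩
        2 * N ≤⟨ 2N≤3i ⟩
        3 * i ∎)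
      decay : ∀ l → l ≤ t′ → levelSize N i ≤ 2 * levelSize N (i ∸ l)
      decay = slow-decay-half N (λ l → levelSize N (i ∸ l)) t′
        (≤-trans (*-monoʳ-≤ 10 (*-mono-≤ (n≤1+n t′) (n≤1+n t′))) 10t²≤N)
        λ l l<t′ → subst (λ z → (N ∸ (5 * l + 3)) * levelSize N z ≤ N * levelSize N (i ∸ suc l))
          (sym (+-∸-assoc 1 (≤-trans l<t′ t′≤i)))
          (descending-ratio N (i ∸ suc l) l (N ∸ (i ∸ suc l))
            (≤-trans 2N≤3i (≤-reflexive (cong (3 *_) (sym (trans (sym (+-suc (i ∸ suc l) l)) (m∸n+n≡m (≤-trans l<t′ t′≤i)))))))
            (m∸n+n≡m (≤-trans (m∸n≤m i (suc l)) i≤N)))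
      close : ∀ s → s ≤ t′ → ∣ i - (i ∸ t′ + s) ∣ < suc t′ × levelSize N i ≤ 2 * levelSize N (i ∸ t′ + s)
      close s s≤t′ = s≤s (subst (_≤ t′) (sym distance) (m∸n≤m t′ s)) ,
        subst (λ z → levelSize N i ≤ 2 * levelSize N z) (sym index) (decay (t′ ∸ s) (m∸n≤m t′ s))
        where
        index : i ∸ t′ + s ≡ i ∸ (t′ ∸ s)
        index = begin-equality
          i ∸ t′ + s ≡⟨ cong (λ z → i ∸ z + s) (m∸n+n≡m s≤t′) ⟨
          i ∸ (t′ ∸ s + s) + s ≡⟨ cong (_+ s) (∸-+-assoc i (t′ ∸ s) s) ⟨
          i ∸ (t′ ∸ s) ∸ s + s ≡⟨ m∸n+n≡m (m+n≤o⇒m≤o∸n s (subst (_≤ i) (sym (m+[n∸m]≡n s≤t′)) t′≤i)) ⟩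
          i ∸ (t′ ∸ s) ∎
        distance : ∣ i - (i ∸ t′ + s) ∣ ≡ t′ ∸ s
        distance = trans (cong (∣ i -_∣) index) (trans (m≤n⇒∣n-m∣≡n∸m (m∸n≤m i (t′ ∸ s)))
          (m∸[m∸n]≡n (≤-trans (m∸n≤m t′ s) t′≤i)))

-- Boundary edges, counted at the endpoint with more zeros.

module EdgeCount where

  open Walk
  open Levels using (sumPoints)
  open import Data.Bool using (Bool; true; false; if_then_else_)
  open import Data.Bool.Properties using () renaming (_≟_ to _≟ᵇ_)
  open import Data.List using (List; []; _∷_; _++_; filter; length; map)
  open import Data.List.Properties using (++-identityʳ)
  open import Data.Nat
  open import Data.Nat.Properties
  open import Data.Nat.Tactic.RingSolver using (solve-∀)
  open import Data.Product using (_,_)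
  open import Data.Vec using ([]; _∷_)
  open import Function using (_∘_)
  open import Relation.Binary.PropositionalEquality
  open import Relation.Nullary using (Dec; yes; no; ¬_; ¬?)
  open import Defs using (−1; O; +1; Point; allPoints; pairs; distance; edges; Subset)

  total : ∀ {A : Set} → (A → ℕ) → List A → ℕ
  total f []       = 0
  total f (x ∷ xs) = f x + total f xs

  total-++ : ∀ {A : Set} (f : A → ℕ) xs ys → total f (xs ++ ys) ≡ total f xs + total f ys
  total-++ f []       ys = refl
  total-++ f (x ∷ xs) ys = trans (cong (f x +_) (total-++ f xs ys)) (sym (+-assoc (f x) _ _))

  total-map : ∀ {A B : Set} (f : B → ℕ) (g : A → B) xs → total f (map g xs) ≡ total (f ∘ g) xs
  total-map f g []       = refl
  total-map f g (x ∷ xs) = cong (f (g x) +_) (total-map f g xs)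

  total-cong : ∀ {A : Set} {f g : A → ℕ} xs → (∀ x → f x ≡ g x) → total f xs ≡ total g xs
  total-cong []       f≡g = refl
  total-cong (x ∷ xs) f≡g = cong₂ _+_ (f≡g x) (total-cong xs f≡g)

  total-+ : ∀ {A : Set} (f g : A → ℕ) xs → total (λ x → f x + g x) xs ≡ total f xs + total g xs
  total-+ f g []       = refl
  total-+ f g (x ∷ xs) = trans (cong (f x + g x +_) (total-+ f g xs)) (arith (f x) (g x) _ _)
    where
    arith : ∀ a b c d → (a + b) + (c + d) ≡ (a + c) + (b + d)
    arith = solve-∀

  total-0 : ∀ {A : Set} (xs : List A) → total (λ _ → 0) xs ≡ 0
  total-0 []       = refl
  total-0 (x ∷ xs) = total-0 xs

  total-points : ∀ n (f : Point n → ℕ) → total f (allPoints n) ≡ sumPoints n f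
  total-points zero    f = +-identityʳ (f [])
  total-points (suc n) f = trans (blocks f) (cong₂ _+_ (part −1) (cong₂ _+_ (part O) (part +1)))
    where
    blocks : ∀ f → total f (allPoints (suc n)) ≡
      total f (map (−1 ∷_) (allPoints n)) + (total f (map (O ∷_) (allPoints n)) + total f (map (+1 ∷_) (allPoints n)))
    blocks f = trans (total-++ f (map (−1 ∷_) (allPoints n)) _) (cong (total f (map (−1 ∷_) (allPoints n)) +_)
      (trans (total-++ f (map (O ∷_) (allPoints n)) _) (cong (total f (map (O ∷_) (allPoints n)) +_)
      (trans (total-++ f (map (+1 ∷_) (allPoints n)) []) (+-identityʳ _)))))
    part : ∀ t → total f (map (t ∷_) (allPoints n)) ≡ sumPoints n (λ x → f (t ∷ x))
    part t = trans (total-map f (t ∷_) (allPoints n)) (total-points n (λ x → f (t ∷ x)))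

  pairTotal : ∀ {A : Set} → (A → A → ℕ) → List A → ℕ
  pairTotal f []       = 0
  pairTotal f (x ∷ xs) = total (f x) xs + pairTotal f xs

  total-pairs : ∀ {A : Set} (f : A → A → ℕ) xs → total (λ (x , y) → f x y) (pairs xs) ≡ pairTotal f xs
  total-pairs f []       = refl
  total-pairs f (x ∷ xs) = trans (total-++ (λ (x , y) → f x y) (map (x ,_) xs) (pairs xs))
    (cong₂ _+_ (total-map (λ (x , y) → f x y) (x ,_) xs) (total-pairs f xs))

  pairTotal-++ : ∀ {A : Set} (f : A → A → ℕ) xs ys →
    pairTotal f (xs ++ ys) ≡ pairTotal f xs + total (λ x → total (f x) ys) xs + pairTotal f ys
  pairTotal-++ f []       ys = refl
  pairTotal-++ f (x ∷ xs) ys = trans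
    (cong₂ _+_ (total-++ (f x) xs ys) (pairTotal-++ f xs ys))
    (arith (total (f x) xs) (total (f x) ys) (pairTotal f xs) _ (pairTotal f ys))
    where
    arith : ∀ a b c d e → a + b + (c + d + e) ≡ a + c + (b + d) + e
    arith = solve-∀

  pairTotal-map : ∀ {A B : Set} (f : B → B → ℕ) (g : A → B) xs →
    pairTotal f (map g xs) ≡ pairTotal (λ x y → f (g x) (g y)) xs
  pairTotal-map f g []       = refl
  pairTotal-map f g (x ∷ xs) = cong₂ _+_ (total-map (f (g x)) g xs) (pairTotal-map f g xs)

  -- The boolean `_≡ᵇ_` is what `_≟_` computes with, so splitting on it in `total-filter` evaluates
  -- `filter` as well.
  is : ℕ → ℕ → ℕ
  is k l = if k ≡ᵇ l then 1 else 0

  length-filter : ∀ {A : Set} {P : A → Set} (P? : ∀ x → Dec (P x)) (f : A → ℕ) →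
    (∀ x → P x → 1 ≤ f x) → ∀ xs → length (filter P? xs) ≤ total f xs
  length-filter P? f 1≤f []       = z≤n
  length-filter P? f 1≤f (x ∷ xs) with P? x
  ... | yes p = +-mono-≤ (1≤f x p) (length-filter P? f 1≤f xs)
  ... | no  _ = ≤-trans (length-filter P? f 1≤f xs) (m≤n+m _ (f x))

  total-filter : ∀ {A : Set} (d : A → ℕ) k (f : A → ℕ) xs →
    total f (filter (λ x → d x ≟ k) xs) ≡ total (λ x → is (d x) k * f x) xs
  total-filter d k f []       = refl
  total-filter d k f (x ∷ xs) with d x ≡ᵇ k
  ... | true  = cong₂ _+_ (sym (+-identityʳ (f x))) (total-filter d k f xs)
  ... | false = total-filter d k f xs

  crossTotal : ∀ {n} → ℕ → (Point n → Point n → ℕ) → ℕ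
  crossTotal {n} k f = total (λ x → total (λ y → is (distance x y) k * f x y) (allPoints n)) (allPoints n)

  crossTotal-0 : ∀ n (f : Point n → Point n → ℕ) → crossTotal 0 f ≡ sumPoints n (λ x → f x x)
  crossTotal-0 zero    f = trans (+-identityʳ _) (trans (+-identityʳ _) (+-identityʳ (f [] [])))
  crossTotal-0 (suc n) f = begin
    crossTotal 0 f ≡⟨ total-points (suc n) (λ x → total (λ y → is (distance x y) 0 * f x y) (allPoints (suc n))) ⟩
    sumPoints (suc n) (λ x → total (λ y → is (distance x y) 0 * f x y) (allPoints (suc n)))
      ≡⟨ cong₂ _+_ (block −1) (cong₂ _+_ (block O) (block +1)) ⟩
    sumPoints (suc n) (λ x → f x x) ∎
    where
    open ≡-Reasoning
    row : ∀ t x → total (λ y → is (distance (t ∷ x) y) 0 * f (t ∷ x) y) (allPoints (suc n)) ≡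
                  total (λ y → is (distance x y) 0 * f (t ∷ x) (t ∷ y)) (allPoints n)
    row t x = trans (total-points (suc n) (λ y → is (distance (t ∷ x) y) 0 * f (t ∷ x) y))
      (trans (pick t) (sym (total-points n (λ y → is (distance x y) 0 * f (t ∷ x) (t ∷ y)))))
      where
      none : sumPoints n (λ _ → 0) ≡ 0
      none = trans (sym (total-points n (λ _ → 0))) (total-0 (allPoints n))
      pick : ∀ t → sumPoints (suc n) (λ y → is (distance (t ∷ x) y) 0 * f (t ∷ x) y) ≡
                   sumPoints n (λ y → is (distance x y) 0 * f (t ∷ x) (t ∷ y))
      pick −1 rewrite none = +-identityʳ _
      pick O  rewrite none = +-identityʳ _
      pick +1 rewrite none = refl
    block : ∀ t → sumPoints n (λ x → total (λ y → is (distance (t ∷ x) y) 0 * f (t ∷ x) y) (allPoints (suc n))) ≡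
                  sumPoints n (λ x → f (t ∷ x) (t ∷ x))
    block t = trans (sym (total-points n (λ x → total (λ y → is (distance (t ∷ x) y) 0 * f (t ∷ x) y) (allPoints (suc n)))))
      (trans (total-cong (allPoints n) (row t)) (crossTotal-0 n (λ x y → f (t ∷ x) (t ∷ y))))

  edgeTotal : ∀ n → (Point n → Point n → ℕ) → ℕ
  edgeTotal n f = pairTotal (λ x y → is (distance x y) 1 * f x y) (allPoints n)

  -- An edge either keeps the first entry, or changes it between O and ±1 and keeps all others; -1
  -- and +1 are too far apart. In the second case the remaining entries form a pair at distance 0,
  -- and `crossTotal-0` collapses the double sum to its diagonal.
  edgeTotal-suc : ∀ n (f : Point (suc n) → Point (suc n) → ℕ) → edgeTotal (suc n) f ≡
    edgeTotal n (λ x y → f (−1 ∷ x) (−1 ∷ y)) + (edgeTotal n (λ x y → f (O ∷ x) (O ∷ y)) + edgeTotal n (λ x y → f (+1 ∷ x) (+1 ∷ y)))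
    + sumPoints n (λ x → f (−1 ∷ x) (O ∷ x) + f (O ∷ x) (+1 ∷ x))
  edgeTotal-suc n f = begin
    pairTotal g (A ++ B ++ C ++ [])
      ≡⟨ pairTotal-++ g A (B ++ C ++ []) ⟩
    pairTotal g A + total (λ x → total (g x) (B ++ C ++ [])) A + pairTotal g (B ++ C ++ [])
      ≡⟨ cong₂ _+_ (cong₂ _+_ (same −1) acrossA) (trans (pairTotal-++ g B (C ++ []))
           (cong₂ _+_ (cong₂ _+_ (same O) acrossB) (trans (cong (pairTotal g) (++-identityʳ C)) (same +1)))) ⟩
    E₋ + D₋ + (E₀ + D₊ + E₊) ≡⟨ arith E₋ D₋ E₀ D₊ E₊ ⟩
    E₋ + (E₀ + E₊) + (D₋ + D₊) ≡⟨ cong (E₋ + (E₀ + E₊) +_) join ⟨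
    E₋ + (E₀ + E₊) + sumPoints n (λ x → f (−1 ∷ x) (O ∷ x) + f (O ∷ x) (+1 ∷ x)) ∎
    where
    open ≡-Reasoning
    g : Point (suc n) → Point (suc n) → ℕ
    g x y = is (distance x y) 1 * f x y
    A B C : List (Point (suc n))
    A = map (−1 ∷_) (allPoints n)
    B = map (O ∷_) (allPoints n)
    C = map (+1 ∷_) (allPoints n)
    E₋ E₀ E₊ D₋ D₊ : ℕ
    E₋ = edgeTotal n (λ x y → f (−1 ∷ x) (−1 ∷ y))
    E₀ = edgeTotal n (λ x y → f (O ∷ x) (O ∷ y))
    E₊ = edgeTotal n (λ x y → f (+1 ∷ x) (+1 ∷ y))
    D₋ = sumPoints n (λ x → f (−1 ∷ x) (O ∷ x))
    D₊ = sumPoints n (λ x → f (O ∷ x) (+1 ∷ x))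
    arith : ∀ a b c d e → a + b + (c + d + e) ≡ a + (c + e) + (b + d)
    arith = solve-∀
    same : ∀ t → pairTotal g (map (t ∷_) (allPoints n)) ≡ edgeTotal n (λ x y → f (t ∷ x) (t ∷ y))
    same −1 = pairTotal-map g (−1 ∷_) (allPoints n)
    same O  = pairTotal-map g (O ∷_) (allPoints n)
    same +1 = pairTotal-map g (+1 ∷_) (allPoints n)
    far : ∀ x → total (g (−1 ∷ x)) C ≡ 0
    far x = trans (total-map (g (−1 ∷ x)) (+1 ∷_) (allPoints n)) (total-0 (allPoints n))
    acrossA : total (λ x → total (g x) (B ++ C ++ [])) A ≡ D₋
    acrossA = trans (total-map (λ x → total (g x) (B ++ C ++ [])) (−1 ∷_) (allPoints n))
      (trans (total-cong (allPoints n) (λ x → trans (total-++ (g (−1 ∷ x)) B (C ++ []))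
          (trans (cong₂ _+_ (total-map (g (−1 ∷ x)) (O ∷_) (allPoints n))
            (trans (cong (total (g (−1 ∷ x))) (++-identityʳ C)) (far x))) (+-identityʳ _))))
        (crossTotal-0 n (λ x y → f (−1 ∷ x) (O ∷ y))))
    acrossB : total (λ x → total (g x) (C ++ [])) B ≡ D₊
    acrossB = trans (total-map (λ x → total (g x) (C ++ [])) (O ∷_) (allPoints n))
      (trans (total-cong (allPoints n) (λ x → trans (cong (total (g (O ∷ x))) (++-identityʳ C))
          (total-map (g (O ∷ x)) (+1 ∷_) (allPoints n))))
        (crossTotal-0 n (λ x y → f (O ∷ x) (+1 ∷ y))))
    join : sumPoints n (λ x → f (−1 ∷ x) (O ∷ x) + f (O ∷ x) (+1 ∷ x)) ≡ D₋ + D₊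
    join = trans (sym (total-points n (λ x → f (−1 ∷ x) (O ∷ x) + f (O ∷ x) (+1 ∷ x)))) (trans (total-+ (λ x → f (−1 ∷ x) (O ∷ x)) (λ x → f (O ∷ x) (+1 ∷ x)) (allPoints n))
      (cong₂ _+_ (total-points n (λ x → f (−1 ∷ x) (O ∷ x))) (total-points n (λ x → f (O ∷ x) (+1 ∷ x)))))

  differ : Bool → Bool → ℕ
  differ true  true  = 0
  differ false false = 0
  differ _     _     = 1

  differ-comm : ∀ a b → differ a b ≡ differ b a
  differ-comm true  true  = refl
  differ-comm true  false = refl
  differ-comm false true  = refl
  differ-comm false false = refl

  sumPoints-cong : ∀ n {f g : Point n → ℕ} → (∀ x → f x ≡ g x) → sumPoints n f ≡ sumPoints n g
  sumPoints-cong zero    f≡g = f≡g []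
  sumPoints-cong (suc n) f≡g = cong₂ _+_ (sumPoints-cong n (λ x → f≡g (−1 ∷ x)))
    (cong₂ _+_ (sumPoints-cong n (λ x → f≡g (O ∷ x))) (sumPoints-cong n (λ x → f≡g (+1 ∷ x))))

  crossing-U : ∀ {n} (S : Subset n) x → crossing S x ≡ U (λ y → differ (S x) (S y)) x
  crossing-U S x with S x
  ... | true  = U-cong (λ y → lemma (S y)) x
    where
    lemma : ∀ b → (if b then 0 else 1) ≡ differ true b
    lemma true  = refl
    lemma false = refl
  ... | false = U-cong (λ y → lemma (S y)) x
    where
    lemma : ∀ b → (if b then 1 else 0) ≡ differ false b
    lemma true  = refl
    lemma false = refl

  edgeTotal-U : ∀ n (S : Subset n) → edgeTotal n (λ x y → differ (S x) (S y)) ≡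
    sumPoints n (λ x → U (λ y → differ (S x) (S y)) x)
  edgeTotal-U zero    S = refl
  edgeTotal-U (suc n) S = begin
    edgeTotal (suc n) (λ x y → differ (S x) (S y)) ≡⟨ edgeTotal-suc n (λ x y → differ (S x) (S y)) ⟩
    edgeTotal n (λ x y → δ (−1 ∷ x) (−1 ∷ y)) + (edgeTotal n (λ x y → δ (O ∷ x) (O ∷ y)) + edgeTotal n (λ x y → δ (+1 ∷ x) (+1 ∷ y)))
      + sumPoints n (λ x → δ (−1 ∷ x) (O ∷ x) + δ (O ∷ x) (+1 ∷ x))
      ≡⟨ cong₂ _+_ (cong₂ _+_ (edgeTotal-U n (λ x → S (−1 ∷ x)))
           (cong₂ _+_ (edgeTotal-U n (λ x → S (O ∷ x))) (edgeTotal-U n (λ x → S (+1 ∷ x)))))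
           -- In `pairs` the edge between -1 and O starts at -1, whereas `U` leaves from O.
           (sumPoints-cong n (λ x → trans (+-comm (δ (−1 ∷ x) (O ∷ x)) _)
             (cong (δ (O ∷ x) (+1 ∷ x) +_) (differ-comm (S (−1 ∷ x)) (S (O ∷ x)))))) ⟩
    V₋ + (V₀ + V₊) + sumPoints n up ≡⟨ arith V₋ V₀ V₊ (sumPoints n up) ⟩
    V₋ + (sumPoints n up + V₀ + V₊) ≡⟨ cong (λ z → V₋ + (z + V₊)) (trans
      (cong₂ _+_ (sym (total-points n up)) (sym (total-points n v₀)))
      (trans (sym (total-+ up v₀ (allPoints n))) (total-points n (λ x → up x + v₀ x)))) ⟩
    sumPoints (suc n) (λ x → U (λ y → differ (S x) (S y)) x) ∎
    where
    open ≡-Reasoning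
    δ : Point (suc n) → Point (suc n) → ℕ
    δ x y = differ (S x) (S y)
    up v₀ : Point n → ℕ
    up x = δ (O ∷ x) (+1 ∷ x) + δ (O ∷ x) (−1 ∷ x)
    v₀ x = U (λ y → δ (O ∷ x) (O ∷ y)) x
    V₋ V₀ V₊ : ℕ
    V₋ = sumPoints n (λ x → U (λ y → δ (−1 ∷ x) (−1 ∷ y)) x)
    V₀ = sumPoints n v₀
    V₊ = sumPoints n (λ x → U (λ y → δ (+1 ∷ x) (+1 ∷ y)) x)
    arith : ∀ a b c d → a + (b + c) + d ≡ a + (d + b + c)
    arith = solve-∀

  boundaryEdges : ∀ {n} → Subset n → ℕ
  boundaryEdges {n} S = length (filter (λ (u , v) → ¬? (S u ≟ᵇ S v)) (edges n))

  boundaryEdges≤crossing : ∀ {n} (S : Subset n) → boundaryEdges S ≤ sumPoints n (crossing S)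
  boundaryEdges≤crossing {n} S = begin
    boundaryEdges S
      ≤⟨ length-filter (λ (u , v) → ¬? (S u ≟ᵇ S v)) (λ (u , v) → differ (S u) (S v)) (λ (u , v) → differs (S u) (S v)) (edges n) ⟩
    total (λ (u , v) → differ (S u) (S v)) (edges n)
      ≡⟨ total-filter (λ (u , v) → distance u v) 1 (λ (u , v) → differ (S u) (S v)) (pairs (allPoints n)) ⟩
    total (λ (u , v) → is (distance u v) 1 * differ (S u) (S v)) (pairs (allPoints n))
      ≡⟨ total-pairs (λ u v → is (distance u v) 1 * differ (S u) (S v)) (allPoints n) ⟩
    edgeTotal n (λ x y → differ (S x) (S y)) ≡⟨ edgeTotal-U n S ⟩
    sumPoints n (λ x → U (λ y → differ (S x) (S y)) x) ≡⟨ sumPoints-cong n (λ x → sym (crossing-U S x)) ⟩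
    sumPoints n (crossing S) ∎
    where
    open ≤-Reasoning
    differs : ∀ a b → ¬ a ≡ b → 1 ≤ differ a b
    differs true  true  a≢b with () ← a≢b refl
    differs true  false _ = ≤-refl
    differs false true  _ = ≤-refl
    differs false false a≢b with () ← a≢b refl

-- Averaging over the levels, and the bound in integers.

module Total where

  open Walk
  open Sums
  open Levels
  open Flat
  open Hull
  open EdgeCount using (boundaryEdges; boundaryEdges≤crossing)
  open import Data.Bool using (true; false; if_then_else_)
  open import Data.Nat
  open import Data.Nat.Properties
  open import Data.Nat.Tactic.RingSolver using (solve-∀)
  open import Data.Product using (_×_; _,_; ∃-syntax)
  open import Data.Sum using (_⊎_; inj₁; inj₂)
  open import Relation.Binary.PropositionalEquality
  open import Relation.Nullary using (yes; no; does; contradiction)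
  open import Relation.Nullary.Decidable using (dec-true; dec-false)
  open import Defs using (Subset; Convex)

  Σ<-window-≤ : ∀ j t r (f : ℕ → ℕ) → Σ< t (λ s → f (j + s)) ≤ Σ< (j + t + r) f
  Σ<-window-≤ j t r f = begin
    Σ< t (λ s → f (j + s)) ≤⟨ m≤n+m _ (Σ< j f) ⟩
    Σ< j f + Σ< t (λ s → f (j + s)) ≡⟨ Σ<-split j t f ⟨
    Σ< (j + t) f ≤⟨ m≤m+n _ _ ⟩
    Σ< (j + t) f + Σ< r (λ i → f (j + t + i)) ≡⟨ Σ<-split (j + t) r f ⟨
    Σ< (j + t + r) f ∎
    where open ≤-Reasoning

  Σ<-window-≡ : ∀ j t r (f : ℕ → ℕ) → (∀ i → i < j → f i ≡ 0) → (∀ i → j + t ≤ i → i < j + t + r → f i ≡ 0) →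
    Σ< (j + t + r) f ≡ Σ< t (λ s → f (j + s))
  Σ<-window-≡ j t r f left right = begin
    Σ< (j + t + r) f ≡⟨ Σ<-split (j + t) r f ⟩
    Σ< (j + t) f + Σ< r (λ i → f (j + t + i))
      ≡⟨ cong₂ _+_ (Σ<-split j t f) (trans (Σ<-cong r (λ i i<r → right (j + t + i) (m≤m+n (j + t) i) (+-monoʳ-< (j + t) i<r))) (Σ<-zero r)) ⟩
    Σ< j f + Σ< t (λ s → f (j + s)) + 0
      ≡⟨ trans (+-identityʳ _) (cong (_+ Σ< t (λ s → f (j + s))) (trans (Σ<-cong j left) (Σ<-zero j))) ⟩
    Σ< t (λ s → f (j + s)) ∎
    where open ≡-Reasoning

  near : ℕ → ℕ → ℕ → ℕ
  near t i k = if does (∣ i - k ∣ <? t) then 1 else 0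

  near-1 : ∀ t i k → ∣ i - k ∣ < t → near t i k ≡ 1
  near-1 t i k lt = cong (if_then 1 else 0) (dec-true (∣ i - k ∣ <? t) lt)

  near-0 : ∀ t i k → t ≤ ∣ i - k ∣ → near t i k ≡ 0
  near-0 t i k le = cong (if_then 1 else 0) (dec-false (∣ i - k ∣ <? t) (≤⇒≯ le))

  near≤1 : ∀ t i k → near t i k ≤ 1
  near≤1 t i k with does (∣ i - k ∣ <? t)
  ... | true  = ≤-refl
  ... | false = z≤n

  -- t * c i is at most twice the sum of the c k with k near i; exchanging the sums leaves,
  -- for each k, a sum of Z over a window of length 2 t.
  module _ (n t : ℕ) (c Z : ℕ → ℕ) (a W : ℕ) (2t≤n : 2 * t ≤ n)
    (flat : ∀ i → i < n → ∃[ j ] j + t ≤ n × (∀ s → s < t → ∣ i - (j + s) ∣ < t × c i ≤ 2 * c (j + s)))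
    (windows : ∀ j r → j + 2 * t + r ≡ n → a * Σ< (2 * t) (λ s → Z (j + s)) ≤ W) where

    open ≤-Reasoning

    spread : ∀ i → i < n → t * c i ≤ 2 * Σ< n (λ k → near t i k * c k)
    spread i i<n with flat i i<n
    ... | j , j+t≤n , good with m≤n⇒∃[o]m+o≡n j+t≤n
    ...   | r , eq = begin
      t * c i ≡⟨ Σ<-const t (c i) ⟨
      Σ< t (λ _ → c i) ≤⟨ Σ<-mono t (λ s s<t → term s (good s s<t)) ⟩
      Σ< t (λ s → 2 * (near t i (j + s) * c (j + s))) ≡⟨ Σ<-* t 2 _ ⟩
      2 * Σ< t (λ s → near t i (j + s) * c (j + s)) ≤⟨ *-monoʳ-≤ 2 (Σ<-window-≤ j t r (λ k → near t i k * c k)) ⟩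
      2 * Σ< (j + t + r) (λ k → near t i k * c k) ≡⟨ cong (λ m → 2 * Σ< m (λ k → near t i k * c k)) eq ⟩
      2 * Σ< n (λ k → near t i k * c k) ∎
      where
      term : ∀ s → ∣ i - (j + s) ∣ < t × c i ≤ 2 * c (j + s) → c i ≤ 2 * (near t i (j + s) * c (j + s))
      term s (lt , le) = ≤-trans le (≤-reflexive (cong (2 *_)
        (trans (sym (*-identityˡ (c (j + s)))) (cong (_* c (j + s)) (sym (near-1 t i (j + s) lt))))))

    -- The indices near k lie in a window of length 2 t that starts at `k ∸ t`. If this window
    -- overruns `n`, the last 2 t indices take its place.
    collect : ∀ k → k < n → a * Σ< n (λ i → near t i k * Z i) ≤ W
    collect k k<n = from-start (≤-total (k ∸ t + 2 * t) n)
      where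
      too-low : ∀ j → j ≤ k ∸ t → ∀ i → i < j → near t i k * Z i ≡ 0
      too-low j j≤k∸t i i<j = cong (_* Z i) (near-0 t i k (begin
        t ≤⟨ m+n≤o⇒m≤o∸n t (≤-trans (≤-reflexive (+-comm t i)) i+t≤k) ⟩
        k ∸ i ≤⟨ m∸n≤∣m-n∣ k i ⟩
        ∣ k - i ∣ ≡⟨ ∣-∣-comm k i ⟩
        ∣ i - k ∣ ∎))
        where
        i<k∸t : i < k ∸ t
        i<k∸t = ≤-trans i<j j≤k∸t
        i+t≤k : i + t ≤ k
        i+t≤k = ≤-trans (+-monoˡ-≤ t (<⇒≤ i<k∸t)) (≤-reflexive (m∸n+n≡m
          (<⇒≤ (m∸n≢0⇒n<m {k} {t} (λ eq → n≮0 (subst (i <_) eq i<k∸t))))))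
      window : ∀ j r → j + 2 * t + r ≡ n → j ≤ k ∸ t → (∀ i → j + 2 * t ≤ i → i < n → near t i k * Z i ≡ 0) →
        a * Σ< n (λ i → near t i k * Z i) ≤ W
      window j r refl j≤k∸t too-high = begin
        a * Σ< n (λ i → near t i k * Z i)
          ≡⟨ cong (a *_) (Σ<-window-≡ j (2 * t) r (λ i → near t i k * Z i) (too-low j j≤k∸t) too-high) ⟩
        a * Σ< (2 * t) (λ s → near t (j + s) k * Z (j + s))
          ≤⟨ *-monoʳ-≤ a (Σ<-mono (2 * t) (λ s _ → ≤-trans (*-monoˡ-≤ (Z (j + s)) (near≤1 t (j + s) k)) (≤-reflexive (*-identityˡ _)))) ⟩
        a * Σ< (2 * t) (λ s → Z (j + s)) ≤⟨ windows j r refl ⟩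
        W ∎
      from-start : k ∸ t + 2 * t ≤ n ⊎ n ≤ k ∸ t + 2 * t → a * Σ< n (λ i → near t i k * Z i) ≤ W
      from-start (inj₁ le) with m≤n⇒∃[o]m+o≡n le
      ... | r , eq = window (k ∸ t) r eq ≤-refl λ i high _ → cong (_* Z i) (near-0 t i k (begin
          t ≤⟨ m+n≤o⇒m≤o∸n t (begin
            t + k ≤⟨ +-monoʳ-≤ t (m≤n+m∸n k t) ⟩
            t + (t + (k ∸ t)) ≡⟨ arith t (k ∸ t) ⟩
            k ∸ t + 2 * t ≤⟨ high ⟩
            i ∎) ⟩
          i ∸ k ≤⟨ m∸n≤∣m-n∣ i k ⟩
          ∣ i - k ∣ ∎))
        where
        arith : ∀ t d → t + (t + d) ≡ d + 2 * t
        arith = solve-∀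
      from-start (inj₂ n≤) = window (n ∸ 2 * t) 0 (trans (+-identityʳ _) (m∸n+n≡m 2t≤n))
        (≤-trans (∸-monoˡ-≤ (2 * t) n≤) (≤-reflexive (m+n∸n≡m (k ∸ t) (2 * t))))
        λ i high i<n → contradiction (≤-trans (≤-reflexive (sym (m∸n+n≡m 2t≤n))) high) (<⇒≱ i<n)

    weighted-sum : t * a * Σ< n (λ i → c i * Z i) ≤ 2 * (Σ< n c * W)
    weighted-sum = begin
      t * a * Σ< n (λ i → c i * Z i) ≡⟨ arith₁ t a (Σ< n (λ i → c i * Z i)) ⟩
      a * (t * Σ< n (λ i → c i * Z i)) ≡⟨ cong (a *_) (Σ<-* n t (λ i → c i * Z i)) ⟨
      a * Σ< n (λ i → t * (c i * Z i)) ≤⟨ *-monoʳ-≤ a (Σ<-mono n λ i i<n → ≤-trans (≤-reflexive (sym (*-assoc t (c i) (Z i))))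
        (*-monoˡ-≤ (Z i) (spread i i<n))) ⟩
      a * Σ< n (λ i → 2 * Σ< n (λ k → near t i k * c k) * Z i)
        ≡⟨ cong (a *_) (Σ<-cong n λ i _ → trans (arith₂ (Σ< n (λ k → near t i k * c k)) (Z i))
             (trans (cong (2 *_) (sym (Σ<-* n (Z i) (λ k → near t i k * c k))))
               (cong (2 *_) (Σ<-cong n λ k _ → arith₃ (Z i) (near t i k) (c k))))) ⟩
      a * Σ< n (λ i → 2 * Σ< n (λ k → c k * (near t i k * Z i)))
        ≡⟨ cong (a *_) (trans (Σ<-* n 2 (λ i → Σ< n (λ k → c k * (near t i k * Z i))))
             (cong (2 *_) (Σ<-swap n n (λ i k → c k * (near t i k * Z i))))) ⟩
      a * (2 * Σ< n (λ k → Σ< n (λ i → c k * (near t i k * Z i))))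
        ≡⟨ cong (λ z → a * (2 * z)) (Σ<-cong n λ k _ → Σ<-* n (c k) (λ i → near t i k * Z i)) ⟩
      a * (2 * Σ< n (λ k → c k * Σ< n (λ i → near t i k * Z i))) ≡⟨ arith₄ a (Σ< n (λ k → c k * Σ< n (λ i → near t i k * Z i))) ⟩
      2 * (a * Σ< n (λ k → c k * Σ< n (λ i → near t i k * Z i)))
        ≡⟨ cong (2 *_) (trans (sym (Σ<-* n a (λ k → c k * Σ< n (λ i → near t i k * Z i)))) (Σ<-cong n λ k _ → arith₅ a (c k) (Σ< n (λ i → near t i k * Z i)))) ⟩
      2 * Σ< n (λ k → c k * (a * Σ< n (λ i → near t i k * Z i)))
        ≤⟨ *-monoʳ-≤ 2 (Σ<-mono n λ k k<n → *-monoʳ-≤ (c k) (collect k k<n)) ⟩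
      2 * Σ< n (λ k → c k * W)
        ≡⟨ cong (2 *_) (trans (Σ<-cong n λ k _ → *-comm (c k) W) (trans (Σ<-* n W c) (*-comm W (Σ< n c)))) ⟩
      2 * (Σ< n c * W) ∎
      where
      arith₁ : ∀ t a x → t * a * x ≡ a * (t * x)
      arith₁ = solve-∀
      arith₂ : ∀ x z → 2 * x * z ≡ 2 * (z * x)
      arith₂ = solve-∀
      arith₃ : ∀ z x c → z * (x * c) ≡ c * (x * z)
      arith₃ = solve-∀
      arith₄ : ∀ a x → a * (2 * x) ≡ 2 * (a * x)
      arith₄ = solve-∀
      arith₅ : ∀ a c x → a * (c * x) ≡ c * (a * x)
      arith₅ = solve-∀

  -- The search finds the largest t with 16 t² ≤ n, and then n < 16 (t + 1)² ≤ 64 t². The factor 16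
  -- leaves room for the condition 10 t² ≤ n - 1 of `flat-window`.
  scale-√ : ∀ n → 16 ≤ n → ∃[ t ] 1 ≤ t × 16 * (t * t) ≤ n × n ≤ 64 * (t * t)
  scale-√ n 16≤n = search n (≤-trans (m≤m*n (suc n) (suc n)) (m≤n*m (suc n * suc n) 16))
    where
    open ≤-Reasoning
    search : ∀ b → n < 16 * (suc b * suc b) → ∃[ t ] 1 ≤ t × 16 * (t * t) ≤ n × n ≤ 64 * (t * t)
    search zero    n<16 = contradiction 16≤n (<⇒≱ n<16)
    search (suc b) n<   with 16 * (suc b * suc b) ≤? n
    ... | no  ≰n = search b (≰⇒> ≰n)
    ... | yes ≤n = suc b , s≤s z≤n , ≤n , (begin
      n ≤⟨ <⇒≤ n< ⟩
      16 * (suc (suc b) * suc (suc b)) ≤⟨ m≤m+n _ (16 * (b * (3 * b + 4))) ⟩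
      16 * (suc (suc b) * suc (suc b)) + 16 * (b * (3 * b + 4)) ≡⟨ arith b ⟩
      64 * (suc b * suc b) ∎)
      where
      arith : ∀ b → 16 * (suc (suc b) * suc (suc b)) + 16 * (b * (3 * b + 4)) ≡ 64 * (suc b * suc b)
      arith = solve-∀

  -- With T = 2 t and a the central binomial coefficient at T, which is at least 4^T / 2√T.
  clear-binomial : ∀ n t X P a q → 1 ≤ t → .{{_ : NonZero a}} →
    t * a * X ≤ 4 * n * P * q → q * q ≤ 4 * (2 * t) * (a * a) → t * (X * X) ≤ 128 * (n * n) * (P * P)
  clear-binomial n t X P a q 1≤t main lower = *-cancelˡ-≤ (t * (a * a)) (begin
    t * (a * a) * (t * (X * X)) ≡⟨ arith₁ t a X ⟩
    t * a * X * (t * a * X) ≤⟨ *-mono-≤ main main ⟩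
    4 * n * P * q * (4 * n * P * q) ≡⟨ arith₂ n P q ⟩
    16 * (n * n) * (P * P) * (q * q) ≤⟨ *-monoʳ-≤ (16 * (n * n) * (P * P)) lower ⟩
    16 * (n * n) * (P * P) * (4 * (2 * t) * (a * a)) ≡⟨ arith₃ n P t a ⟩
    t * (a * a) * (128 * (n * n) * (P * P)) ∎)
    where
    open ≤-Reasoning
    instance
      t≢0 : NonZero t
      t≢0 = >-nonZero 1≤t
      a²≢0 : NonZero (a * a)
      a²≢0 = m*n≢0 a a
      ta²≢0 : NonZero (t * (a * a))
      ta²≢0 = m*n≢0 t (a * a)
    arith₁ : ∀ t a X → t * (a * a) * (t * (X * X)) ≡ t * a * X * (t * a * X)
    arith₁ = solve-∀
    arith₂ : ∀ n P q → 4 * n * P * q * (4 * n * P * q) ≡ 16 * (n * n) * (P * P) * (q * q)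
    arith₂ = solve-∀
    arith₃ : ∀ n P t a → 16 * (n * n) * (P * P) * (4 * (2 * t) * (a * a)) ≡ t * (a * a) * (128 * (n * n) * (P * P))
    arith₃ = solve-∀

  abstract

    -- The 64 comes from n ≤ 64 t² and the 128 from `clear-binomial`. The product is 2²⁰, the fourth
    -- power of 32.
    influenceConstant⁴ : ℕ
    influenceConstant⁴ = 64 * (128 * 128)

    influenceConstant⁴≡64*128² : influenceConstant⁴ ≡ 64 * (128 * 128)
    influenceConstant⁴≡64*128² = refl

    influenceConstant⁴≡32⁴ : influenceConstant⁴ ≡ 32 * 32 * (32 * 32)
    influenceConstant⁴≡32⁴ = refl

  -- Squaring once more gives t² X⁴ ≤ c² n⁴ P⁴. Since n ≤ b t², it follows that n X⁴ ≤ b c² n⁴ P⁴,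
  -- and one factor n cancels; this is the origin of the exponent 3/4.
  clear-scale : ∀ b c K n t E X P → K ≡ b * (c * c) → 1 ≤ n → E ≤ X → n ≤ b * (t * t) → t * (X * X) ≤ c * (n * n) * (P * P) →
    E * E * (E * E) ≤ K * (n * n * n) * (P * P * (P * P))
  clear-scale b c _ n t E X P refl 1≤n E≤X n≤bt² le = *-cancelˡ-≤ n (begin
    n * (E * E * (E * E)) ≤⟨ *-monoʳ-≤ n (*-mono-≤ (*-mono-≤ E≤X E≤X) (*-mono-≤ E≤X E≤X)) ⟩
    n * (X * X * (X * X)) ≤⟨ *-monoˡ-≤ (X * X * (X * X)) n≤bt² ⟩
    b * (t * t) * (X * X * (X * X)) ≡⟨ arith₁ b t X ⟩
    b * (t * (X * X) * (t * (X * X))) ≤⟨ *-monoʳ-≤ b (*-mono-≤ le le) ⟩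
    b * (c * (n * n) * (P * P) * (c * (n * n) * (P * P))) ≡⟨ arith₂ b c n P ⟩
    n * (b * (c * c) * (n * n * n) * (P * P * (P * P))) ∎)
    where
    open ≤-Reasoning
    instance
      n≢0 : NonZero n
      n≢0 = >-nonZero 1≤n
    arith₁ : ∀ b t X → b * (t * t) * (X * X * (X * X)) ≡ b * (t * (X * X) * (t * (X * X)))
    arith₁ = solve-∀
    arith₂ : ∀ b c n P → b * (c * (n * n) * (P * P) * (c * (n * n) * (P * P))) ≡ n * (b * (c * c) * (n * n * n) * (P * P * (P * P)))
    arith₂ = solve-∀

  -- The 3 of `crossings-bound` is kept next to `p`: the weights sum to p = 3ⁿ⁻¹, so `3 * p` becomes
  -- 3ⁿ.
  combine : ∀ M t a X n s p q .{{_ : NonZero M}} →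
    t * a * s ≤ 2 * (p * (3 * q * M)) → M * X ≡ 2 * n * s → t * a * X ≤ 4 * n * (3 * p) * q
  combine M t a X n s p q weighted rescaled = *-cancelˡ-≤ M (begin
    M * (t * a * X) ≡⟨ arith₁ M (t * a) X ⟩
    t * a * (M * X) ≡⟨ cong (t * a *_) rescaled ⟩
    t * a * (2 * n * s) ≡⟨ arith₁ (t * a) (2 * n) s ⟩
    2 * n * (t * a * s) ≤⟨ *-monoʳ-≤ (2 * n) weighted ⟩
    2 * n * (2 * (p * (3 * q * M))) ≡⟨ arith₂ n p q M ⟩
    M * (4 * n * (3 * p) * q) ∎)
    where
    open ≤-Reasoning
    arith₁ : ∀ a b c → a * (b * c) ≡ b * (a * c)
    arith₁ = solve-∀
    arith₂ : ∀ n p q m → 2 * n * (2 * (p * (3 * q * m))) ≡ m * (4 * n * (3 * p) * q)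
    arith₂ = solve-∀

  boundaryEdges-bound-at : ∀ N (S : Subset (suc N)) → Convex S →
    ∀ t → 1 ≤ t → 16 * (t * t) ≤ suc N → suc N ≤ 64 * (t * t) →
    boundaryEdges S * boundaryEdges S * (boundaryEdges S * boundaryEdges S) ≤
    influenceConstant⁴ * (suc N * suc N * suc N) * (3 ^ suc N * 3 ^ suc N * (3 ^ suc N * 3 ^ suc N))
  boundaryEdges-bound-at N S conv t 1≤t 16t²≤n n≤64t² =
      clear-scale 64 128 influenceConstant⁴ n t (boundaryEdges S) X P influenceConstant⁴≡64*128² (s≤s z≤n)
        (boundaryEdges≤crossing S) n≤64t² (clear-binomial n t X P a (4 ^ T) 1≤t {{a≢0}} main lower)
    where
    open ≤-Reasoning
    n T X P a M : ℕ
    n = suc N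
    -- Walks of 2 t steps cover all levels closer than t to a given one, on both sides.
    T = 2 * t
    X = sumPoints n (crossing S)
    P = 3 ^ n
    a = centralBinomial T
    M = n ! * 2 ^ n

    t≤t² : t ≤ t * t
    t≤t² = m≤m*n t t {{>-nonZero 1≤t}}

    10t²≤N : 10 * (t * t) ≤ N
    10t²≤N = s≤s⁻¹ (begin
      suc (10 * (t * t)) ≤⟨ +-monoˡ-≤ (10 * (t * t)) (≤-trans 1≤t (≤-trans t≤t² (m≤n*m (t * t) 6))) ⟩
      6 * (t * t) + 10 * (t * t) ≡⟨ *-distribʳ-+ (t * t) 6 10 ⟨
      16 * (t * t) ≤⟨ 16t²≤n ⟩
      n ∎)

    T≤n : T ≤ n
    T≤n = ≤-trans (*-mono-≤ {2} {16} (s≤s (s≤s z≤n)) t≤t²) 16t²≤n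

    lower : 4 ^ T * 4 ^ T ≤ 4 * (2 * t) * (a * a)
    lower with m≤n⇒∃[o]m+o≡n {1} {T} (≤-trans 1≤t (m≤n*m t 2))
    ... | o , eq = subst (λ u → 4 ^ u * 4 ^ u ≤ 4 * u * (centralBinomial u * centralBinomial u)) eq
      (subst (_≤ 4 * suc o * (centralBinomial (suc o) * centralBinomial (suc o))) (16^ (suc o)) (centralBinomial-lower o))
      where
      16^ : ∀ k → 16 ^ k ≡ 4 ^ k * 4 ^ k
      16^ k = trans (^-*-assoc 4 2 k) (trans (cong (λ e → 4 ^ (k + e)) (+-identityʳ k)) (^-distribˡ-+-* 4 k k))

    a≢0 : NonZero a
    a≢0 = ≢-nonZero λ a≡0 → n≮0 (≤-trans (*-mono-≤ (m^n>0 4 T) (m^n>0 4 T))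
      (≤-trans lower (≤-reflexive (trans (cong (λ z → 4 * (2 * t) * (z * z)) a≡0) (*-zeroʳ (4 * (2 * t)))))))

    M≢0 : NonZero M
    M≢0 = m*n≢0 (n !) (2 ^ n) {{n !≢0}} {{m^n≢0 2 n}}

    weighted : t * a * Σ< n (λ i → levelSize N i * crossingRate S i) ≤ 2 * (Σ< n (levelSize N) * (3 * 4 ^ T * M))
    weighted = weighted-sum n t (levelSize N) (crossingRate S) a (3 * 4 ^ T * M) T≤n
      (λ { i (s≤s i≤N) → flat-window N t 1≤t 10t²≤N i i≤N })
      (λ j r eq → window-bound S (λ u x x∉S → convex-stay S x conv x∉S u) T r j eq)

    rescaled : M * X ≡ 2 * n * Σ< n (λ i → levelSize N i * crossingRate S i)
    rescaled = begin-equality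
      M * X ≡⟨ cong (M *_) (sum-crossingAt S) ⟨
      M * Σ< n (crossingAt S) ≡⟨ Σ<-* n M (crossingAt S) ⟨
      Σ< n (λ i → M * crossingAt S i) ≡⟨ Σ<-cong n (λ { i (s≤s i≤N) → rate i i≤N }) ⟩
      Σ< n (λ i → 2 * n * (levelSize N i * crossingRate S i)) ≡⟨ Σ<-* n (2 * n) (λ i → levelSize N i * crossingRate S i) ⟩
      2 * n * Σ< n (λ i → levelSize N i * crossingRate S i) ∎
      where
      rate : ∀ i → i ≤ N → M * crossingAt S i ≡ 2 * n * (levelSize N i * crossingRate S i)
      rate i i≤N = trans (crossingRate-crossingAt S (N ∸ i) i (cong suc (sym (m∸n+n≡m i≤N))))
        (trans (cong (λ m → 2 * n * levelSize m i * crossingRate S i) (m∸n+n≡m i≤N))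
               (*-assoc (2 * n) (levelSize N i) (crossingRate S i)))

    main : t * a * X ≤ 4 * n * P * 4 ^ T
    main = combine M t a X n _ (3 ^ N) (4 ^ T) {{M≢0}}
      (≤-trans weighted (≤-reflexive (cong (λ z → 2 * (z * (3 * 4 ^ T * M))) (trans (sum-levels N (λ _ → 1)) (sumPoints-1 N)))))
      rescaled

  boundaryEdges-bound : ∀ n (S : Subset n) → Convex S → 16 ≤ n →
    boundaryEdges S * boundaryEdges S * (boundaryEdges S * boundaryEdges S) ≤
    influenceConstant⁴ * (n * n * n) * (3 ^ n * 3 ^ n * (3 ^ n * 3 ^ n))
  boundaryEdges-bound (suc N) S conv 16≤n =
    let t , 1≤t , 16t²≤n , n≤64t² = scale-√ (suc N) 16≤n
    in boundaryEdges-bound-at N S conv t 1≤t 16t²≤n n≤64t²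

-- The bound in rationals, and approximate fourth roots.

module Rational where

  open import Defs hiding (_+_; _≤_)
  open Hull using (/1-*; m*1/m)
  open EdgeCount using (boundaryEdges)
  open Total using (boundaryEdges-bound; influenceConstant⁴; influenceConstant⁴≡32⁴)
  open import Data.Integer as ℤ using (ℤ; +_)
  import Data.Integer.Properties as ℤP
  import Data.Integer.Tactic.RingSolver as ℤSolver
  open import Data.Nat as ℕ using (ℕ; zero; suc)
  open import Data.Nat.Logarithm using (⌊log₂_⌋; ⌊log₂⌋-mono-≤; ⌊log₂[2^n]⌋≡n)
  import Data.Nat.Properties as ℕP
  open import Data.Rational as ℚ using (ℚ; 0ℚ; 1ℚ; _≤_; _<_; _*_; _+_; _/_)
  open import Data.Rational.Properties
  open import Data.Rational.Solver using (module +-*-Solver)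
  import Data.Rational.Unnormalised as ℚᵘ
  import Data.Rational.Unnormalised.Properties as ℚᵘP
  open import Relation.Binary.PropositionalEquality

  ι : ℕ → ℚ
  ι m = + m / 1

  ι-* : ∀ a b → ι (a ℕ.* b) ≡ ι a * ι b
  ι-* a b = trans (cong (_/ 1) (ℤP.pos-* a b)) (/1-* (+ a) (+ b))

  ι-mono : ∀ {a b} → a ℕ.≤ b → ι a ≤ ι b
  ι-mono {a} {b} a≤b = /-mono a b 0 0 (ℕP.*-monoˡ-≤ 1 a≤b)

  0≤ι : ∀ a → 0ℚ ≤ ι a
  0≤ι a = 0≤a/k a 0

  e/m*m : ∀ e m .{{_ : ℕ.NonZero m}} → (+ e / m) * ι m ≡ ι e
  e/m*m e (suc k) = toℚᵘ-injective (ℚᵘP.≃-trans (toℚᵘ-homo-* (+ e / suc k) (ι (suc k)))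
    (ℚᵘP.≃-trans (ℚᵘP.*-cong (toℚᵘ-fromℚᵘ (ℚᵘ.mkℚᵘ (+ e) k)) (toℚᵘ-fromℚᵘ (ℚᵘ.mkℚᵘ (+ suc k) 0)))
    (ℚᵘP.≃-trans (ℚᵘ.*≡* (arith (+ e) (+ suc k))) (ℚᵘP.≃-sym (toℚᵘ-fromℚᵘ (ℚᵘ.mkℚᵘ (+ e) 0))))))
    where
    arith : ∀ e m → e ℤ.* m ℤ.* ℤ.1ℤ ≡ e ℤ.* (m ℤ.* ℤ.1ℤ)
    arith = ℤSolver.solve-∀

  ι-⁴ : ∀ a → ι (a ℕ.* a ℕ.* (a ℕ.* a)) ≡ ι a ^ 4
  ι-⁴ a = trans (ι-* (a ℕ.* a) (a ℕ.* a)) (trans (cong (λ z → z * z) (ι-* a a)) (arith (ι a)))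
    where
    open +-*-Solver
    arith : ∀ x → x * x * (x * x) ≡ x * (x * (x * (x * 1ℚ)))
    arith = solve 1 (λ x → x :* x :* (x :* x) := x :* (x :* (x :* (x :* con 1ℚ)))) refl

  ι-³ : ∀ a → ι (a ℕ.* a ℕ.* a) ≡ ι a ^ 3
  ι-³ a = trans (ι-* (a ℕ.* a) a) (trans (cong (_* ι a) (ι-* a a)) (arith (ι a)))
    where
    open +-*-Solver
    arith : ∀ x → x * x * x ≡ x * (x * (x * 1ℚ))
    arith = solve 1 (λ x → x :* x :* x := x :* (x :* (x :* con 1ℚ))) refl

  *-^4 : ∀ x y → (x * y) ^ 4 ≡ x ^ 4 * y ^ 4
  *-^4 = solve 2 (λ x y → (x :* y) :* ((x :* y) :* ((x :* y) :* ((x :* y) :* con 1ℚ))) :=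
                          (x :* (x :* (x :* (x :* con 1ℚ)))) :* (y :* (y :* (y :* (y :* con 1ℚ))))) refl
    where open +-*-Solver

  abstract

    influenceConstant influenceConstant⁻¹ : ℚ
    influenceConstant   = ι 32
    influenceConstant⁻¹ = + 1 / 32

    influenceConstant-pos : 0ℚ < influenceConstant
    influenceConstant-pos = positive⁻¹ (ι 32)

    influenceConstant⁻¹-pos : 0ℚ < influenceConstant⁻¹
    influenceConstant⁻¹-pos = positive⁻¹ (+ 1 / 32)

    influenceConstant-inverse : influenceConstant * influenceConstant⁻¹ ≡ 1ℚ
    influenceConstant-inverse = m*1/m 31

    influenceConstant^4 : ι influenceConstant⁴ ≡ influenceConstant ^ 4
    influenceConstant^4 = trans (cong ι influenceConstant⁴≡32⁴) (ι-⁴ 32)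

  private
    C : ℚ
    C = influenceConstant

    instance
      C-pos : ℚ.Positive C
      C-pos = ℚ.positive influenceConstant-pos

      C-nonNeg : ℚ.NonNegative C
      C-nonNeg = pos⇒nonNeg C

      C⁴-pos : ℚ.Positive (C ^ 4)
      C⁴-pos = ℚ.positive (^-pos C influenceConstant-pos)

      C⁴-nonNeg : ℚ.NonNegative (C ^ 4)
      C⁴-nonNeg = pos⇒nonNeg (C ^ 4)

  quotient⁴ : ∀ E P K n x c → x * ι P ≡ ι E → 1 ℕ.≤ P → ι K ≡ c ^ 4 →
    E ℕ.* E ℕ.* (E ℕ.* E) ℕ.≤ K ℕ.* (n ℕ.* n ℕ.* n) ℕ.* (P ℕ.* P ℕ.* (P ℕ.* P)) →
    x ^ 4 ≤ c ^ 4 * ι n ^ 3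
  quotient⁴ E P K n x c x*P≡E 1≤P K≡c⁴ le = *-cancelʳ-≤-pos (ι P ^ 4) {{ℚ.positive (^-pos (ι P) 0<ιP)}} (begin
    x ^ 4 * ι P ^ 4 ≡⟨ *-^4 x (ι P) ⟨
    (x * ι P) ^ 4 ≡⟨ cong (_^ 4) x*P≡E ⟩
    ι E ^ 4 ≡⟨ ι-⁴ E ⟨
    ι (E ℕ.* E ℕ.* (E ℕ.* E)) ≤⟨ ι-mono le ⟩
    ι (K ℕ.* (n ℕ.* n ℕ.* n) ℕ.* (P ℕ.* P ℕ.* (P ℕ.* P))) ≡⟨ ι-* (K ℕ.* (n ℕ.* n ℕ.* n)) (P ℕ.* P ℕ.* (P ℕ.* P)) ⟩
    ι (K ℕ.* (n ℕ.* n ℕ.* n)) * ι (P ℕ.* P ℕ.* (P ℕ.* P))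
      ≡⟨ cong₂ _*_ (trans (ι-* K (n ℕ.* n ℕ.* n)) (cong₂ _*_ K≡c⁴ (ι-³ n))) (ι-⁴ P) ⟩
    c ^ 4 * ι n ^ 3 * ι P ^ 4 ∎)
    where
    open ≤-Reasoning
    0<ιP : 0ℚ < ι P
    0<ιP = <-≤-trans (positive⁻¹ 1ℚ) (ι-mono 1≤P)

  influence*3^n : ∀ n (S : Subset n) → 𝕀 S * ι (3 ℕ.^ n) ≡ ι (boundaryEdges S)
  influence*3^n n S = e/m*m (boundaryEdges S) (3 ℕ.^ n) {{ℕP.m^n≢0 3 n}}

  influence⁴ : ∀ n (S : Subset n) → Convex S → 16 ℕ.≤ n → 𝕀 S ^ 4 ≤ C ^ 4 * ι n ^ 3
  influence⁴ n S conv 16≤n = quotient⁴ (boundaryEdges S) (3 ℕ.^ n) influenceConstant⁴ n (𝕀 S) C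
    (influence*3^n n S) (ℕP.m^n>0 3 n) influenceConstant^4 (boundaryEdges-bound n S conv 16≤n)

  1≤log₂ : ∀ n → 2 ℕ.≤ n → ∀ k → 1ℚ ≤ seq (log₂ n) k
  1≤log₂ n 2≤n k = /-mono 1 ⌊log₂ (n ℕ.^ suc k) ⌋ 0 k (begin
    1 ℕ.* suc k ≡⟨ ℕP.*-identityˡ (suc k) ⟩
    suc k ≡⟨ ⌊log₂[2^n]⌋≡n (suc k) ⟨
    ⌊log₂ (2 ℕ.^ suc k) ⌋ ≤⟨ ⌊log₂⌋-mono-≤ (ℕP.^-monoˡ-≤ (suc k) 2≤n) ⟩
    ⌊log₂ (n ℕ.^ suc k) ⌋ ≡⟨ ℕP.*-identityʳ _ ⟨
    ⌊log₂ (n ℕ.^ suc k) ⌋ ℕ.* 1 ∎)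
    where open ℕP.≤-Reasoning

  module _ (y q x : ℚ) (y≤q : y ≤ q) (x⁴≤ : x ^ 4 ≤ C ^ 4 * y) (k : ℕ) where

    open ≤-Reasoning

    -- Fourth powers are compared instead of roots: a larger `x` would have a fourth power above C⁴
    -- q ≥ C⁴ y.
    ≤C*rootAbove : x ≤ C * rootAbove q k
    ≤C*rootAbove = ≮⇒≥ λ lt → <-irrefl refl (begin-strict
      C ^ 4 * y ≤⟨ *-monoˡ-≤-nonNeg (C ^ 4) y≤q ⟩
      C ^ 4 * q <⟨ *-monoʳ-<-pos (C ^ 4) (rootAbove-upper q k) ⟩
      C ^ 4 * rootAbove q k ^ 4 ≡⟨ *-^4 C (rootAbove q k) ⟨
      (C * rootAbove q k) ^ 4 <⟨ ^-mono-< 3 0≤C*root lt ⟩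
      x ^ 4 ≤⟨ x⁴≤ ⟩
      C ^ 4 * y ∎)
      where
      0≤C*root : 0ℚ ≤ C * rootAbove q k
      0≤C*root = subst (_≤ C * rootAbove q k) (*-zeroʳ C) (*-monoˡ-≤-nonNeg C (0≤rootAbove q k))

    -- The terms of `∜_` are values of `rootBelow`, which misses `rootAbove` by 1 / (k + 1).
    -- Multiplied by C, this error has to be at most ε.
    ≤C*rootBelow : ∀ ε → + 1 / suc k ≤ influenceConstant⁻¹ * ε → x ≤ C * rootBelow q k + ε
    ≤C*rootBelow ε small = begin
      x ≤⟨ ≤C*rootAbove ⟩
      C * rootAbove q k ≡⟨ cong (C *_) (rootAbove-split q k) ⟩
      C * (rootBelow q k + + 1 / suc k) ≡⟨ *-distribˡ-+ C (rootBelow q k) (+ 1 / suc k) ⟩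
      C * rootBelow q k + C * (+ 1 / suc k)
        ≤⟨ +-monoʳ-≤ (C * rootBelow q k) (*-monoˡ-≤-nonNeg C small) ⟩
      C * rootBelow q k + C * (influenceConstant⁻¹ * ε)
        ≡⟨ cong (λ z → C * rootBelow q k + z) (trans (sym (*-assoc C influenceConstant⁻¹ ε))
             (trans (cong (_* ε) influenceConstant-inverse) (*-identityˡ ε))) ⟩
      C * rootBelow q k + ε ∎

  -- Here the logarithm of the theorem comes in, as a factor each of whose approximations is at
  -- least 1.
  n³≤n³*log₂ : ∀ n → 2 ℕ.≤ n → ∀ k → ι n ^ 3 ≤ ι n ^ 3 * seq (log₂ n) k
  n³≤n³*log₂ n 2≤n k = subst (_≤ ι n ^ 3 * seq (log₂ n) k) (*-identityʳ (ι n ^ 3))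
    (*-monoˡ-≤-nonNeg (ι n ^ 3) {{ℚ.nonNegative (^-nonNeg 3 (0≤ι n))}} (1≤log₂ n 2≤n k))

-- The bound as an inequality between Cauchy sequences.

open import Defs
open import Data.Integer using (+_)
open import Data.Nat using (ℕ) renaming (_≤_ to _≤ℕ_)
open import Data.Product using (∃-syntax; _×_; _,_)
open import Data.Rational using (ℚ; 0ℚ; _<_; _/_)
import Data.Nat.Properties as ℕP
import Data.Rational as ℚ
import Data.Rational.Properties as ℚP
open import Relation.Binary.PropositionalEquality using (subst)

theorem1p4 : ∃[ C ] (0ℚ < C) × (∃[ N ] ∀ (n : ℕ) → N ≤ℕ n → (S : Subset n) → Convex S →
    fromℚ (𝕀 S) ≤ C · ∜ ((+ n / 1) ^ 3 · log₂ n))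
theorem1p4 = influenceConstant , influenceConstant-pos , 16 , λ n 16≤n S conv ε 0<ε →
  -- From `N` on, the grid width 1 / (k + 1) of the approximate root is at most ε / C.
  let N , small = archimedean (influenceConstant⁻¹ ℚ.* ε) (0<1/C*ε ε 0<ε)
      2≤n       = ℕP.≤-trans (ℕP.m≤m+n 2 14) 16≤n
  in N , λ k N≤k → ≤C*rootBelow ((+ n / 1) ^ 3) ((+ n / 1) ^ 3 ℚ.* seq (log₂ n) k) (𝕀 S)
       (n³≤n³*log₂ n 2≤n k) (influence⁴ n S conv 16≤n) k ε (small k N≤k)
  where
  open Rational
  0<1/C*ε : ∀ ε → 0ℚ < ε → 0ℚ < influenceConstant⁻¹ ℚ.* ε
  0<1/C*ε ε 0<ε = subst (_< influenceConstant⁻¹ ℚ.* ε) (ℚP.*-zeroʳ influenceConstant⁻¹)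
    (ℚP.*-monoʳ-<-pos influenceConstant⁻¹ {{ℚ.positive influenceConstant⁻¹-pos}} 0<ε)
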